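{- There exists a constant $c>0$ such that for every finite graph $H$ with an even number of edges there is $n_0$ such that for all $n\geq n_0$ we have $r_H(n)\geq c\log n$, and consequently $$d^{\mathrm{lin}}_H(n)\leq (c\log n)^{ -1}.$$
   Context: $\log$ denotes the natural logarithm. For $n\in\mathbb{N}$, $K_n$ is the complete graph on vertex set $[n]=\{1,\dots,n\}$. An edge coloring $\chi$ of $K_n$ admits an even-chromatic copy of a graph $H$ if there is an injective map $f\colon V(H)\to [n]$ such that for every color $\gamma$, the number of edges $uv\in E(H)$ with $\chi(f(u)f(v))=\gamma$ is even (possibly zero). $r_H(n)$ is the minimum number of colors in an edge coloring of $K_n$ that admits no even-chromatic copy of $H$ (and $r_H(n)=\infty$ if no such coloring exists). The graphs on vertex set $[n]$ form an $\mathbb{F}_2$-vector space $\mathbb{F}_2^{K_n}$, where the sum of two graphs is the graph on $[n]$ whose edge set is the symmetric difference of their edge sets. A graph $G$ on $[n]$ is a copy of $H$ if there is $S\subseteq[n]$ such that $G[S]$ is isomorphic to $H$ and every vertex of $[n]\setminus S$ is isolated in $G$. Define $d^{\mathrm{lin}}_H(n)=2^{ -\binom n2}\max\{|\mathcal C|:\mathcal C\text{ is an }\mathbb{F}_2\text{ -subspace of }\mathbb{F}_2^{K_n}\text{ containing no copy of }H\}$. -}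

module Defs where

open import Data.Nat using (ℕ; zero; suc; _+_; _<ᵇ_)
open import Data.Fin using (Fin; toℕ; _≟_)
open import Data.Bool using (Bool; true; false; _∧_; _xor_; if_then_else_)
open import Data.List using (List; map; length)
open import Data.Nat.ListAction using (sum)
open import Data.List.Base using (allFin)
open import Data.List.Membership.Propositional using (_∈_)
open import Data.List.Relation.Unary.AllPairs using (AllPairs)
open import Data.Product using (Σ; ∃; ∃-syntax; _×_)
open import Relation.Binary.PropositionalEquality using (_≡_)
open import Relation.Nullary using (¬_; does)
open import Function.Definitions using (Injective)

record SimpleGraph (n : ℕ) : Set where
  field
    adj    : Fin n → Fin n → Bool
    sym    : ∀ i j → adj i j ≡ adj j i
    irrefl : ∀ i → adj i i ≡ false
open SimpleGraph public

countPairs : {n : ℕ} → (Fin n → Fin n → Bool) → ℕ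
countPairs {n} P =
  sum (map (λ i → sum (map (λ j →
        if (toℕ i <ᵇ toℕ j) ∧ P i j then 1 else 0) (allFin n))) (allFin n))

edgeCount : {n : ℕ} → SimpleGraph n → ℕ
edgeCount G = countPairs (adj G)

-- An edge colouring of K_n with (at most) m colours (colours Fin m);
-- the value on the diagonal is irrelevant.
record Coloring (n m : ℕ) : Set where
  field
    col    : Fin n → Fin n → Fin m
    colSym : ∀ i j → col i j ≡ col j i
open Coloring public

EvenChromaticCopy : {h n m : ℕ} → SimpleGraph h → Coloring n m → Set
EvenChromaticCopy {h} {n} {m} H χ =
  Σ (Fin h → Fin n) λ f →
    Injective _≡_ _≡_ f ×
    (∀ (γ : Fin m) → Data.Nat.Divisibility._∣_ 2
       (countPairs (λ u v → adj H u v ∧ does (col χ (f u) (f v) ≟ γ))))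
  where import Data.Nat.Divisibility

_+G_ : {n : ℕ} → SimpleGraph n → SimpleGraph n → SimpleGraph n
adj (G +G G') i j = adj G i j xor adj G' i j
sym (G +G G') i j rewrite sym G i j | sym G' i j = Relation.Binary.PropositionalEquality.refl
  where import Relation.Binary.PropositionalEquality
irrefl (G +G G') i rewrite irrefl G i | irrefl G' i = Relation.Binary.PropositionalEquality.refl
  where import Relation.Binary.PropositionalEquality

_≈G_ : {n : ℕ} → SimpleGraph n → SimpleGraph n → Set
G ≈G G' = ∀ i j → adj G i j ≡ adj G' i j

emptyGraph : (n : ℕ) → SimpleGraph n
adj (emptyGraph n) i j = false
sym (emptyGraph n) i j = Relation.Binary.PropositionalEquality.refl
  where import Relation.Binary.PropositionalEquality
irrefl (emptyGraph n) i = Relation.Binary.PropositionalEquality.refl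
  where import Relation.Binary.PropositionalEquality

IsCopyOf : {n h : ℕ} → SimpleGraph n → SimpleGraph h → Set
IsCopyOf {n} {h} G H =
  Σ (Fin h → Fin n) λ f →
    Injective _≡_ _≡_ f ×
    (∀ u v → adj G (f u) (f v) ≡ adj H u v) ×
    (∀ a b → adj G a b ≡ true → (∃[ u ] f u ≡ a) × (∃[ v ] f v ≡ b))

record Subspace (n : ℕ) : Set where
  field
    elems    : List (SimpleGraph n)
    distinct : AllPairs (λ G G' → ¬ (G ≈G G')) elems
    hasZero  : ∃[ G ] (G ∈ elems × G ≈G emptyGraph n)
    closed   : ∀ {G G'} → G ∈ elems → G' ∈ elems →
               ∃[ G'' ] (G'' ∈ elems × G'' ≈G (G +G G'))
open Subspace public

size : {n : ℕ} → Subspace n → ℕ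
size C = length (elems C)

{-# OPTIONS --safe #-}
module Submission where

-- Call distinct vertices x, y, s, t a square if col x s = col x t, col y s = col y t and col x y = col s t; a square is
-- an even-chromatic K₄.
--
-- Squares suffice: split off from H a vertex of even degree, or two non-adjacent vertices of odd degree (mapped to
-- vertices with a large common neighbourhood in one colour), or else, when H is complete with all degrees odd, four
-- vertices mapped to a square.  The rest of H goes to a set towards which each vertex of the split-off block is
-- monochromatic, at the cost of a factor O(m⁴), which is negligible against 2^(k m).
--
-- Squares exist: if X and T are such that every vertex of X is monochromatic towards T, then without squares no colour
-- inside T occurs inside X.  Let X maximise |X| 2^(-ρ #colours(X)), and suppose that half of the w ∈ X have a colour
-- class Y_w with |Y_w| ≥ |X| / b.  If each Y_w contained a large subset with all colour degrees tiny, then for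
-- r ≈ (log b)² most r-tuples of it would be rainbow, and averaging over w gives a rainbow r-tuple T that is
-- monochromatic towards at least |X| b^(-O(r)) vertices, a set which lacks about r²/2 of the colours of X,
-- contradicting maximality.  So some Y_w has large colour degrees throughout, and we pass to a maximising subset of it,
-- with b replaced by polylog(b) and with ρ slightly decreased to pay for the loss.  When b reaches a constant, pairs T
-- already give a contradiction.
--
-- Subspaces: colour an edge by its coset modulo 𝒞.  An even-chromatic copy of H is then a copy of H in 𝒞, and the
-- number m of colours satisfies m |𝒞| ≤ 2^(n choose 2).

open import Defs hiding (sym)
open import Data.Nat using (ℕ; zero; suc; _+_; _*_; _∸_; _^_; _≤_; _<_; _<ᵇ_; _≤?_; _<?_; z≤n; s≤s; NonZero; >-nonZero)
open import Data.Nat.Properties hiding (suc-injective)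
open import Data.Nat.Combinatorics using (_C_; nC1≡n; nCk+nC[k+1]≡[n+1]C[k+1])
open import Data.Nat.Divisibility using (_∣_; divides)
open import Data.Nat.DivMod using (_/_; _%_; m/n*n≤m; m≡m%n+[m/n]*n; m%n<n)
open import Data.Nat.ListAction using () renaming (sum to sumᴸ)
open import Data.Nat.Tactic.RingSolver using (solve-∀)
open import Data.Bool using (Bool; true; false; T; _∧_; _∨_; _xor_; not; if_then_else_) renaming (_≟_ to _≟ᵇ_)
open import Data.Bool.Properties using (not-involutive; ∨-comm; ∧-comm; ∧-identityʳ; ∧-zeroʳ; xor-assoc; xor-comm; xor-same; xor-identityʳ)
open import Data.Fin using (Fin; zero; suc; toℕ; combine; remQuot; inject≤; funToFin; finToFun) renaming (_≟_ to _≟ᶠ_; _<_ to _<ᶠ_)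
open import Data.Fin.Properties using (any?; all?; suc-injective; pigeonhole; combine-injective; combine-remQuot; inject≤-injective; finToFun-funToFin) renaming (_≤?_ to _≤ᶠ?_; ≤-antisym to ≤ᶠ-antisym; <⇒≢ to <ᶠ⇒≢; <-cmp to <ᶠ-cmp)
open import Data.Vec using (Vec; []; _∷_)
open import Data.Vec.Membership.Propositional using () renaming (_∈_ to _∈ᵥ_)
open import Data.Vec.Relation.Unary.Any using (here; there)
open import Data.List using (List; []; _∷_; _++_; length; map; lookup; allFin; cartesianProductWith)
open import Data.List.Properties using (++-assoc; length-++; length-map; length-tabulate; map-++; map-∘)
open import Data.List.Membership.Propositional using (_∈_; find; lose)
open import Data.List.Membership.Propositional.Properties using (∈-++⁻; ∈-map⁺; ∈-map⁻; ∈-∃++; ∈-allFin; ∈-lookup; ∈-cartesianProductWith⁺)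
open import Data.List.Relation.Unary.All using ([]; _∷_) renaming (lookup to All-lookup; tabulate to All-tabulate)
open import Data.List.Relation.Unary.AllPairs using (AllPairs; []; _∷_)
open import Data.List.Relation.Unary.Any using (here; there)
open import Data.List.Relation.Unary.Any.Properties using (lookup-index)
open import Data.List.Relation.Unary.Unique.Propositional using (Unique)
import Data.List.Relation.Unary.Any as Any
import Data.List.Relation.Unary.AllPairs.Properties as AllPairsₚ
import Data.List.Relation.Unary.Unique.Propositional.Properties as Uniqueₚ
open import Data.List.Relation.Binary.Permutation.Propositional using (_↭_; ↭-refl; ↭-sym; ↭-trans; prep; swap; ↭⇒↭ₛ)
open import Data.List.Relation.Binary.Permutation.Propositional.Properties using (∈-resp-↭; shift; ++⁺ˡ; ↭-length)
open import Data.List.Relation.Binary.Permutation.Setoid.Properties using (Unique-resp-↭)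
open import Data.Product using (Σ; _×_; _,_; proj₁; proj₂; ∃-syntax)
open import Data.Sum using (_⊎_; inj₁; inj₂)
open import Data.Empty using (⊥-elim)
open import Relation.Nullary using (¬_; Dec; yes; no; does)
open import Relation.Nullary.Decidable using (_×-dec_; ¬?; decidable-stable; map′)
open import Relation.Binary.Definitions using (tri<; tri≈; tri>)
open import Relation.Binary.PropositionalEquality using (_≡_; _≢_; refl; sym; trans; cong; cong₂; subst; module ≡-Reasoning)
open import Relation.Binary.PropositionalEquality.Properties using (setoid)
open import Function using (_∘_; id; case_of_)
open import Algebra.Properties.Semiring.Sum +-*-semiring using (sum; ∑-distrib-+; ∑-comm; *-distribˡ-sum; sum-cong-≗)

-- The parameters come from one balance. Let b = 2^a. A rainbow r-tuple excludes about r²/2 colours,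
-- a gain of k r²/2 in the exponent; averaging over r-tuples costs r log B, where B bounds the loss
-- from `X` to the subset that holds the tuple. Moving to a maximiser makes log B of order a²,
-- because the rate drops only by about k/a, so r has to be of order a². Rainbow tuples of that
-- length need colour densities below 1/(2 r⁴), a mere power of 1/a and far above 1/b: this room
-- makes the descent possible. Two different rates control the loss. A maximiser inside Y_w for the
-- lower rate that had dropped many colours would be too small to exist by maximality at that rate,
-- or too large for the extremality of `X` at the higher one. In the code each step replaces b by
-- its square root, which is less than polylog(b) would give and still enough: the rates are 2k -
-- k/2^i, so their gaps sum to less than k, and the size required at level i is 2^(5 A 4^i),
-- dominated by the top level, where 4^i ≤ m. A rate is a fraction p/q, cleared of its denominator
-- by raising sizes to the power q.

1[_] : Bool → ℕ
1[ true ] = 1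
1[ false ] = 0

isZero : ℕ → Bool
isZero zero = true
isZero (suc _) = false

1[∧] : ∀ a b → 1[ a ∧ b ] ≡ 1[ a ] * 1[ b ]
1[∧] true b = sym (+-identityʳ _)
1[∧] false b = refl

∧-true⁻ : ∀ {a b} → a ∧ b ≡ true → a ≡ true × b ≡ true
∧-true⁻ {true} {true} _ = refl , refl

∧-true⁺ : ∀ {a b} → a ≡ true → b ≡ true → a ∧ b ≡ true
∧-true⁺ refl refl = refl

*-left-comm : ∀ a b d → a * (b * d) ≡ b * (a * d)
*-left-comm = solve-∀

sum-mono : ∀ {n} {f g : Fin n → ℕ} → (∀ i → f i ≤ g i) → sum f ≤ sum g
sum-mono {zero} _ = z≤n
sum-mono {suc n} f≤g = +-mono-≤ (f≤g zero) (sum-mono (f≤g ∘ suc))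

sum-const : ∀ n c → sum {n} (λ _ → c) ≡ n * c
sum-const zero c = refl
sum-const (suc n) c = cong (c +_) (sum-const n c)

sum-zero : ∀ {n} {f : Fin n → ℕ} → (∀ i → f i ≡ 0) → sum f ≡ 0
sum-zero {n} f≡0 = trans (sum-cong-≗ f≡0) (trans (sum-const n 0) (*-zeroʳ n))

-- Sums over subsets and over tuples of vertices.

Subset : ℕ → Set
Subset n = Fin n → Bool

∣_∣ : ∀ {n} → Subset n → ℕ
∣ X ∣ = sum (λ x → 1[ X x ])

guard-≤ : ∀ b {p q} → (b ≡ true → p ≤ q) → 1[ b ] * p ≤ 1[ b ] * q
guard-≤ true h = *-monoʳ-≤ 1 (h refl)
guard-≤ false h = z≤n

sum-*ʳ : ∀ {n} (f : Fin n → ℕ) c → sum (λ i → f i * c) ≡ sum f * c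
sum-*ʳ f c = trans (sum-cong-≗ (λ i → *-comm (f i) c)) (trans (sym (*-distribˡ-sum c f)) (*-comm c (sum f)))

∑ᵥ : ∀ {n} r → (Vec (Fin n) r → ℕ) → ℕ
∑ᵥ zero F = F []
∑ᵥ (suc r) F = sum (λ x → ∑ᵥ r (λ v → F (x ∷ v)))

∑ᵥ-mono : ∀ {n} r {F G : Vec (Fin n) r → ℕ} → (∀ v → F v ≤ G v) → ∑ᵥ r F ≤ ∑ᵥ r G
∑ᵥ-mono zero F≤G = F≤G []
∑ᵥ-mono (suc r) F≤G = sum-mono (λ x → ∑ᵥ-mono r (λ v → F≤G (x ∷ v)))

∑ᵥ-cong : ∀ {n} r {F G : Vec (Fin n) r → ℕ} → (∀ v → F v ≡ G v) → ∑ᵥ r F ≡ ∑ᵥ r G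
∑ᵥ-cong zero F≡G = F≡G []
∑ᵥ-cong (suc r) F≡G = sum-cong-≗ (λ x → ∑ᵥ-cong r (λ v → F≡G (x ∷ v)))

∑ᵥ-+ : ∀ {n} r (F G : Vec (Fin n) r → ℕ) → ∑ᵥ r (λ v → F v + G v) ≡ ∑ᵥ r F + ∑ᵥ r G
∑ᵥ-+ zero F G = refl
∑ᵥ-+ (suc r) F G = trans (sum-cong-≗ (λ x → ∑ᵥ-+ r (λ v → F (x ∷ v)) (λ v → G (x ∷ v))))
                         (∑-distrib-+ (λ x → ∑ᵥ r (λ v → F (x ∷ v))) (λ x → ∑ᵥ r (λ v → G (x ∷ v))))

∑ᵥ-*ˡ : ∀ {n} r c (F : Vec (Fin n) r → ℕ) → ∑ᵥ r (λ v → c * F v) ≡ c * ∑ᵥ r F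
∑ᵥ-*ˡ zero c F = refl
∑ᵥ-*ˡ (suc r) c F = trans (sum-cong-≗ (λ x → ∑ᵥ-*ˡ r c (λ v → F (x ∷ v))))
                          (sym (*-distribˡ-sum c (λ x → ∑ᵥ r (λ v → F (x ∷ v)))))

∑ᵥ-sum : ∀ {n k} r (G : Fin k → Vec (Fin n) r → ℕ) →
         ∑ᵥ r (λ v → sum (λ w → G w v)) ≡ sum (λ w → ∑ᵥ r (G w))
∑ᵥ-sum zero G = refl
∑ᵥ-sum (suc r) G = trans (sum-cong-≗ (λ x → ∑ᵥ-sum r (λ w v → G w (x ∷ v))))
                         (∑-comm (λ x w → ∑ᵥ r (λ v → G w (x ∷ v))))

allIn : ∀ {n r} → Subset n → Vec (Fin n) r → Bool
allIn X [] = true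
allIn X (x ∷ v) = X x ∧ allIn X v

-- An unnormalised expectation: divided by `∣ X ∣ ^ r` it is the mean of `F` over a random r-tuple
-- from `X` with repetition, so probabilistic bounds become inequalities between naturals.
𝔼 : ∀ {n} → Subset n → ∀ r → (Vec (Fin n) r → ℕ) → ℕ
𝔼 X r F = ∑ᵥ r (λ v → 1[ allIn X v ] * F v)

𝔼-suc : ∀ {n} (X : Subset n) r F → 𝔼 X (suc r) F ≡ sum (λ x → 1[ X x ] * 𝔼 X r (λ v → F (x ∷ v)))
𝔼-suc X r F = sum-cong-≗ (λ x → trans
  (∑ᵥ-cong r (λ v → trans (cong (_* F (x ∷ v)) (1[∧] (X x) (allIn X v))) (*-assoc 1[ X x ] _ _)))
  (∑ᵥ-*ˡ r 1[ X x ] _))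

𝔼-mono : ∀ {n} (X : Subset n) r {F G} → (∀ v → allIn X v ≡ true → F v ≤ G v) → 𝔼 X r F ≤ 𝔼 X r G
𝔼-mono X r F≤G = ∑ᵥ-mono r (λ v → guard-≤ (allIn X v) (F≤G v))

𝔼-+ : ∀ {n} (X : Subset n) r F G → 𝔼 X r (λ v → F v + G v) ≡ 𝔼 X r F + 𝔼 X r G
𝔼-+ X r F G = trans (∑ᵥ-cong r (λ v → *-distribˡ-+ 1[ allIn X v ] (F v) (G v)))
                    (∑ᵥ-+ r (λ v → 1[ allIn X v ] * F v) (λ v → 1[ allIn X v ] * G v))

𝔼-*ˡ : ∀ {n} (X : Subset n) r c F → 𝔼 X r (λ v → c * F v) ≡ c * 𝔼 X r F
𝔼-*ˡ X r c F = trans (∑ᵥ-cong r (λ v → *-left-comm 1[ allIn X v ] c (F v))) (∑ᵥ-*ˡ r c (λ v → 1[ allIn X v ] * F v))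

𝔼-const : ∀ {n} (X : Subset n) r c → 𝔼 X r (λ _ → c) ≡ c * ∣ X ∣ ^ r
𝔼-const X zero c = trans (+-identityʳ c) (sym (*-identityʳ c))
𝔼-const X (suc r) c = begin
  𝔼 X (suc r) (λ _ → c)                 ≡⟨ 𝔼-suc X r (λ _ → c) ⟩
  sum (λ x → 1[ X x ] * 𝔼 X r (λ _ → c)) ≡⟨ sum-*ʳ (λ x → 1[ X x ]) _ ⟩
  ∣ X ∣ * 𝔼 X r (λ _ → c)               ≡⟨ cong (∣ X ∣ *_) (𝔼-const X r c) ⟩
  ∣ X ∣ * (c * ∣ X ∣ ^ r)               ≡⟨ *-left-comm ∣ X ∣ c (∣ X ∣ ^ r) ⟩
  c * (∣ X ∣ * ∣ X ∣ ^ r)               ∎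
  where
  open ≡-Reasoning

𝔼-sum : ∀ {n} (X : Subset n) r (F : Fin n → Vec (Fin n) r → ℕ) →
        sum (λ x → 1[ X x ] * 𝔼 X r (F x)) ≡ 𝔼 X r (λ v → sum (λ x → 1[ X x ] * F x v))
𝔼-sum X r F = begin
  sum (λ x → 1[ X x ] * 𝔼 X r (F x))
    ≡⟨ sum-cong-≗ (λ x → sym (𝔼-*ˡ X r 1[ X x ] (F x))) ⟩
  sum (λ x → 𝔼 X r (λ v → 1[ X x ] * F x v))
    ≡⟨ sym (∑ᵥ-sum r (λ x v → 1[ allIn X v ] * (1[ X x ] * F x v))) ⟩
  ∑ᵥ r (λ v → sum (λ x → 1[ allIn X v ] * (1[ X x ] * F x v)))
    ≡⟨ ∑ᵥ-cong r (λ v → sym (*-distribˡ-sum 1[ allIn X v ] (λ x → 1[ X x ] * F x v))) ⟩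
  𝔼 X r (λ v → sum (λ x → 1[ X x ] * F x v)) ∎
  where open ≡-Reasoning

-- The expected number of repeated colours in a random tuple.

module Collisions {n M : ℕ} (colour : Fin n → Fin n → Fin M) (colour-sym : ∀ x y → colour x y ≡ colour y x)
                  (diag : Fin M) where

  δ : Fin M → Fin M → ℕ
  δ c d = 1[ does (c ≟ᶠ d) ]

  deg : Subset n → Fin n → Fin M → ℕ
  deg X x c = sum (λ z → 1[ X z ] * δ (colour x z) c)

  hits : Fin M → List (Fin M) → ℕ
  hits c [] = 0
  hits c (d ∷ ds) = δ c d + hits c ds

  collisions : List (Fin M) → ℕ
  collisions [] = 0
  collisions (c ∷ cs) = hits c cs + collisions cs

  cross : List (Fin M) → List (Fin M) → ℕ
  cross [] ds = 0
  cross (c ∷ cs) ds = hits c ds + cross cs ds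

  hits-++ : ∀ c cs ds → hits c (cs ++ ds) ≡ hits c cs + hits c ds
  hits-++ c [] ds = refl
  hits-++ c (d ∷ cs) ds = trans (cong (δ c d +_) (hits-++ c cs ds)) (sym (+-assoc (δ c d) _ _))

  collisions-++ : ∀ cs ds → collisions (cs ++ ds) ≡ collisions cs + cross cs ds + collisions ds
  collisions-++ [] ds = refl
  collisions-++ (c ∷ cs) ds rewrite hits-++ c cs ds | collisions-++ cs ds =
    rearrange (hits c cs) (hits c ds) (collisions cs) (cross cs ds) (collisions ds)
    where
    rearrange : ∀ a b p q s → a + b + (p + q + s) ≡ a + p + (b + q) + s
    rearrange = solve-∀

  star : ∀ {r} → Fin n → Vec (Fin n) r → List (Fin M)
  star x [] = []
  star x (y ∷ v) = colour x y ∷ star x v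

  colours : ∀ {r} → Vec (Fin n) r → List (Fin M)
  colours [] = []
  colours (x ∷ v) = star x v ++ colours v

  -- The final `diag` is a sentinel. Once `diag` is the colour of loops, absence of collisions also
  -- forces the entries of the tuple to be distinct.
  colours₀ : ∀ {r} → Vec (Fin n) r → List (Fin M)
  colours₀ [] = diag ∷ []
  colours₀ (x ∷ v) = star x v ++ colours₀ v

  length-star : ∀ {r} x (v : Vec (Fin n) r) → length (star x v) ≡ r
  length-star x [] = refl
  length-star x (y ∷ v) = cong suc (length-star x v)

  module _ (β : ℕ) (Λ : Subset n) (light : ∀ x → Λ x ≡ true → ∀ c → β * deg Λ x c ≤ ∣ Λ ∣) where

    private
      N : ℕ
      N = ∣ Λ ∣

    -- By lightness at `x`, each listed colour is hit by at most N/β choices of `y`.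
    hits-bound : ∀ x → Λ x ≡ true → ∀ cs → β * sum (λ y → 1[ Λ y ] * hits (colour x y) cs) ≤ length cs * N
    hits-bound x Λx [] = ≤-reflexive (trans (cong (β *_) (sum-zero (λ y → *-zeroʳ 1[ Λ y ]))) (*-zeroʳ β))
    hits-bound x Λx (c ∷ cs) = begin
      β * sum (λ y → 1[ Λ y ] * (δ (colour x y) c + hits (colour x y) cs))
        ≡⟨ cong (β *_) (trans (sum-cong-≗ (λ y → *-distribˡ-+ 1[ Λ y ] (δ (colour x y) c) (hits (colour x y) cs)))
                              (∑-distrib-+ (λ y → 1[ Λ y ] * δ (colour x y) c) (λ y → 1[ Λ y ] * hits (colour x y) cs))) ⟩
      β * (deg Λ x c + sum (λ y → 1[ Λ y ] * hits (colour x y) cs))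
        ≡⟨ *-distribˡ-+ β _ _ ⟩
      β * deg Λ x c + β * sum (λ y → 1[ Λ y ] * hits (colour x y) cs)
        ≤⟨ +-mono-≤ (light x Λx c) (hits-bound x Λx cs) ⟩
      N + length cs * N ∎
      where open ≤-Reasoning

    -- The tuple `v` is fixed and the new vertex x is random. Symmetry of the colouring lets
    -- lightness be applied at the old endpoints y, which turns this into `hits-bound`.
    cross-bound : ∀ {r} (v : Vec (Fin n) r) → allIn Λ v ≡ true → ∀ cs →
                  β * sum (λ x → 1[ Λ x ] * cross (star x v) cs) ≤ r * (length cs * N)
    cross-bound [] _ cs = ≤-reflexive (trans (cong (β *_) (sum-zero (λ y → *-zeroʳ 1[ Λ y ]))) (*-zeroʳ β))
    cross-bound {suc r} (y ∷ v) Λv cs = begin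
      β * sum (λ x → 1[ Λ x ] * (hits (colour x y) cs + cross (star x v) cs))
        ≡⟨ cong (β *_) (trans (sum-cong-≗ (λ x → trans (*-distribˡ-+ 1[ Λ x ] (hits (colour x y) cs) (cross (star x v) cs))
                                                        (cong (λ c → 1[ Λ x ] * hits c cs + 1[ Λ x ] * cross (star x v) cs) (colour-sym x y))))
                              (∑-distrib-+ (λ x → 1[ Λ x ] * hits (colour y x) cs) (λ x → 1[ Λ x ] * cross (star x v) cs))) ⟩
      β * (sum (λ x → 1[ Λ x ] * hits (colour y x) cs) + sum (λ x → 1[ Λ x ] * cross (star x v) cs))
        ≡⟨ *-distribˡ-+ β _ _ ⟩
      β * sum (λ x → 1[ Λ x ] * hits (colour y x) cs) + β * sum (λ x → 1[ Λ x ] * cross (star x v) cs)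
        ≤⟨ +-mono-≤ (hits-bound y (proj₁ (∧-true⁻ Λv)) cs) (cross-bound v (proj₂ (∧-true⁻ Λv)) cs) ⟩
      length cs * N + r * (length cs * N) ∎
      where open ≤-Reasoning

    -- When the entries are exposed one at a time, the next one repeats one of at most r earlier
    -- colours at `x` with probability at most r/β; summing over the entries stays below r²/β.
    star-bound : ∀ x → Λ x ≡ true → ∀ r → β * 𝔼 Λ r (λ v → collisions (star x v)) ≤ r * r * N ^ r
    star-bound x Λx zero = ≤-reflexive (*-zeroʳ β)
    star-bound x Λx (suc r) = begin
      β * 𝔼 Λ (suc r) (λ v → collisions (star x v))
        ≡⟨ cong (β *_) (𝔼-suc Λ r (λ v → collisions (star x v))) ⟩
      β * sum (λ y → 1[ Λ y ] * 𝔼 Λ r (λ u → hits (colour x y) (star x u) + collisions (star x u)))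
        ≡⟨ cong (β *_) (𝔼-sum Λ r (λ y u → hits (colour x y) (star x u) + collisions (star x u))) ⟩
      β * 𝔼 Λ r (λ u → sum (λ y → 1[ Λ y ] * (hits (colour x y) (star x u) + collisions (star x u))))
        ≡⟨ sym (𝔼-*ˡ Λ r β _) ⟩
      𝔼 Λ r (λ u → β * sum (λ y → 1[ Λ y ] * (hits (colour x y) (star x u) + collisions (star x u))))
        ≤⟨ 𝔼-mono Λ r (λ u _ → inner u) ⟩
      𝔼 Λ r (λ u → r * N + N * (β * collisions (star x u)))
        ≡⟨ 𝔼-+ Λ r (λ _ → r * N) (λ u → N * (β * collisions (star x u))) ⟩
      𝔼 Λ r (λ _ → r * N) + 𝔼 Λ r (λ u → N * (β * collisions (star x u)))
        ≡⟨ cong₂ _+_ (𝔼-const Λ r (r * N)) (trans (𝔼-*ˡ Λ r N (λ u → β * collisions (star x u))) (cong (N *_) (𝔼-*ˡ Λ r β (λ u → collisions (star x u))))) ⟩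
      r * N * N ^ r + N * (β * 𝔼 Λ r (λ u → collisions (star x u)))
        ≤⟨ +-monoʳ-≤ (r * N * N ^ r) (*-monoʳ-≤ N (star-bound x Λx r)) ⟩
      r * N * N ^ r + N * (r * r * N ^ r)
        ≤⟨ m≤m+n _ ((r + 1) * (N * N ^ r)) ⟩
      r * N * N ^ r + N * (r * r * N ^ r) + (r + 1) * (N * N ^ r)
        ≡⟨ arith r N (N ^ r) ⟩
      suc r * suc r * (N * N ^ r) ∎
      where
      open ≤-Reasoning
      arith : ∀ r N P → r * N * P + N * (r * r * P) + (r + 1) * (N * P) ≡ suc r * suc r * (N * P)
      arith = solve-∀
      inner : ∀ u → β * sum (λ y → 1[ Λ y ] * (hits (colour x y) (star x u) + collisions (star x u)))
                    ≤ r * N + N * (β * collisions (star x u))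
      inner u = begin
        β * sum (λ y → 1[ Λ y ] * (hits (colour x y) (star x u) + κ))
          ≡⟨ cong (β *_) (trans (sum-cong-≗ (λ y → *-distribˡ-+ 1[ Λ y ] (hits (colour x y) (star x u)) κ))
                                (∑-distrib-+ (λ y → 1[ Λ y ] * hits (colour x y) (star x u)) (λ y → 1[ Λ y ] * κ))) ⟩
        β * (sum (λ y → 1[ Λ y ] * hits (colour x y) (star x u)) + sum (λ y → 1[ Λ y ] * κ))
          ≡⟨ *-distribˡ-+ β _ _ ⟩
        β * sum (λ y → 1[ Λ y ] * hits (colour x y) (star x u)) + β * sum (λ y → 1[ Λ y ] * κ)
          ≤⟨ +-mono-≤ (hits-bound x Λx (star x u)) (≤-reflexive (trans (cong (β *_) (sum-*ʳ (λ y → 1[ Λ y ]) κ)) (*-left-comm β N κ))) ⟩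
        length (star x u) * N + N * (β * κ)
          ≡⟨ cong (λ l → l * N + N * (β * κ)) (length-star x u) ⟩
        r * N + N * (β * κ) ∎
        where
        κ : ℕ
        κ = collisions (star x u)

    length-colours₀ : ∀ {r} (v : Vec (Fin n) r) → length (colours₀ v) ≤ suc (r * r)
    length-colours₀ [] = ≤-refl
    length-colours₀ {suc r} (x ∷ v) = begin
      length (star x v ++ colours₀ v)        ≡⟨ length-++ (star x v) ⟩
      length (star x v) + length (colours₀ v) ≤⟨ +-mono-≤ (≤-reflexive (length-star x v)) (length-colours₀ v) ⟩
      r + suc (r * r)                        ≤⟨ m≤m+n _ (suc r) ⟩
      r + suc (r * r) + suc r                ≡⟨ arith r ⟩
      suc (suc r * suc r)                    ∎
      where
      open ≤-Reasoning
      arith : ∀ r → r + suc (r * r) + suc r ≡ suc (suc r * suc r)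
      arith = solve-∀

    -- A new vertex adds collisions inside its star (at most r²), and between its star and the at
    -- most r² + 1 old colours (at most r (r² + 1)), to the old r⁴, all in units of 1/β. The total
    -- is below (r + 1)⁴; the polynomial added in the proof is the exact difference.
    collisions-bound : ∀ r → β * 𝔼 Λ r (λ v → collisions (colours₀ v)) ≤ r * r * r * r * N ^ r
    collisions-bound zero = ≤-reflexive (*-zeroʳ β)
    collisions-bound (suc r) = begin
      β * 𝔼 Λ (suc r) (λ v → collisions (colours₀ v))
        ≡⟨ cong (β *_) (𝔼-suc Λ r (λ v → collisions (colours₀ v))) ⟩
      β * sum (λ x → 1[ Λ x ] * 𝔼 Λ r (λ v → collisions (star x v ++ colours₀ v)))
        ≡⟨ cong (β *_) (sum-cong-≗ split) ⟩
      β * sum (λ x → 1[ Λ x ] * 𝔼 Λ r (λ v → collisions (star x v)) + 1[ Λ x ] * 𝔼 Λ r (λ v → cross (star x v) (colours₀ v)) + 1[ Λ x ] * 𝔼 Λ r (λ v → collisions (colours₀ v)))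
        ≡⟨ cong (β *_) (trans (∑-distrib-+ (λ x → f₁ x + f₂ x) f₃) (cong₂ _+_ (∑-distrib-+ f₁ f₂) (sum-*ʳ (λ x → 1[ Λ x ]) E))) ⟩
      β * (sum f₁ + sum f₂ + N * E)
        ≡⟨ arith₁ β (sum f₁) (sum f₂) N E ⟩
      β * sum f₁ + β * sum f₂ + N * (β * E)
        ≤⟨ +-mono-≤ (+-mono-≤ bound₁ bound₂) (*-monoʳ-≤ N (collisions-bound r)) ⟩
      N * (r * r * N ^ r) + r * (suc (r * r) * N) * N ^ r + N * (r * r * r * r * N ^ r)
        ≤⟨ m≤m+n _ ((3 * r * r * r + 5 * r * r + 3 * r + 1) * (N * N ^ r)) ⟩
      N * (r * r * N ^ r) + r * (suc (r * r) * N) * N ^ r + N * (r * r * r * r * N ^ r) + (3 * r * r * r + 5 * r * r + 3 * r + 1) * (N * N ^ r)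
        ≡⟨ arith₂ r N (N ^ r) ⟩
      suc r * suc r * suc r * suc r * (N * N ^ r) ∎
      where
      open ≤-Reasoning
      E : ℕ
      E = 𝔼 Λ r (λ v → collisions (colours₀ v))
      f₁ f₂ f₃ : Fin n → ℕ
      f₁ x = 1[ Λ x ] * 𝔼 Λ r (λ v → collisions (star x v))
      f₂ x = 1[ Λ x ] * 𝔼 Λ r (λ v → cross (star x v) (colours₀ v))
      f₃ x = 1[ Λ x ] * E
      split : ∀ x → 1[ Λ x ] * 𝔼 Λ r (λ v → collisions (star x v ++ colours₀ v)) ≡ f₁ x + f₂ x + f₃ x
      split x = trans (cong (1[ Λ x ] *_) (trans
        (∑ᵥ-cong r (λ v → cong (1[ allIn Λ v ] *_) (collisions-++ (star x v) (colours₀ v))))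
        (trans (𝔼-+ Λ r (λ v → collisions (star x v) + cross (star x v) (colours₀ v)) (λ v → collisions (colours₀ v)))
               (cong (_+ E) (𝔼-+ Λ r (λ v → collisions (star x v)) (λ v → cross (star x v) (colours₀ v)))))))
        (distr 1[ Λ x ] _ _ E)
        where
        distr : ∀ a b c d → a * (b + c + d) ≡ a * b + a * c + a * d
        distr = solve-∀
      arith₁ : ∀ β a b N E → β * (a + b + N * E) ≡ β * a + β * b + N * (β * E)
      arith₁ = solve-∀
      arith₂ : ∀ r N P → N * (r * r * P) + r * (suc (r * r) * N) * P + N * (r * r * r * r * P) + (3 * r * r * r + 5 * r * r + 3 * r + 1) * (N * P) ≡ suc r * suc r * suc r * suc r * (N * P)
      arith₂ = solve-∀
      bound₁ : β * sum f₁ ≤ N * (r * r * N ^ r)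
      bound₁ = begin
        β * sum f₁ ≡⟨ *-distribˡ-sum β f₁ ⟩
        sum (λ x → β * f₁ x) ≡⟨ sum-cong-≗ (λ x → *-left-comm β 1[ Λ x ] _) ⟩
        sum (λ x → 1[ Λ x ] * (β * 𝔼 Λ r (λ v → collisions (star x v))))
          ≤⟨ sum-mono (λ x → guard-≤ (Λ x) (λ Λx → star-bound x Λx r)) ⟩
        sum (λ x → 1[ Λ x ] * (r * r * N ^ r)) ≡⟨ sum-*ʳ (λ x → 1[ Λ x ]) _ ⟩
        N * (r * r * N ^ r) ∎
      bound₂ : β * sum f₂ ≤ r * (suc (r * r) * N) * N ^ r
      bound₂ = begin
        β * sum f₂ ≡⟨ cong (β *_) (𝔼-sum Λ r (λ x v → cross (star x v) (colours₀ v))) ⟩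
        β * 𝔼 Λ r (λ v → sum (λ x → 1[ Λ x ] * cross (star x v) (colours₀ v)))
          ≡⟨ sym (𝔼-*ˡ Λ r β _) ⟩
        𝔼 Λ r (λ v → β * sum (λ x → 1[ Λ x ] * cross (star x v) (colours₀ v)))
          ≤⟨ 𝔼-mono Λ r (λ v Λv → ≤-trans (cross-bound v Λv (colours₀ v)) (*-monoʳ-≤ r (*-monoˡ-≤ N (length-colours₀ v)))) ⟩
        𝔼 Λ r (λ _ → r * (suc (r * r) * N)) ≡⟨ 𝔼-const Λ r _ ⟩
        r * (suc (r * r) * N) * N ^ r ∎

    -- Markov's inequality: the mean number of collisions is at most r⁴/β ≤ 1/2, so at least half of
    -- the tuples have none.
    rainbow-majority : ∀ r → 1 ≤ r → 2 * (r * r * r * r) ≤ β →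
                       N ^ r ≤ 2 * 𝔼 Λ r (λ v → 1[ isZero (collisions (colours₀ v)) ])
    rainbow-majority (suc r′) _ 2r⁴≤β = +-cancelʳ-≤ (2 * K) (N ^ r) (2 * G) (begin
      N ^ r + 2 * K          ≤⟨ +-monoʳ-≤ (N ^ r) 2K≤ ⟩
      N ^ r + N ^ r          ≡⟨ arith₁ (N ^ r) ⟩
      2 * (1 * N ^ r)        ≡⟨ cong (2 *_) (sym (𝔼-const Λ r 1)) ⟩
      2 * 𝔼 Λ r (λ _ → 1)    ≤⟨ *-monoʳ-≤ 2 (𝔼-mono Λ r (λ v _ → one≤ (collisions (colours₀ v)))) ⟩
      2 * 𝔼 Λ r (λ v → 1[ isZero (collisions (colours₀ v)) ] + collisions (colours₀ v))
        ≡⟨ cong (2 *_) (𝔼-+ Λ r (λ v → 1[ isZero (collisions (colours₀ v)) ]) (λ v → collisions (colours₀ v))) ⟩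
      2 * (G + K)            ≡⟨ *-distribˡ-+ 2 G K ⟩
      2 * G + 2 * K          ∎)
      where
      open ≤-Reasoning
      r = suc r′
      G = 𝔼 Λ r (λ v → 1[ isZero (collisions (colours₀ v)) ])
      K = 𝔼 Λ r (λ v → collisions (colours₀ v))
      arith₁ : ∀ a → a + a ≡ 2 * (1 * a)
      arith₁ = solve-∀
      arith₂ : ∀ a b → a * (2 * b) ≡ 2 * a * b
      arith₂ = solve-∀
      one≤ : ∀ k → 1 ≤ 1[ isZero k ] + k
      one≤ zero = ≤-refl
      one≤ (suc k) = s≤s z≤n
      2K≤ : 2 * K ≤ N ^ r
      2K≤ = *-cancelˡ-≤ (r * r * r * r) (begin
        r * r * r * r * (2 * K) ≡⟨ arith₂ (r * r * r * r) K ⟩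
        2 * (r * r * r * r) * K ≤⟨ *-monoˡ-≤ K 2r⁴≤β ⟩
        β * K                   ≤⟨ collisions-bound r ⟩
        r * r * r * r * N ^ r   ∎)

-- Colours excluded by a rainbow tuple, and averaging over the tuple.

sum-δ : ∀ {M} (c : Fin M) → sum (λ d → 1[ does (c ≟ᶠ d) ]) ≡ 1
sum-δ {suc M} zero = cong suc (sum-zero {f = λ d → 1[ does (zero {M} ≟ᶠ suc d) ]} (λ d → refl))
sum-δ {suc M} (suc c) = trans (sum-cong-≗ (λ d → cong 1[_] (does-suc c d))) (sum-δ c)
  where
  does-suc : ∀ {M} (c d : Fin M) → does (suc c ≟ᶠ suc d) ≡ does (c ≟ᶠ d)
  does-suc c d with c ≟ᶠ d
  ... | yes refl = refl
  ... | no _ = refl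

1[]-mono : ∀ {a b} → (a ≡ true → b ≡ true) → 1[ a ] ≤ 1[ b ]
1[]-mono {true} {b} h rewrite h refl = ≤-refl
1[]-mono {false} h = z≤n

^-distribʳ-* : ∀ r a b → (a * b) ^ r ≡ a ^ r * b ^ r
^-distribʳ-* zero a b = refl
^-distribʳ-* (suc r) a b = trans (cong (a * b *_) (^-distribʳ-* r a b)) (arith a b (a ^ r) (b ^ r))
  where
  arith : ∀ a b p q → a * b * (p * q) ≡ a * p * (b * q)
  arith = solve-∀

_⊆_ : ∀ {n} → Subset n → Subset n → Set
X ⊆ Y = ∀ x → X x ≡ true → Y x ≡ true

∣∣-mono : ∀ {n} {X Y : Subset n} → X ⊆ Y → ∣ X ∣ ≤ ∣ Y ∣
∣∣-mono X⊆Y = sum-mono (λ x → 1[]-mono (X⊆Y x))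

allIn-⊆ : ∀ {n r} {X Y : Subset n} → X ⊆ Y → (v : Vec (Fin n) r) → allIn X v ≡ true → allIn Y v ≡ true
allIn-⊆ X⊆Y [] _ = refl
allIn-⊆ X⊆Y (x ∷ v) h = ∧-true⁺ (X⊆Y x (proj₁ (∧-true⁻ h))) (allIn-⊆ X⊆Y v (proj₂ (∧-true⁻ h)))

allIn-∈ : ∀ {n r} {X : Subset n} {v : Vec (Fin n) r} {x} → allIn X v ≡ true → x ∈ᵥ v → X x ≡ true
allIn-∈ h (here refl) = proj₁ (∧-true⁻ h)
allIn-∈ {v = y ∷ v} h (there x∈v) = allIn-∈ {v = v} (proj₂ (∧-true⁻ h)) x∈v

pairs : ℕ → ℕ
pairs zero = 0
pairs (suc r) = r + pairs r

2*pairs : ∀ r → 2 * pairs (suc r) ≡ suc r * r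
2*pairs zero = refl
2*pairs (suc r) = trans (*-distribˡ-+ 2 (suc r) (pairs (suc r))) (trans (cong (2 * suc r +_) (2*pairs r)) (arith r))
  where
  arith : ∀ r → 2 * suc r + suc r * r ≡ suc (suc r) * suc r
  arith = solve-∀

module Rainbow {n M : ℕ} (colour : Fin n → Fin n → Fin M) (colour-sym : ∀ x y → colour x y ≡ colour y x)
               (diag : Fin M) (colour-refl : ∀ x → colour x x ≡ diag)
               (no-square : ∀ x y s t → x ≢ y → s ≢ t → x ≢ s → x ≢ t → y ≢ s → y ≢ t →
                            colour x s ≡ colour x t → colour y s ≡ colour y t → colour x y ≢ colour s t)
               where

  open Collisions colour colour-sym diag public

  rainbow : ∀ {r} → Vec (Fin n) r → ℕ
  rainbow v = 1[ isZero (collisions (colours₀ v)) ]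

  Appears : Subset n → Fin M → Set
  Appears X c = ∃[ x ] ∃[ y ] (X x ≡ true × X y ≡ true × x ≢ y × colour x y ≡ c)

  appears? : ∀ X c → Dec (Appears X c)
  appears? X c = any? (λ x → any? (λ y → (X x ≟ᵇ true) ×-dec (X y ≟ᵇ true) ×-dec ¬? (x ≟ᶠ y) ×-dec (colour x y ≟ᶠ c)))

  #colours : Subset n → ℕ
  #colours X = sum (λ c → 1[ does (appears? X c) ])

  δ≡0⇒≢ : ∀ c d → δ c d ≡ 0 → does (c ≟ᶠ d) ≡ false
  δ≡0⇒≢ c d h with does (c ≟ᶠ d)
  ... | false = refl

  hits≡0 : ∀ {c cs d} → hits c cs ≡ 0 → d ∈ cs → does (c ≟ᶠ d) ≡ false
  hits≡0 {c} {e ∷ cs} h (here refl) = δ≡0⇒≢ c e (m+n≡0⇒m≡0 (δ c e) h)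
  hits≡0 {c} {e ∷ cs} h (there d∈cs) = hits≡0 (m+n≡0⇒n≡0 (δ c e) h) d∈cs

  -- The listed colours are moved into `u` one at a time; as the list has no collisions, each of
  -- them is still new when its turn comes.
  count-new : ∀ (u v : Fin M → Bool) cs → collisions cs ≡ 0 → (∀ c → u c ≡ true → v c ≡ true) →
              (∀ {c} → c ∈ cs → u c ≡ false × v c ≡ true) →
              ∣ u ∣ + length cs ≤ ∣ v ∣
  count-new u v [] _ u⊆v _ = ≤-trans (≤-reflexive (+-identityʳ _)) (∣∣-mono u⊆v)
  count-new u v (c ∷ cs) h u⊆v new = begin
    ∣ u ∣ + suc (length cs)  ≡⟨ arith ∣ u ∣ (length cs) ⟩
    ∣ u ∣ + 1 + length cs    ≡⟨ cong (_+ length cs) (sym ∣u′∣) ⟩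
    ∣ u′ ∣ + length cs       ≤⟨ count-new u′ v cs (m+n≡0⇒n≡0 (hits c cs) h) u′⊆v new′ ⟩
    ∣ v ∣                    ∎
    where
    open ≤-Reasoning
    arith : ∀ a b → a + suc b ≡ a + 1 + b
    arith = solve-∀
    u′ : Fin M → Bool
    u′ d = u d ∨ does (c ≟ᶠ d)
    pointwise : ∀ d → 1[ u′ d ] ≡ 1[ u d ] + 1[ does (c ≟ᶠ d) ]
    pointwise d with c ≟ᶠ d
    ... | yes refl rewrite proj₁ (new (here refl)) = refl
    ... | no _ with u d
    ...   | true = refl
    ...   | false = refl
    ∣u′∣ : ∣ u′ ∣ ≡ ∣ u ∣ + 1
    ∣u′∣ = trans (sum-cong-≗ pointwise)
                 (trans (∑-distrib-+ (λ d → 1[ u d ]) (λ d → 1[ does (c ≟ᶠ d) ])) (cong (∣ u ∣ +_) (sum-δ c)))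
    u′⊆v : ∀ d → u′ d ≡ true → v d ≡ true
    u′⊆v d h′ with u d in eq
    ... | true = u⊆v d eq
    ... | false with c ≟ᶠ d
    ...   | yes refl = proj₂ (new (here refl))
    new′ : ∀ {d} → d ∈ cs → u′ d ≡ false × v d ≡ true
    new′ {d} d∈cs rewrite proj₁ (new (there d∈cs)) =
      hits≡0 (m+n≡0⇒m≡0 (hits c cs) h) d∈cs , proj₂ (new (there d∈cs))

  #colours-mono : ∀ {X Y} → X ⊆ Y → #colours X ≤ #colours Y
  #colours-mono {X} {Y} X⊆Y = sum-mono pointwise
    where
    pointwise : ∀ c → 1[ does (appears? X c) ] ≤ 1[ does (appears? Y c) ]
    pointwise c with appears? X c | appears? Y c
    ... | no _ | _ = z≤n
    ... | yes _ | yes _ = ≤-refl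
    ... | yes (x , y , Xx , Xy , x≢y , eq) | no ¬Y = ⊥-elim (¬Y (x , y , X⊆Y x Xx , X⊆Y y Xy , x≢y , eq))

  length-colours : ∀ {r} (v : Vec (Fin n) r) → length (colours v) ≡ pairs r
  length-colours [] = refl
  length-colours (x ∷ v) = trans (length-++ (star x v)) (cong₂ _+_ (length-star x v) (length-colours v))

  colours₀-≡ : ∀ {r} (v : Vec (Fin n) r) → colours₀ v ≡ colours v ++ diag ∷ []
  colours₀-≡ [] = refl
  colours₀-≡ (x ∷ v) = trans (cong (star x v ++_) (colours₀-≡ v)) (sym (++-assoc (star x v) (colours v) _))

  collisions-last : ∀ cs {d} → collisions (cs ++ d ∷ []) ≡ 0 → collisions cs ≡ 0 × (∀ {c} → c ∈ cs → c ≢ d)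
  collisions-last [] _ = refl , λ ()
  collisions-last (c ∷ cs) {d} h = cong₂ _+_ (m+n≡0⇒m≡0 (hits c cs) hc) (proj₁ rec) , ≢d
    where
    hc : hits c cs + hits c (d ∷ []) ≡ 0
    hc = trans (sym (hits-++ c cs (d ∷ []))) (m+n≡0⇒m≡0 _ h)
    rec = collisions-last cs (m+n≡0⇒n≡0 (hits c (cs ++ d ∷ [])) h)
    ≢d : ∀ {e} → e ∈ c ∷ cs → e ≢ d
    ≢d (here refl) refl with d ≟ᶠ d | hits≡0 {d} {d ∷ []} (m+n≡0⇒n≡0 (hits d cs) hc) (here refl)
    ... | yes _ | ()
    ... | no d≢d | _ = d≢d refl
    ≢d (there e∈cs) = proj₂ rec e∈cs

  ∈-star : ∀ {r c} x (v : Vec (Fin n) r) → c ∈ star x v → ∃[ y ] (y ∈ᵥ v × colour x y ≡ c)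
  ∈-star x (y ∷ v) (here refl) = y , here refl , refl
  ∈-star x (y ∷ v) (there c∈) with ∈-star x v c∈
  ... | z , z∈v , eq = z , there z∈v , eq

  ∈-colours : ∀ {r c} (v : Vec (Fin n) r) → c ∈ colours v → ∃[ x ] ∃[ y ] (x ∈ᵥ v × y ∈ᵥ v × colour x y ≡ c)
  ∈-colours (x ∷ v) c∈ with ∈-++⁻ (star x v) c∈
  ... | inj₁ c∈star with ∈-star x v c∈star
  ...   | y , y∈v , eq = x , y , here refl , there y∈v , eq
  ∈-colours (x ∷ v) c∈ | inj₂ c∈v with ∈-colours v c∈v
  ...   | y , z , y∈v , z∈v , eq = y , z , there y∈v , there z∈v , eq

  -- The condition `γ ≢ diag` keeps `w` outside `X` when loops have colour `diag`; this supplies the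
  -- distinctness that a square demands.
  Sees : Fin n → Subset n → Fin M → Set
  Sees w X γ = γ ≢ diag × (∀ z → X z ≡ true → colour w z ≡ γ)

  -- If every vertex of Z is monochromatic towards T, then a pair in Z and a pair in T of the same colour would
  -- be the diagonals of a square.
  colours-die : ∀ {r} (X Z : Subset n) (T : Vec (Fin n) r) → Z ⊆ X → allIn X T ≡ true →
                collisions (colours₀ T) ≡ 0 →
                (∀ w → Z w ≡ true → ∃[ γ ] (γ ≢ diag × (∀ {t} → t ∈ᵥ T → colour w t ≡ γ))) →
                #colours Z + pairs r ≤ #colours X
  colours-die {r} X Z T Z⊆X T⊆X rb mono =
    subst (λ l → #colours Z + l ≤ #colours X) (length-colours T)
      (count-new (λ c → does (appears? Z c)) (λ c → does (appears? X c)) (colours T) (proj₁ distinct-colours) incl new)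
    where
    distinct-colours = collisions-last (colours T) (trans (cong collisions (sym (colours₀-≡ T))) rb)
    incl : ∀ c → does (appears? Z c) ≡ true → does (appears? X c) ≡ true
    incl c h with appears? Z c | appears? X c
    ... | _ | yes _ = refl
    ... | yes (x , y , Zx , Zy , x≢y , eq) | no ¬X = ⊥-elim (¬X (x , y , Z⊆X x Zx , Z⊆X y Zy , x≢y , eq))
    new : ∀ {c} → c ∈ colours T → does (appears? Z c) ≡ false × does (appears? X c) ≡ true
    new {c} c∈ with ∈-colours T c∈
    ... | s , t , s∈ , t∈ , eq with appears? Z c | appears? X c
    ...   | no _ | yes _ = refl , refl
    ...   | _ | no ¬X = ⊥-elim (¬X (s , t , allIn-∈ {v = T} T⊆X s∈ , allIn-∈ {v = T} T⊆X t∈ , s≢t , eq))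
      where
      s≢t : s ≢ t
      s≢t refl = proj₂ distinct-colours c∈ (trans (sym eq) (colour-refl s))
    ...   | yes (x , y , Zx , Zy , x≢y , eq′) | yes _ =
      ⊥-elim (no-square x y s t x≢y s≢t (out x Zx s∈) (out x Zx t∈) (out y Zy s∈) (out y Zy t∈)
                        (same x Zx) (same y Zy) (trans eq′ (sym eq)))
      where
      s≢t : s ≢ t
      s≢t refl = proj₂ distinct-colours c∈ (trans (sym eq) (colour-refl s))
      out : ∀ w → Z w ≡ true → ∀ {u} → u ∈ᵥ T → w ≢ u
      out w Zw u∈ refl with mono w Zw
      ... | γ , γ≢ , m = γ≢ (trans (sym (m u∈)) (colour-refl w))
      same : ∀ w → Z w ≡ true → colour w s ≡ colour w t
      same w Zw with mono w Zw
      ... | γ , γ≢ , m = trans (m s∈) (sym (m t∈))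

  module _ (k : ℕ) (X H : Subset n) (Λ : Fin n → Subset n) (r B : ℕ)
           (X>0 : 1 ≤ ∣ X ∣) (H⊆X : H ⊆ X) (X≤2H : ∣ X ∣ ≤ 2 * ∣ H ∣)
           (Λ⊆X : ∀ w → H w ≡ true → Λ w ⊆ X)
           (sees : ∀ w → H w ≡ true → ∃[ γ ] Sees w (Λ w) γ)
           (good : ∀ w → H w ≡ true → ∣ Λ w ∣ ^ r ≤ 2 * 𝔼 (Λ w) r rainbow)
           (large : ∀ w → H w ≡ true → ∣ X ∣ ≤ B * ∣ Λ w ∣)
           (kill : ∀ Z → Z ⊆ X → ∀ d → #colours Z + d ≤ #colours X → 2 ^ (k * d) * ∣ Z ∣ ≤ ∣ X ∣)
           where

    private
      P : ℕ
      P = 2 ^ (k * pairs r)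
      common : Vec (Fin n) r → Fin n → ℕ
      common T w = 1[ H w ] * (1[ allIn (Λ w) T ] * rainbow T)
      G : ℕ
      G = ∑ᵥ r (λ T → sum (common T))

    -- For a rainbow `T` inside `X`, the vertices counted form a set that lacks `pairs r` colours of
    -- `X` by `colours-die`, and `kill` makes it small. Any other `T` contributes nothing.
    common-bound : ∀ T → P * sum (common T) ≤ 1[ allIn X T ] * ∣ X ∣
    common-bound T with collisions (colours₀ T) in rb
    ... | suc _ = ≤-trans (≤-reflexive (trans (cong (P *_) (sum-zero (λ w → trans (cong (1[ H w ] *_) (*-zeroʳ 1[ allIn (Λ w) T ])) (*-zeroʳ 1[ H w ])))) (*-zeroʳ P))) z≤n
    ... | zero with allIn X T in T⊆X
    ...   | false = ≤-reflexive (trans (cong (P *_) (sum-zero none)) (*-zeroʳ P))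
      where
      none : ∀ w → 1[ H w ] * (1[ allIn (Λ w) T ] * 1) ≡ 0
      none w with H w in Hw | allIn (Λ w) T in Tw
      ... | false | _ = refl
      ... | true | false = refl
      ... | true | true with trans (sym T⊆X) (allIn-⊆ (Λ⊆X w Hw) T Tw)
      ...   | ()
    ...   | true = begin
      P * sum (λ w → 1[ H w ] * (1[ allIn (Λ w) T ] * 1))
        ≡⟨ cong (P *_) (sum-cong-≗ (λ w → trans (cong (1[ H w ] *_) (*-identityʳ _)) (sym (1[∧] (H w) (allIn (Λ w) T))))) ⟩
      P * ∣ Z ∣ ≤⟨ kill Z (λ w → H⊆X w ∘ proj₁ ∘ ∧-true⁻) (pairs r) (colours-die X Z T (λ w → H⊆X w ∘ proj₁ ∘ ∧-true⁻) T⊆X rb mono) ⟩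
      ∣ X ∣     ≡⟨ sym (+-identityʳ ∣ X ∣) ⟩
      1 * ∣ X ∣ ∎
      where
      open ≤-Reasoning
      Z : Subset n
      Z w = H w ∧ allIn (Λ w) T
      mono : ∀ w → Z w ≡ true → ∃[ γ ] (γ ≢ diag × (∀ {t} → t ∈ᵥ T → colour w t ≡ γ))
      mono w Zw with sees w (proj₁ (∧-true⁻ Zw))
      ... | γ , γ≢ , m = γ , γ≢ , λ {t} t∈ → m t (allIn-∈ {v = T} (proj₂ (∧-true⁻ {H w} Zw)) t∈)

    -- Double counting of the pairs (w, T) with `w` in `H` and `T` a rainbow r-tuple in `Λ w`. Per
    -- vertex there are at least (|X|/B)^r / 2 tuples, per tuple at most |X|/P vertices. One factor
    -- 2 comes from `good`, the other from `X≤2H`.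
    averaging : P ≤ 4 * B ^ r
    averaging = *-cancelʳ-≤ P (4 * B ^ r) (∣ X ∣ * ∣ X ∣ ^ r) {{>-nonZero (m^n>0 ∣ X ∣ {{>-nonZero X>0}} (suc r))}} (begin
      P * (∣ X ∣ * ∣ X ∣ ^ r)
        ≤⟨ *-monoʳ-≤ P (*-monoˡ-≤ (∣ X ∣ ^ r) X≤2H) ⟩
      P * (2 * ∣ H ∣ * ∣ X ∣ ^ r)
        ≡⟨ arith₁ P ∣ H ∣ (∣ X ∣ ^ r) ⟩
      2 * P * (∣ H ∣ * ∣ X ∣ ^ r)
        ≡⟨ cong (2 * P *_) (sym (sum-*ʳ (λ w → 1[ H w ]) (∣ X ∣ ^ r))) ⟩
      2 * P * sum (λ w → 1[ H w ] * ∣ X ∣ ^ r)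
        ≤⟨ *-monoʳ-≤ (2 * P) (sum-mono (λ w → guard-≤ (H w) (lower w))) ⟩
      2 * P * sum (λ w → 1[ H w ] * (2 * B ^ r * 𝔼 (Λ w) r rainbow))
        ≡⟨ cong (2 * P *_) (trans (sum-cong-≗ (λ w → *-left-comm 1[ H w ] (2 * B ^ r) _)) (sym (*-distribˡ-sum (2 * B ^ r) (λ w → 1[ H w ] * 𝔼 (Λ w) r rainbow)))) ⟩
      2 * P * (2 * B ^ r * sum (λ w → 1[ H w ] * 𝔼 (Λ w) r rainbow))
        ≡⟨ cong (λ g → 2 * P * (2 * B ^ r * g)) (sym G≡) ⟩
      2 * P * (2 * B ^ r * G)
        ≡⟨ arith₂ P (B ^ r) G ⟩
      4 * B ^ r * (P * G)
        ≤⟨ *-monoʳ-≤ (4 * B ^ r) PG≤ ⟩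
      4 * B ^ r * (∣ X ∣ * ∣ X ∣ ^ r) ∎)
      where
      open ≤-Reasoning
      arith₁ : ∀ p h x → p * (2 * h * x) ≡ 2 * p * (h * x)
      arith₁ = solve-∀
      arith₂ : ∀ p b g → 2 * p * (2 * b * g) ≡ 4 * b * (p * g)
      arith₂ = solve-∀
      arith₃ : ∀ b e → b * (2 * e) ≡ 2 * b * e
      arith₃ = solve-∀
      lower : ∀ w → H w ≡ true → ∣ X ∣ ^ r ≤ 2 * B ^ r * 𝔼 (Λ w) r rainbow
      lower w Hw = begin
        ∣ X ∣ ^ r                        ≤⟨ ^-monoˡ-≤ r (large w Hw) ⟩
        (B * ∣ Λ w ∣) ^ r                ≡⟨ ^-distribʳ-* r B ∣ Λ w ∣ ⟩
        B ^ r * ∣ Λ w ∣ ^ r              ≤⟨ *-monoʳ-≤ (B ^ r) (good w Hw) ⟩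
        B ^ r * (2 * 𝔼 (Λ w) r rainbow)  ≡⟨ arith₃ (B ^ r) _ ⟩
        2 * B ^ r * 𝔼 (Λ w) r rainbow    ∎
      G≡ : G ≡ sum (λ w → 1[ H w ] * 𝔼 (Λ w) r rainbow)
      G≡ = trans (∑ᵥ-sum r (λ w T → common T w))
                 (sum-cong-≗ (λ w → ∑ᵥ-*ˡ r 1[ H w ] (λ T → 1[ allIn (Λ w) T ] * rainbow T)))
      PG≤ : P * G ≤ ∣ X ∣ * ∣ X ∣ ^ r
      PG≤ = begin
        P * G                                ≡⟨ sym (∑ᵥ-*ˡ r P (λ T → sum (common T))) ⟩
        ∑ᵥ r (λ T → P * sum (common T))      ≤⟨ ∑ᵥ-mono r common-bound ⟩
        𝔼 X r (λ _ → ∣ X ∣)                  ≡⟨ 𝔼-const X r ∣ X ∣ ⟩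
        ∣ X ∣ * ∣ X ∣ ^ r                    ∎

-- Arithmetic of powers, of the rates and of the loss per step.

^-cancelˡ-≤ : ∀ q → 1 ≤ q → ∀ {a b} → a ^ q ≤ b ^ q → a ≤ b
^-cancelˡ-≤ q 1≤q {a} {b} h with a ≤? b
... | yes a≤b = a≤b
... | no a≰b = ⊥-elim (<⇒≱ (^-monoˡ-< q {{>-nonZero 1≤q}} (≰⇒> a≰b)) h)

2^-cancel-≤ : ∀ {a b} → 2 ^ a ≤ 2 ^ b → a ≤ b
2^-cancel-≤ {a} {b} h with a ≤? b
... | yes a≤b = a≤b
... | no a≰b = ⊥-elim (<⇒≱ (^-monoʳ-< 2 (s≤s (s≤s z≤n)) (≰⇒> a≰b)) h)

2^-mono : ∀ {a b} → a ≤ b → 2 ^ a ≤ 2 ^ b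
2^-mono = ^-monoʳ-≤ 2

2^>0 : ∀ a → 1 ≤ 2 ^ a
2^>0 a = m^n>0 2 a

2^-cancelʳ : ∀ e {a b} → a * 2 ^ e ≤ b * 2 ^ e → a ≤ b
2^-cancelʳ e = *-cancelʳ-≤ _ _ (2 ^ e) {{m^n≢0 2 e}}

n<2^n : ∀ n → suc n ≤ 2 ^ n
n<2^n zero = ≤-refl
n<2^n (suc n) = begin
  suc (suc n)    ≤⟨ m≤m+n _ n ⟩
  suc (suc n) + n ≡⟨ arith n ⟩
  2 * suc n      ≤⟨ *-monoʳ-≤ 2 (n<2^n n) ⟩
  2 * 2 ^ n      ∎
  where
  open ≤-Reasoning
  arith : ∀ n → suc (suc n) + n ≡ 2 * suc n
  arith = solve-∀

-- Extremal subsets are obtained only under double negation. One is needed for every heavy vertex,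
-- and since the aim is a contradiction, finite choice under double negation suffices.
¬¬-finite-choice : ∀ {n} {P : Fin n → Set} → (∀ i → ¬ ¬ P i) → ¬ ¬ (∀ i → P i)
¬¬-finite-choice {zero} h ¬all = ¬all (λ ())
¬¬-finite-choice {suc n} {P} h ¬all =
  h zero (λ p₀ → ¬¬-finite-choice (h ∘ suc) (λ ps → ¬all (λ { zero → p₀ ; (suc i) → ps i })))

-- Numerator of the rate 2k - k/2^i over the denominator 2^i. Going from level i + 1 to level i
-- lowers the rate by k/2^(i+1), and it never falls below k.
p-level : ℕ → ℕ → ℕ
p-level k zero = k
p-level k (suc i) = 2 * p-level k i + k

k*2^i≤p : ∀ k i → k * 2 ^ i ≤ p-level k i
k*2^i≤p k zero = ≤-reflexive (*-identityʳ k)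
k*2^i≤p k (suc i) = begin
  k * (2 * 2 ^ i)         ≡⟨ arith k (2 ^ i) ⟩
  2 * (k * 2 ^ i)         ≤⟨ *-monoʳ-≤ 2 (k*2^i≤p k i) ⟩
  2 * p-level k i         ≤⟨ m≤m+n _ k ⟩
  2 * p-level k i + k     ∎
  where
  open ≤-Reasoning
  arith : ∀ k q → k * (2 * q) ≡ 2 * (k * q)
  arith = solve-∀

p+k≡2k*2^i : ∀ k i → p-level k i + k ≡ 2 * k * 2 ^ i
p+k≡2k*2^i k zero = arith k
  where
  arith : ∀ k → k + k ≡ 2 * k * 1
  arith = solve-∀
p+k≡2k*2^i k (suc i) = begin
  2 * p-level k i + k + k  ≡⟨ arith₁ k (p-level k i) ⟩
  2 * (p-level k i + k)    ≡⟨ cong (2 *_) (p+k≡2k*2^i k i) ⟩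
  2 * (2 * k * 2 ^ i)      ≡⟨ arith₂ k (2 ^ i) ⟩
  2 * k * (2 * 2 ^ i)      ∎
  where
  open ≡-Reasoning
  arith₁ : ∀ k p → 2 * p + k + k ≡ 2 * (p + k)
  arith₁ = solve-∀
  arith₂ : ∀ k q → 2 * (2 * k * q) ≡ 2 * k * (2 * q)
  arith₂ = solve-∀

p≤2k*2^i : ∀ k i → p-level k i ≤ 2 * k * 2 ^ i
p≤2k*2^i k i = ≤-trans (m≤m+n _ k) (≤-reflexive (p+k≡2k*2^i k i))

-- Here x, y, x′ stand for the sizes of sets X ⊇ Y ⊇ X′, and d for the number of colours lost from X to X′.
loss-arith : ∀ {x y x′} a q p k d → 1 ≤ q → p ≤ 2 * k * q → 1 ≤ x → x ≤ 2 ^ a * y →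
             y ^ q ≤ x′ ^ q * 2 ^ (p * d) →
             x′ ^ (2 * q) * 2 ^ ((2 * p + k) * d) ≤ x ^ (2 * q) →
             x ≤ 2 ^ (a + 4 * a * q) * x′
loss-arith {x} {y} {x′} a q p k d 1≤q p≤2kq 1≤x x≤ y≤ x′≤ = begin
  x                             ≤⟨ x≤ ⟩
  2 ^ a * y                     ≤⟨ *-monoʳ-≤ (2 ^ a) y≤′ ⟩
  2 ^ a * (x′ * 2 ^ (4 * a * q)) ≡⟨ arith₀ (2 ^ a) x′ _ ⟩
  2 ^ a * 2 ^ (4 * a * q) * x′   ≡⟨ cong (_* x′) (sym (^-distribˡ-+-* 2 a (4 * a * q))) ⟩
  2 ^ (a + 4 * a * q) * x′ ∎
  where
  open ≤-Reasoning
  arith₀ : ∀ a b c → a * (b * c) ≡ a * c * b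
  arith₀ = solve-∀
  x′≢0 : x′ ≢ 0
  x′≢0 refl = <⇒≱ (m^n>0 y {{>-nonZero 1≤y}} q) (≤-trans y≤ (≤-reflexive (cong (_* 2 ^ (p * d)) (0^ 1≤q))))
    where
    0^ : ∀ {q} → 1 ≤ q → 0 ^ q ≡ 0
    0^ (s≤s _) = refl
    1≤y : 1 ≤ y
    1≤y = n≢0⇒n>0 (λ y≡0 → <⇒≱ 1≤x (≤-trans x≤ (≤-reflexive (trans (cong (2 ^ a *_) y≡0) (*-zeroʳ (2 ^ a))))))
  u = x′ ^ q
  -- Substituting the lower bound for x′ into the upper one cancels x′^(2q) 2^(2pd); only the
  -- surplus `k` of the higher rate is left, and it bounds d.
  kd≤ : k * d ≤ 2 * a * q
  kd≤ = 2^-cancel-≤ (*-cancelˡ-≤ (u * u * (2 ^ (p * d) * 2 ^ (p * d))) {{nz}} (begin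
    u * u * (2 ^ (p * d) * 2 ^ (p * d)) * 2 ^ (k * d)
      ≡⟨ *-assoc (u * u) _ _ ⟩
    u * u * (2 ^ (p * d) * 2 ^ (p * d) * 2 ^ (k * d))
      ≡⟨ cong₂ _*_ (sym (square x′)) (trans (cong (_* 2 ^ (k * d)) (sym (^-distribˡ-+-* 2 (p * d) (p * d)))) (trans (sym (^-distribˡ-+-* 2 (p * d + p * d) (k * d))) (cong (2 ^_) (arith₁ p k d)))) ⟩
    x′ ^ (2 * q) * 2 ^ ((2 * p + k) * d)  ≤⟨ x′≤ ⟩
    x ^ (2 * q)                           ≡⟨ square x ⟩
    x ^ q * x ^ q                         ≤⟨ *-mono-≤ xq≤ xq≤ ⟩
    2 ^ (a * q) * (u * 2 ^ (p * d)) * (2 ^ (a * q) * (u * 2 ^ (p * d)))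
      ≡⟨ arith₂ (2 ^ (a * q)) u (2 ^ (p * d)) ⟩
    u * u * (2 ^ (p * d) * 2 ^ (p * d)) * (2 ^ (a * q) * 2 ^ (a * q))
      ≡⟨ cong (u * u * (2 ^ (p * d) * 2 ^ (p * d)) *_) (trans (sym (^-distribˡ-+-* 2 (a * q) (a * q))) (cong (2 ^_) (arith₃ a q))) ⟩
    u * u * (2 ^ (p * d) * 2 ^ (p * d)) * 2 ^ (2 * a * q) ∎))
    where
    nz : NonZero (u * u * (2 ^ (p * d) * 2 ^ (p * d)))
    nz = >-nonZero (*-mono-≤ (*-mono-≤ 1≤u 1≤u) (*-mono-≤ (2^>0 (p * d)) (2^>0 (p * d))))
      where
      1≤u : 1 ≤ u
      1≤u = m^n>0 x′ {{>-nonZero (n≢0⇒n>0 x′≢0)}} q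
    square : ∀ z → z ^ (2 * q) ≡ z ^ q * z ^ q
    square z = trans (cong (z ^_) (cong (q +_) (+-identityʳ q))) (^-distribˡ-+-* z q q)
    arith₁ : ∀ p k d → p * d + p * d + k * d ≡ (2 * p + k) * d
    arith₁ = solve-∀
    arith₂ : ∀ b u e → b * (u * e) * (b * (u * e)) ≡ u * u * (e * e) * (b * b)
    arith₂ = solve-∀
    arith₃ : ∀ a q → a * q + a * q ≡ 2 * a * q
    arith₃ = solve-∀
    xq≤ : x ^ q ≤ 2 ^ (a * q) * (u * 2 ^ (p * d))
    xq≤ = begin
      x ^ q                              ≤⟨ ^-monoˡ-≤ q x≤ ⟩
      (2 ^ a * y) ^ q                    ≡⟨ ^-distribʳ-* q (2 ^ a) y ⟩
      (2 ^ a) ^ q * y ^ q                ≡⟨ cong (_* y ^ q) (^-*-assoc 2 a q) ⟩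
      2 ^ (a * q) * y ^ q                ≤⟨ *-monoʳ-≤ (2 ^ (a * q)) y≤ ⟩
      2 ^ (a * q) * (u * 2 ^ (p * d))    ∎
  -- With d bounded, y/x′ ≤ 2^(pd/q) ≤ 2^(2kd) ≤ 2^(4aq).
  y≤′ : y ≤ x′ * 2 ^ (4 * a * q)
  y≤′ = ^-cancelˡ-≤ q 1≤q (begin
    y ^ q                                ≤⟨ y≤ ⟩
    x′ ^ q * 2 ^ (p * d)                 ≤⟨ *-monoʳ-≤ (x′ ^ q) (2^-mono exponent) ⟩
    x′ ^ q * 2 ^ (4 * a * q * q)         ≡⟨ cong (x′ ^ q *_) (sym (^-*-assoc 2 (4 * a * q) q)) ⟩
    x′ ^ q * (2 ^ (4 * a * q)) ^ q       ≡⟨ sym (^-distribʳ-* q x′ _) ⟩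
    (x′ * 2 ^ (4 * a * q)) ^ q           ∎)
    where
    arith₄ : ∀ k q d → 2 * k * q * d ≡ 2 * q * (k * d)
    arith₄ = solve-∀
    arith₅ : ∀ a q → 2 * q * (2 * a * q) ≡ 4 * a * q * q
    arith₅ = solve-∀
    exponent : p * d ≤ 4 * a * q * q
    exponent = begin
      p * d             ≤⟨ *-monoˡ-≤ d p≤2kq ⟩
      2 * k * q * d     ≡⟨ arith₄ k q d ⟩
      2 * q * (k * d)   ≤⟨ *-monoʳ-≤ (2 * q) kd≤ ⟩
      2 * q * (2 * a * q) ≡⟨ arith₅ a q ⟩
      4 * a * q * q ∎

-- Colour classes, heavy and light vertices, extremal subsets.

module Descent {n M : ℕ} (colour : Fin n → Fin n → Fin M) (colour-sym : ∀ x y → colour x y ≡ colour y x)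
               (diag : Fin M) (colour-refl : ∀ x → colour x x ≡ diag) (colour-off : ∀ x y → colour x y ≡ diag → x ≡ y)
               (no-square : ∀ x y s t → x ≢ y → s ≢ t → x ≢ s → x ≢ t → y ≢ s → y ≢ t →
                            colour x s ≡ colour x t → colour y s ≡ colour y t → colour x y ≢ colour s t)
               where

  open Rainbow colour colour-sym diag colour-refl no-square public

  class : Subset n → Fin n → Fin M → Subset n
  class X w γ z = X z ∧ does (colour w z ≟ᶠ γ)

  ∣class∣ : ∀ X w γ → ∣ class X w γ ∣ ≡ deg X w γ
  ∣class∣ X w γ = sum-cong-≗ (λ z → 1[∧] (X z) (does (colour w z ≟ᶠ γ)))

  class-colour : ∀ X w γ z → class X w γ z ≡ true → colour w z ≡ γ
  class-colour X w γ z h with colour w z ≟ᶠ γ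
  ... | yes eq = eq
  ... | no _ with ∧-true⁻ {X z} h
  ...   | _ , ()

  HeavyAt : ℕ → Subset n → Fin n → Set
  HeavyAt b X w = ∃[ γ ] (γ ≢ diag × ∣ X ∣ ≤ b * ∣ class X w γ ∣)

  heavyAt? : ∀ b X w → Dec (HeavyAt b X w)
  heavyAt? b X w = any? (λ γ → ¬? (γ ≟ᶠ diag) ×-dec (∣ X ∣ ≤? b * ∣ class X w γ ∣))

  heavy light : ℕ → Subset n → Subset n
  heavy b X w = X w ∧ does (heavyAt? b X w)
  light b X w = X w ∧ not (does (heavyAt? b X w))

  Heavy : ℕ → Subset n → Set
  Heavy b X = ∣ X ∣ ≤ 2 * ∣ heavy b X ∣

  ∣heavy∣+∣light∣ : ∀ b X → ∣ X ∣ ≡ ∣ heavy b X ∣ + ∣ light b X ∣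
  ∣heavy∣+∣light∣ b X = trans (sum-cong-≗ (λ w → split (X w) (does (heavyAt? b X w))))
                             (∑-distrib-+ (λ w → 1[ heavy b X w ]) (λ w → 1[ light b X w ]))
    where
    split : ∀ a b → 1[ a ] ≡ 1[ a ∧ b ] + 1[ a ∧ not b ]
    split true true = refl
    split true false = refl
    split false _ = refl

  heavy⁻ : ∀ {b X w} → heavy b X w ≡ true → HeavyAt b X w
  heavy⁻ {b} {X} {w} h with heavyAt? b X w
  ... | yes p = p
  ... | no _ with ∧-true⁻ {X w} h
  ...   | _ , ()

  light⁻ : ∀ {b X w} → light b X w ≡ true → ¬ HeavyAt b X w
  light⁻ {b} {X} {w} h with heavyAt? b X w
  ... | no ¬p = ¬p
  ... | yes _ with ∧-true⁻ {X w} h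
  ...   | _ , ()

  deg-diag : ∀ X x → deg X x diag ≤ 1
  deg-diag X x = ≤-trans (sum-mono pointwise) (≤-reflexive (sum-δ x))
    where
    pointwise : ∀ z → 1[ X z ] * δ (colour x z) diag ≤ 1[ does (x ≟ᶠ z) ]
    pointwise z with X z | colour x z ≟ᶠ diag
    ... | false | _ = z≤n
    ... | true | no _ = z≤n
    ... | true | yes eq with x ≟ᶠ z
    ...   | yes _ = ≤-refl
    ...   | no x≢z = ⊥-elim (x≢z (colour-off x z eq))

  deg-mono : ∀ {X Y} → X ⊆ Y → ∀ x c → deg X x c ≤ deg Y x c
  deg-mono X⊆Y x c = sum-mono (λ z → *-monoˡ-≤ (δ (colour x z) c) (1[]-mono (X⊆Y z)))

  ∣light∣-large : ∀ b X → ¬ Heavy b X → ∣ X ∣ ≤ 2 * ∣ light b X ∣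
  ∣light∣-large b X ¬heavy = +-cancelˡ-≤ ∣ X ∣ _ _ (begin
    ∣ X ∣ + ∣ X ∣                                ≡⟨ cong₂ _+_ (∣heavy∣+∣light∣ b X) (∣heavy∣+∣light∣ b X) ⟩
    h + l + (h + l)                              ≡⟨ arith h l ⟩
    2 * h + 2 * l                                ≤⟨ +-monoˡ-≤ (2 * l) (<⇒≤ (≰⇒> ¬heavy)) ⟩
    ∣ X ∣ + 2 * l ∎)
    where
    open ≤-Reasoning
    h = ∣ heavy b X ∣
    l = ∣ light b X ∣
    arith : ∀ h l → h + l + (h + l) ≡ 2 * h + 2 * l
    arith = solve-∀

  -- A light vertex has degrees below |X|/(2β), and at least half of `X` is light, which uses up the
  -- factor 2. Lightness does not speak about `diag`; there the degree is at most 1, and the lower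
  -- bound on |X| covers it.
  light-degrees : ∀ β X → ¬ Heavy (2 * β) X → 2 * β ≤ ∣ X ∣ →
                  ∀ x → light (2 * β) X x ≡ true → ∀ c → β * deg (light (2 * β) X) x c ≤ ∣ light (2 * β) X ∣
  light-degrees β X ¬heavy 2β≤ x Λx c = *-cancelˡ-≤ 2 (≤-trans bound (∣light∣-large (2 * β) X ¬heavy))
    where
    open ≤-Reasoning
    Λ = light (2 * β) X
    bound : 2 * (β * deg Λ x c) ≤ ∣ X ∣
    bound with c ≟ᶠ diag
    ... | yes refl = begin
      2 * (β * deg Λ x diag) ≤⟨ *-monoʳ-≤ 2 (*-monoʳ-≤ β (deg-diag Λ x)) ⟩
      2 * (β * 1)            ≡⟨ cong (2 *_) (*-identityʳ β) ⟩
      2 * β                  ≤⟨ 2β≤ ⟩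
      ∣ X ∣ ∎
    ... | no c≢ with ∣ X ∣ ≤? 2 * β * ∣ class X x c ∣
    ...   | yes h = ⊥-elim (light⁻ {2 * β} {X} Λx (c , c≢ , h))
    ...   | no ¬h = begin
      2 * (β * deg Λ x c)      ≤⟨ *-monoʳ-≤ 2 (*-monoʳ-≤ β (deg-mono {Λ} {X} (λ z → proj₁ ∘ ∧-true⁻ {X z}) x c)) ⟩
      2 * (β * deg X x c)      ≡⟨ sym (*-assoc 2 β _) ⟩
      2 * β * deg X x c        ≡⟨ cong (2 * β *_) (sym (∣class∣ X x c)) ⟩
      2 * β * ∣ class X x c ∣  ≤⟨ <⇒≤ (≰⇒> ¬h) ⟩
      ∣ X ∣ ∎

  -- |Y| 2^(-ρ #colours Y) ≤ |X| 2^(-ρ #colours X) with ρ = p / q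
  Dominates : ℕ → ℕ → Subset n → Subset n → Set
  Dominates q p X Y = ∣ Y ∣ ^ q * 2 ^ (p * #colours X) ≤ ∣ X ∣ ^ q * 2 ^ (p * #colours Y)

  Extremal : ℕ → ℕ → Subset n → Set
  Extremal q p X = ∀ Y → Y ⊆ X → Dominates q p X Y

  dominates-trans : ∀ q p {X Y Z} → Dominates q p X Y → Dominates q p Y Z → Dominates q p X Z
  dominates-trans q p {X} {Y} {Z} XY YZ = 2^-cancelʳ (p * #colours Y) (begin
    z * 2 ^ (p * #colours X) * 2 ^ (p * #colours Y)  ≡⟨ exchange z _ _ ⟩
    z * 2 ^ (p * #colours Y) * 2 ^ (p * #colours X)  ≤⟨ *-monoˡ-≤ _ YZ ⟩
    y * 2 ^ (p * #colours Z) * 2 ^ (p * #colours X)  ≡⟨ exchange y _ _ ⟩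
    y * 2 ^ (p * #colours X) * 2 ^ (p * #colours Z)  ≤⟨ *-monoˡ-≤ _ XY ⟩
    x * 2 ^ (p * #colours Y) * 2 ^ (p * #colours Z)  ≡⟨ exchange x _ _ ⟩
    x * 2 ^ (p * #colours Z) * 2 ^ (p * #colours Y)  ∎)
    where
    open ≤-Reasoning
    x = ∣ X ∣ ^ q
    y = ∣ Y ∣ ^ q
    z = ∣ Z ∣ ^ q
    exchange : ∀ a b c → a * b * c ≡ a * c * b
    exchange = solve-∀

  -- A subset of `Y` that violates domination has strictly fewer colours, since it cannot be larger
  -- than `Y`. Hence replacing `Y` by a violator stops after at most `#colours Y` rounds, and
  -- domination is transitive. The double negation replaces a search through all subsets.
  extremal-exists : ∀ q p Y → ¬ ¬ (∃[ X ] (X ⊆ Y × Extremal q p X × Dominates q p X Y))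
  extremal-exists q p Y = search (#colours Y) Y ≤-refl
    where
    search : ∀ s Y → #colours Y ≤ s → ¬ ¬ (∃[ X ] (X ⊆ Y × Extremal q p X × Dominates q p X Y))
    search s Y #Y≤s none = none (Y , (λ _ → id) , (λ Z Z⊆Y → extremal Z Z⊆Y s #Y≤s) , ≤-refl)
      where
      extremal : ∀ Z → Z ⊆ Y → ∀ s → #colours Y ≤ s → Dominates q p Y Z
      extremal Z Z⊆Y s #Y≤s with ∣ Z ∣ ^ q * 2 ^ (p * #colours Y) ≤? ∣ Y ∣ ^ q * 2 ^ (p * #colours Z)
      ... | yes h = h
      ... | no ¬h with #colours Y ≤? #colours Z
      ...   | yes #Y≤#Z = *-mono-≤ (^-monoˡ-≤ q (∣∣-mono Z⊆Y)) (2^-mono (*-monoʳ-≤ p #Y≤#Z))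
      extremal Z Z⊆Y zero #Y≤s    | no ¬h | no #Y≰#Z = ⊥-elim (#Y≰#Z (≤-trans #Y≤s z≤n))
      extremal Z Z⊆Y (suc s) #Y≤s | no ¬h | no #Y≰#Z =
        ⊥-elim (search s Z (≤-pred (≤-trans (≰⇒> #Y≰#Z) #Y≤s))
          (λ { (X , X⊆Z , ext , dom) → none (X , (λ x → Z⊆Y x ∘ X⊆Z x) , ext ,
                 dominates-trans q p {X} {Z} {Y} dom (<⇒≤ (≰⇒> ¬h))) }))

  -- Supplies the hypothesis `kill` of the averaging: each missing colour costs a factor 2^(p/q),
  -- and p/q ≥ k.
  extremal-kill : ∀ q p k X → 1 ≤ q → k * q ≤ p → Extremal q p X →
                  ∀ Z → Z ⊆ X → ∀ d → #colours Z + d ≤ #colours X → 2 ^ (k * d) * ∣ Z ∣ ≤ ∣ X ∣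
  extremal-kill q p k X 1≤q kq≤p ext Z Z⊆X d #≤ = ^-cancelˡ-≤ q 1≤q (2^-cancelʳ (p * #colours Z) (begin
    (2 ^ (k * d) * ∣ Z ∣) ^ q * 2 ^ (p * #colours Z)
      ≡⟨ cong (_* 2 ^ (p * #colours Z)) (trans (^-distribʳ-* q (2 ^ (k * d)) ∣ Z ∣) (cong (_* ∣ Z ∣ ^ q) (^-*-assoc 2 (k * d) q))) ⟩
    2 ^ (k * d * q) * ∣ Z ∣ ^ q * 2 ^ (p * #colours Z)
      ≡⟨ arith₁ (2 ^ (k * d * q)) (∣ Z ∣ ^ q) (2 ^ (p * #colours Z)) ⟩
    ∣ Z ∣ ^ q * (2 ^ (k * d * q) * 2 ^ (p * #colours Z))
      ≡⟨ cong (∣ Z ∣ ^ q *_) (sym (^-distribˡ-+-* 2 (k * d * q) (p * #colours Z))) ⟩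
    ∣ Z ∣ ^ q * 2 ^ (k * d * q + p * #colours Z)
      ≤⟨ *-monoʳ-≤ (∣ Z ∣ ^ q) (2^-mono exponent) ⟩
    ∣ Z ∣ ^ q * 2 ^ (p * #colours X)
      ≤⟨ ext Z Z⊆X ⟩
    ∣ X ∣ ^ q * 2 ^ (p * #colours Z) ∎))
    where
    open ≤-Reasoning
    arith₁ : ∀ a b c → a * b * c ≡ b * (a * c)
    arith₁ = solve-∀
    arith₂ : ∀ k d q p z → k * d * q + p * z ≡ k * q * d + p * z
    arith₂ = solve-∀
    arith₃ : ∀ p d z → p * d + p * z ≡ p * (z + d)
    arith₃ = solve-∀
    exponent : k * d * q + p * #colours Z ≤ p * #colours X
    exponent = begin
      k * d * q + p * #colours Z ≡⟨ arith₂ k d q p (#colours Z) ⟩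
      k * q * d + p * #colours Z ≤⟨ +-monoˡ-≤ _ (*-monoˡ-≤ d kq≤p) ⟩
      p * d + p * #colours Z     ≡⟨ arith₃ p d (#colours Z) ⟩
      p * (#colours Z + d)       ≤⟨ *-monoʳ-≤ p #≤ ⟩
      p * #colours X ∎

  -- With d the number of colours of `X` missing from `X′`, domination of `Y` at rate p/q bounds
  -- |X′| from below, and extremality of `X` at the rate larger by k/(2q) bounds it from above. The
  -- two bounds are compatible only for small d.
  extremal-loss : ∀ a q p k X Y X′ → 1 ≤ q → p ≤ 2 * k * q → 1 ≤ ∣ X ∣ → ∣ X ∣ ≤ 2 ^ a * ∣ Y ∣ →
                  X′ ⊆ Y → Y ⊆ X → Extremal (2 * q) (2 * p + k) X → Dominates q p X′ Y →
                  ∣ X ∣ ≤ 2 ^ (a + 4 * a * q) * ∣ X′ ∣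
  extremal-loss a q p k X Y X′ 1≤q p≤ 1≤X X≤ X′⊆Y Y⊆X ext dom =
    loss-arith a q p k d 1≤q p≤ 1≤X X≤
      (2^-cancelʳ (p * #colours X′) (begin
        ∣ Y ∣ ^ q * 2 ^ (p * #colours X′)            ≤⟨ dom ⟩
        ∣ X′ ∣ ^ q * 2 ^ (p * #colours Y)            ≤⟨ *-monoʳ-≤ (∣ X′ ∣ ^ q) (2^-mono (*-monoʳ-≤ p (#colours-mono Y⊆X))) ⟩
        ∣ X′ ∣ ^ q * 2 ^ (p * #colours X)            ≡⟨ cong (∣ X′ ∣ ^ q *_) (split p) ⟩
        ∣ X′ ∣ ^ q * (2 ^ (p * d) * 2 ^ (p * #colours X′)) ≡⟨ sym (*-assoc (∣ X′ ∣ ^ q) _ _) ⟩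
        ∣ X′ ∣ ^ q * 2 ^ (p * d) * 2 ^ (p * #colours X′) ∎))
      (2^-cancelʳ ((2 * p + k) * #colours X′) (begin
        ∣ X′ ∣ ^ (2 * q) * 2 ^ ((2 * p + k) * d) * 2 ^ ((2 * p + k) * #colours X′)
          ≡⟨ *-assoc (∣ X′ ∣ ^ (2 * q)) _ _ ⟩
        ∣ X′ ∣ ^ (2 * q) * (2 ^ ((2 * p + k) * d) * 2 ^ ((2 * p + k) * #colours X′))
          ≡⟨ cong (∣ X′ ∣ ^ (2 * q) *_) (sym (split (2 * p + k))) ⟩
        ∣ X′ ∣ ^ (2 * q) * 2 ^ ((2 * p + k) * #colours X)
          ≤⟨ ext X′ (λ x → Y⊆X x ∘ X′⊆Y x) ⟩
        ∣ X ∣ ^ (2 * q) * 2 ^ ((2 * p + k) * #colours X′) ∎))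
    where
    open ≤-Reasoning
    d = #colours X ∸ #colours X′
    split : ∀ p → 2 ^ (p * #colours X) ≡ 2 ^ (p * d) * 2 ^ (p * #colours X′)
    split p = trans (cong (2 ^_) (trans (cong (p *_) (sym (m∸n+n≡m (#colours-mono (λ x → Y⊆X x ∘ X′⊆Y x)))))
                                        (*-distribˡ-+ p d (#colours X′))))
                    (^-distribˡ-+-* 2 (p * d) (p * #colours X′))

-- The descent through the levels and the contradiction for many vertices.

4r⁴≤ : ∀ A i → 14 ≤ A → let r = suc (2 ^ i * 2 ^ i) in 4 * (r * r * r * r) ≤ 2 ^ (A * 2 ^ i)
4r⁴≤ A i 14≤A = begin
  4 * (r * r * r * r)       ≤⟨ *-monoʳ-≤ 4 (*-mono-≤ (*-mono-≤ (*-mono-≤ r≤s r≤s) r≤s) r≤s) ⟩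
  4 * (s * s * s * s)       ≡⟨ arith₁ (Q * Q) ⟩
  2 ^ 6 * ((Q * Q) * (Q * Q) * ((Q * Q) * (Q * Q)))
    ≡⟨ cong (2 ^ 6 *_) (trans (cong (λ z → z * z * (z * z)) (sym (^-distribˡ-+-* 2 i i)))
         (trans (cong (λ z → z * z) (sym (^-distribˡ-+-* 2 (i + i) (i + i)))) (sym (^-distribˡ-+-* 2 (i + i + (i + i)) (i + i + (i + i)))))) ⟩
  2 ^ 6 * 2 ^ (i + i + (i + i) + (i + i + (i + i)))
    ≡⟨ sym (^-distribˡ-+-* 2 6 (i + i + (i + i) + (i + i + (i + i)))) ⟩
  2 ^ (6 + (i + i + (i + i) + (i + i + (i + i))))
    ≤⟨ 2^-mono exponent ⟩
  2 ^ (A * Q) ∎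
  where
  open ≤-Reasoning
  Q = 2 ^ i
  r = suc (Q * Q)
  s = 2 * (Q * Q)
  1≤QQ : 1 ≤ Q * Q
  1≤QQ = *-mono-≤ (2^>0 i) (2^>0 i)
  r≤s : r ≤ s
  r≤s = ≤-trans (+-monoˡ-≤ (Q * Q) 1≤QQ) (≤-reflexive (cong (Q * Q +_) (sym (+-identityʳ (Q * Q)))))
  arith₁ : ∀ z → 4 * (2 * z * (2 * z) * (2 * z) * (2 * z)) ≡ 64 * (z * z * (z * z))
  arith₁ = solve-∀
  arith₂ : ∀ i → 6 + (i + i + (i + i) + (i + i + (i + i))) + 2 + 6 * i ≡ 8 + 14 * i
  arith₂ = solve-∀
  arith₃ : ∀ i → 8 + 14 * i + 6 ≡ 14 * suc i
  arith₃ = solve-∀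
  -- As r ≤ 2^(2i+1), the left side is at most 2^(8i+6), linear in i in the exponent against A 2^i ≥
  -- 14 (i + 1); the value 14 is convenient, not optimised.
  exponent : 6 + (i + i + (i + i) + (i + i + (i + i))) ≤ A * Q
  exponent = begin
    6 + (i + i + (i + i) + (i + i + (i + i)))              ≤⟨ m≤m+n _ 2 ⟩
    6 + (i + i + (i + i) + (i + i + (i + i))) + 2          ≤⟨ m≤m+n _ (6 * i) ⟩
    6 + (i + i + (i + i) + (i + i + (i + i))) + 2 + 6 * i  ≡⟨ arith₂ i ⟩
    8 + 14 * i                                             ≤⟨ m≤m+n _ 6 ⟩
    8 + 14 * i + 6                                         ≡⟨ arith₃ i ⟩
    14 * suc i                                             ≤⟨ *-mono-≤ 14≤A (n<2^n i) ⟩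
    A * Q ∎

-- With r = s + 1, the gain k r s / 2 and the cost r (10 A s + 1) + 2 are both quadratic in s. After
-- doubling, 20 A of `k` pays for the leading term and the remaining 7 for the lower-order terms.
pairs-too-many : ∀ A k s → 20 * A + 7 ≤ k → 1 ≤ s →
                 ¬ (2 ^ (k * pairs (suc s)) ≤ 4 * (2 ^ (10 * A * s + 1)) ^ suc s)
pairs-too-many A k s k≥ 1≤s h = <⇒≱ exceeds (begin
  k * (suc s * s)              ≡⟨ cong (k *_) (sym (2*pairs s)) ⟩
  k * (2 * pairs (suc s))      ≡⟨ arith₁ k (pairs (suc s)) ⟩
  2 * (k * pairs (suc s))      ≤⟨ *-monoʳ-≤ 2 (2^-cancel-≤ {k * pairs (suc s)} {2 + (10 * A * s + 1) * suc s} h′) ⟩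
  2 * (2 + (10 * A * s + 1) * suc s) ≡⟨ arith₂ A s ⟩
  20 * A * (suc s * s) + (4 + 2 * suc s) ∎)
  where
  open ≤-Reasoning
  h′ : 2 ^ (k * pairs (suc s)) ≤ 2 ^ (2 + (10 * A * s + 1) * suc s)
  h′ = begin
    2 ^ (k * pairs (suc s)) ≤⟨ h ⟩
    4 * (2 ^ (10 * A * s + 1)) ^ suc s   ≡⟨ cong (4 *_) (^-*-assoc 2 (10 * A * s + 1) (suc s)) ⟩
    4 * 2 ^ ((10 * A * s + 1) * suc s)   ≡⟨ sym (^-distribˡ-+-* 2 2 ((10 * A * s + 1) * suc s)) ⟩
    2 ^ (2 + (10 * A * s + 1) * suc s) ∎
  arith₁ : ∀ k p → k * (2 * p) ≡ 2 * (k * p)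
  arith₁ = solve-∀
  arith₂ : ∀ A s → 2 * (2 + (10 * A * s + 1) * suc s) ≡ 20 * A * (suc s * s) + (4 + 2 * suc s)
  arith₂ = solve-∀
  arith₃ : ∀ s → 5 + 2 * suc s ≡ 7 + 2 * s
  arith₃ = solve-∀
  arith₄ : ∀ A s → 20 * A * (suc s * s) + 7 * (suc s * s) ≡ (20 * A + 7) * (suc s * s)
  arith₄ = solve-∀
  arith₅ : ∀ s → 7 * (suc s * 1) ≡ 7 + 2 * s + 5 * s
  arith₅ = solve-∀
  exceeds : 20 * A * (suc s * s) + (4 + 2 * suc s) < k * (suc s * s)
  exceeds = begin
    suc (20 * A * (suc s * s) + (4 + 2 * suc s)) ≡⟨ sym (+-suc (20 * A * (suc s * s)) (4 + 2 * suc s)) ⟩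
    20 * A * (suc s * s) + (5 + 2 * suc s)       ≤⟨ +-monoʳ-≤ (20 * A * (suc s * s)) small ⟩
    20 * A * (suc s * s) + 7 * (suc s * s)       ≡⟨ arith₄ A s ⟩
    (20 * A + 7) * (suc s * s)                   ≤⟨ *-monoˡ-≤ (suc s * s) k≥ ⟩
    k * (suc s * s) ∎
    where
    small : 5 + 2 * suc s ≤ 7 * (suc s * s)
    small = begin
      5 + 2 * suc s       ≡⟨ arith₃ s ⟩
      7 + 2 * s           ≤⟨ m≤m+n _ (5 * s) ⟩
      7 + 2 * s + 5 * s   ≡⟨ sym (arith₅ s) ⟩
      7 * (suc s * 1)     ≤⟨ *-monoʳ-≤ 7 (*-monoʳ-≤ (suc s) 1≤s) ⟩
      7 * (suc s * s) ∎

-- Selects the starting level. With Q = 2^i, the lower bound on m keeps the required size 2^(5 A Q²)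
-- within 2^(k m); the upper bound makes the number of colours polynomial in Q, hence small against
-- 2^(A Q).
level-of : ∀ m → 1 ≤ m → ∃[ i ] (2 ^ i * 2 ^ i ≤ m × m < 4 * (2 ^ i * 2 ^ i))
level-of (suc zero) _ = 0 , s≤s z≤n , s≤s (s≤s z≤n)
level-of (suc (suc m)) _ with level-of (suc m) (s≤s z≤n)
... | i , lo , hi with suc (suc m) <? 4 * (2 ^ i * 2 ^ i)
...   | yes lt = i , ≤-trans lo (n≤1+n _) , lt
...   | no ≮ = suc i , ≤-trans (≤-reflexive (arith (2 ^ i))) (≮⇒≥ ≮) , (begin
    suc (suc (suc m))     ≤⟨ s≤s hi ⟩
    1 + 4 * (2 ^ i * 2 ^ i)  ≤⟨ +-monoˡ-≤ (4 * (2 ^ i * 2 ^ i)) (≤-trans (*-mono-≤ (2^>0 i) (2^>0 i)) (m≤n*m _ 12)) ⟩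
    12 * (2 ^ i * 2 ^ i) + 4 * (2 ^ i * 2 ^ i) ≡⟨ arith′ (2 ^ i) ⟩
    4 * (2 ^ suc i * 2 ^ suc i) ∎)
  where
  open ≤-Reasoning
  arith : ∀ q → 2 * q * (2 * q) ≡ 4 * (q * q)
  arith = solve-∀
  arith′ : ∀ q → 12 * (q * q) + 4 * (q * q) ≡ 4 * (2 * q * (2 * q))
  arith′ = solve-∀

module NoSquare (A k : ℕ) (14≤A : 14 ≤ A) (k≥ : 20 * A + 7 ≤ k)
                {n M : ℕ} (colour : Fin n → Fin n → Fin M) (colour-sym : ∀ x y → colour x y ≡ colour y x)
                (diag : Fin M) (colour-refl : ∀ x → colour x x ≡ diag) (colour-off : ∀ x y → colour x y ≡ diag → x ≡ y)
                (no-square : ∀ x y s t → x ≢ y → s ≢ t → x ≢ s → x ≢ t → y ≢ s → y ≢ t →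
                             colour x s ≡ colour x t → colour y s ≡ colour y t → colour x y ≢ colour s t)
                where

  open Descent colour colour-sym diag colour-refl colour-off no-square

  -- A pair spans a single colour, which can collide only with the sentinel, that is, when both
  -- entries agree. There are |X| such pairs, at most half of all once |X| ≥ 2.
  rainbow-pairs : ∀ X → 2 ≤ ∣ X ∣ → ∣ X ∣ ^ 2 ≤ 2 * 𝔼 X 2 rainbow
  rainbow-pairs X 2≤ = +-cancelʳ-≤ (2 * ∣ X ∣) _ _ (begin
    ∣ X ∣ ^ 2 + 2 * ∣ X ∣             ≤⟨ +-monoʳ-≤ (∣ X ∣ ^ 2) (≤-trans (*-monoˡ-≤ ∣ X ∣ 2≤) (≤-reflexive (cong (∣ X ∣ *_) (sym (*-identityʳ ∣ X ∣))))) ⟩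
    ∣ X ∣ ^ 2 + ∣ X ∣ ^ 2             ≡⟨ arith (∣ X ∣ ^ 2) ⟩
    2 * (1 * ∣ X ∣ ^ 2)               ≡⟨ cong (2 *_) (sym (𝔼-const X 2 1)) ⟩
    2 * 𝔼 X 2 (λ _ → 1)               ≤⟨ *-monoʳ-≤ 2 (𝔼-mono X 2 (λ v _ → one≤ v)) ⟩
    2 * 𝔼 X 2 (λ v → rainbow v + equal v) ≡⟨ cong (2 *_) (𝔼-+ X 2 rainbow equal) ⟩
    2 * (𝔼 X 2 rainbow + 𝔼 X 2 equal) ≤⟨ *-monoʳ-≤ 2 (+-monoʳ-≤ (𝔼 X 2 rainbow) equal≤) ⟩
    2 * (𝔼 X 2 rainbow + ∣ X ∣)       ≡⟨ *-distribˡ-+ 2 (𝔼 X 2 rainbow) ∣ X ∣ ⟩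
    2 * 𝔼 X 2 rainbow + 2 * ∣ X ∣ ∎)
    where
    open ≤-Reasoning
    arith : ∀ a → a + a ≡ 2 * (1 * a)
    arith = solve-∀
    equal : Vec (Fin n) 2 → ℕ
    equal (x ∷ y ∷ []) = 1[ does (x ≟ᶠ y) ]
    one≤ : ∀ v → 1 ≤ rainbow v + equal v
    one≤ (x ∷ y ∷ []) with colour x y ≟ᶠ diag
    ... | no _ = s≤s z≤n
    ... | yes eq with x ≟ᶠ y
    ...   | yes _ = s≤s z≤n
    ...   | no x≢y = ⊥-elim (x≢y (colour-off x y eq))
    equal≤ : 𝔼 X 2 equal ≤ ∣ X ∣
    equal≤ = begin
      𝔼 X 2 equal ≡⟨ 𝔼-suc X 1 equal ⟩
      sum (λ x → 1[ X x ] * 𝔼 X 1 (λ v → equal (x ∷ v)))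
        ≤⟨ sum-mono (λ x → *-monoʳ-≤ 1[ X x ] (≤-trans (sum-mono (λ y → drop (allIn X (y ∷ [])) _)) (≤-reflexive (sum-δ x)))) ⟩
      sum (λ x → 1[ X x ] * 1) ≡⟨ sum-cong-≗ (λ x → *-identityʳ 1[ X x ]) ⟩
      ∣ X ∣ ∎
      where
      drop : ∀ b e → 1[ b ] * e ≤ e
      drop true e = ≤-reflexive (+-identityʳ e)
      drop false e = z≤n

  -- The induction on i is the descent: inside a large colour class the typical colour density grows from
  -- 2^(-2AQ) to 2^(-AQ), Q = 2^i, while the rate p-level k i / 2^i stays between k and 2k.
  no-heavy : ∀ i X → Extremal (2 ^ i) (p-level k i) X → 2 ^ (5 * A * (2 ^ i * 2 ^ i)) ≤ ∣ X ∣ → ¬ Heavy (2 ^ (A * 2 ^ i)) X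
  no-heavy zero X ext big hv = <⇒≱ exceeds (2^-cancel-≤ (begin
    2 ^ (k * 1)               ≤⟨ averaging k X H Λ 2 (2 ^ (A * 1)) 1≤X (λ w → proj₁ ∘ ∧-true⁻) hv Λ⊆X Λ-sees Λ-good Λ-large
                                   (extremal-kill 1 k k X ≤-refl (≤-reflexive (*-identityʳ k)) ext) ⟩
    4 * (2 ^ (A * 1)) ^ 2     ≡⟨ cong (4 *_) (^-*-assoc 2 (A * 1) 2) ⟩
    4 * 2 ^ (A * 1 * 2)       ≡⟨ sym (^-distribˡ-+-* 2 2 (A * 1 * 2)) ⟩
    2 ^ (2 + A * 1 * 2) ∎))
    where
    open ≤-Reasoning
    b = 2 ^ (A * 1)
    H = heavy b X
    Λ : Fin n → Subset n
    Λ w with heavyAt? b X w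
    ... | yes (γ , _) = class X w γ
    -- A dummy value: the averaging looks at `Λ w` only for `w` in `H`.
    ... | no _ = X
    1≤X : 1 ≤ ∣ X ∣
    1≤X = ≤-trans (2^>0 (5 * A * 1)) big
    Λ⊆X : ∀ w → H w ≡ true → Λ w ⊆ X
    Λ⊆X w Hw x Λx with heavyAt? b X w
    ... | yes (γ , _) = proj₁ (∧-true⁻ Λx)
    ... | no _ = Λx
    Λ-sees : ∀ w → H w ≡ true → ∃[ γ ] Sees w (Λ w) γ
    Λ-sees w Hw with heavyAt? b X w | ∧-true⁻ {X w} Hw
    ... | yes (γ , γ≢ , _) | _ = γ , γ≢ , class-colour X w γ
    ... | no _ | _ , ()
    Λ-large : ∀ w → H w ≡ true → ∣ X ∣ ≤ b * ∣ Λ w ∣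
    Λ-large w Hw with heavyAt? b X w | ∧-true⁻ {X w} Hw
    ... | yes (γ , γ≢ , h) | _ = h
    ... | no _ | _ , ()
    arith : ∀ A → A * 1 + 4 * A ≡ 5 * A * 1
    arith = solve-∀
    Λ-good : ∀ w → H w ≡ true → ∣ Λ w ∣ ^ 2 ≤ 2 * 𝔼 (Λ w) 2 rainbow
    Λ-good w Hw = rainbow-pairs (Λ w) (≤-trans (2^-mono {1} (≤-trans (s≤s z≤n) (*-mono-≤ {1} {4} (s≤s z≤n) 14≤A)))
      (*-cancelˡ-≤ b {{m^n≢0 2 (A * 1)}} (begin
        b * 2 ^ (4 * A)        ≡⟨ sym (^-distribˡ-+-* 2 (A * 1) (4 * A)) ⟩
        2 ^ (A * 1 + 4 * A)    ≡⟨ cong (2 ^_) (arith A) ⟩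
        2 ^ (5 * A * 1)        ≤⟨ big ⟩
        ∣ X ∣                  ≤⟨ Λ-large w Hw ⟩
        b * ∣ Λ w ∣ ∎)))
    arith₁ : ∀ A → suc (2 + A * 1 * 2) + (18 * A + 4) ≡ 20 * A + 7
    arith₁ = solve-∀
    exceeds : 2 + A * 1 * 2 < k * 1
    exceeds = begin
      suc (2 + A * 1 * 2)   ≤⟨ m≤m+n _ (18 * A + 4) ⟩
      suc (2 + A * 1 * 2) + (18 * A + 4) ≡⟨ arith₁ A ⟩
      20 * A + 7            ≤⟨ k≥ ⟩
      k                     ≡⟨ sym (*-identityʳ k) ⟩
      k * 1 ∎
  -- The descent appears as an appeal to the induction hypothesis: the maximiser `X′` inside each
  -- large class is not heavy at level i, so its light part carries mostly rainbow tuples of length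
  -- Q² + 1.
  no-heavy (suc i) X ext big hv = ¬¬-finite-choice choose λ data′ →
    pairs-too-many A k (Q * Q) k≥ 1≤QQ
      (averaging k X H (λ w → proj₁ (data′ w)) (suc (Q * Q)) B 1≤X (λ w → proj₁ ∘ ∧-true⁻) hv
        (λ w Hw → proj₁ (proj₂ (data′ w) Hw))
        (λ w Hw → proj₁ (proj₂ (proj₂ (data′ w) Hw)))
        (λ w Hw → proj₁ (proj₂ (proj₂ (proj₂ (data′ w) Hw))))
        (λ w Hw → proj₂ (proj₂ (proj₂ (proj₂ (data′ w) Hw))))
        (extremal-kill (2 ^ suc i) (p-level k (suc i)) k X (2^>0 (suc i)) (k*2^i≤p k (suc i)) ext))
    where
    open ≤-Reasoning
    Q = 2 ^ i
    a = A * (2 * Q)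
    H = heavy (2 ^ a) X
    -- The term 10 A Q² bounds a + 4 a Q for a = 2 A Q, the loss from `X` to `X′`; the extra 1 pays
    -- for passing to the light half of `X′`.
    B = 2 ^ (10 * A * (Q * Q) + 1)
    1≤QQ : 1 ≤ Q * Q
    1≤QQ = *-mono-≤ (2^>0 i) (2^>0 i)
    1≤X : 1 ≤ ∣ X ∣
    1≤X = ≤-trans (2^>0 (5 * A * (2 * Q * (2 * Q)))) big
    -- β = 2^e, since lightness is measured at 2β and the induction hypothesis speaks of 2^(A Q).
    e = A * Q ∸ 1
    1≤AQ : 1 ≤ A * Q
    1≤AQ = *-mono-≤ (≤-trans (s≤s z≤n) 14≤A) (2^>0 i)
    2β≡ : 2 ^ (A * Q) ≡ 2 * 2 ^ e
    2β≡ = cong (2 ^_) (sym (m+[n∸m]≡n 1≤AQ))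
    D : Fin n → Set
    D w = Σ (Subset n) λ Λ → H w ≡ true →
      Λ ⊆ X × (∃[ γ ] Sees w Λ γ) × ∣ Λ ∣ ^ suc (Q * Q) ≤ 2 * 𝔼 Λ (suc (Q * Q)) rainbow × ∣ X ∣ ≤ B * ∣ Λ ∣
    choose : ∀ w → ¬ ¬ D w
    choose w none with H w in Hw
    ... | false = none (X , λ ())
    ... | true with heavy⁻ {2 ^ a} {X} {w} Hw
    ...   | γ , γ≢ , Y-large = extremal-exists Q (p-level k i) (class X w γ) use
      where
      Y = class X w γ
      Y⊆X : Y ⊆ X
      Y⊆X z = proj₁ ∘ ∧-true⁻
      use : ¬ (∃[ X′ ] (X′ ⊆ Y × Extremal Q (p-level k i) X′ × Dominates Q (p-level k i) X′ Y))
      use (X′ , X′⊆Y , ext′ , dom) = none (Λ , λ _ →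
          (λ z → Y⊆X z ∘ X′⊆Y z ∘ proj₁ ∘ ∧-true⁻) ,
          (γ , γ≢ , (λ z Λz → class-colour X w γ z (X′⊆Y z (proj₁ (∧-true⁻ Λz))))) ,
          rainbow-majority (2 ^ e) Λ light′ (suc (Q * Q)) (s≤s z≤n) (*-cancelˡ-≤ 2 2r⁴) ,
          X≤BΛ)
        where
        Λ = light (2 * 2 ^ e) X′
        L = 10 * A * (Q * Q)
        arith₁ : ∀ A Q → A * (2 * Q) + 4 * (A * (2 * Q)) * Q ≡ 2 * A * (Q * 1) + 8 * A * (Q * Q)
        arith₁ = solve-∀
        arith₂ : ∀ A Q → 2 * A * (Q * Q) + 8 * A * (Q * Q) ≡ 10 * A * (Q * Q)
        arith₂ = solve-∀
        arith₃ : ∀ A Q → 5 * A * (2 * Q * (2 * Q)) ≡ 10 * A * (Q * Q) + (5 * A * (Q * Q) + 5 * A * (Q * Q))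
        arith₃ = solve-∀
        arith₄ : ∀ r → 4 * r ≡ 2 * (2 * r)
        arith₄ = solve-∀
        loss : ∣ X ∣ ≤ 2 ^ L * ∣ X′ ∣
        loss = ≤-trans (extremal-loss a Q (p-level k i) k X Y X′ (2^>0 i) (p≤2k*2^i k i) 1≤X Y-large X′⊆Y Y⊆X ext dom)
          (*-monoˡ-≤ ∣ X′ ∣ (2^-mono (begin
            a + 4 * a * Q                          ≡⟨ arith₁ A Q ⟩
            2 * A * (Q * 1) + 8 * A * (Q * Q)      ≤⟨ +-monoˡ-≤ (8 * A * (Q * Q)) (*-monoʳ-≤ (2 * A) (*-monoʳ-≤ Q (2^>0 i))) ⟩
            2 * A * (Q * Q) + 8 * A * (Q * Q)      ≡⟨ arith₂ A Q ⟩
            L ∎)))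
        -- Of the 20 A Q² required at level i + 1, the loss consumes 10 A Q²; twice the requirement
        -- of level i remains.
        big₂ : 2 ^ (5 * A * (Q * Q) + 5 * A * (Q * Q)) ≤ ∣ X′ ∣
        big₂ = *-cancelˡ-≤ (2 ^ L) {{m^n≢0 2 L}} (begin
          2 ^ L * 2 ^ (5 * A * (Q * Q) + 5 * A * (Q * Q)) ≡⟨ sym (^-distribˡ-+-* 2 L _) ⟩
          2 ^ (L + (5 * A * (Q * Q) + 5 * A * (Q * Q)))   ≡⟨ cong (2 ^_) (sym (arith₃ A Q)) ⟩
          2 ^ (5 * A * (2 * Q * (2 * Q)))                 ≤⟨ big ⟩
          ∣ X ∣                                           ≤⟨ loss ⟩
          2 ^ L * ∣ X′ ∣ ∎)
        big₁ : 2 ^ (5 * A * (Q * Q)) ≤ ∣ X′ ∣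
        big₁ = ≤-trans (2^-mono (m≤m+n (5 * A * (Q * Q)) _)) big₂
        ¬heavy : ¬ Heavy (2 * 2 ^ e) X′
        ¬heavy h = no-heavy i X′ ext′ big₁ (subst (λ b → Heavy b X′) (sym 2β≡) h)
        2β≤ : 2 * 2 ^ e ≤ ∣ X′ ∣
        2β≤ = begin
          2 * 2 ^ e ≡⟨ sym 2β≡ ⟩
          2 ^ (A * Q) ≤⟨ 2^-mono (*-mono-≤ {A} {5 * A} (m≤n*m A 5) (m≤n*m Q Q {{m^n≢0 2 i}})) ⟩
          2 ^ (5 * A * (Q * Q)) ≤⟨ big₁ ⟩
          ∣ X′ ∣ ∎
        light′ : ∀ x → Λ x ≡ true → ∀ c → 2 ^ e * deg Λ x c ≤ ∣ Λ ∣
        light′ = light-degrees (2 ^ e) X′ ¬heavy 2β≤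
        2r⁴ : 2 * (2 * (suc (Q * Q) * suc (Q * Q) * suc (Q * Q) * suc (Q * Q))) ≤ 2 * 2 ^ e
        2r⁴ = ≤-trans (≤-reflexive (sym (arith₄ (suc (Q * Q) * suc (Q * Q) * suc (Q * Q) * suc (Q * Q))))) (≤-trans (4r⁴≤ A i 14≤A) (≤-reflexive 2β≡))
        X≤BΛ : ∣ X ∣ ≤ B * ∣ Λ ∣
        X≤BΛ = begin
          ∣ X ∣                   ≤⟨ loss ⟩
          2 ^ L * ∣ X′ ∣          ≤⟨ *-monoʳ-≤ (2 ^ L) (∣light∣-large (2 * 2 ^ e) X′ ¬heavy) ⟩
          2 ^ L * (2 * ∣ Λ ∣)     ≡⟨ sym (*-assoc (2 ^ L) 2 ∣ Λ ∣) ⟩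
          2 ^ L * 2 ^ 1 * ∣ Λ ∣   ≡⟨ cong (_* ∣ Λ ∣) (sym (^-distribˡ-+-* 2 L 1)) ⟩
          B * ∣ Λ ∣ ∎

  #colours≤ : ∀ X → #colours X ≤ M
  #colours≤ X = ≤-trans (sum-mono (λ c → 1[]≤1 (does (appears? X c)))) (≤-reflexive (trans (sum-const M 1) (*-identityʳ M)))
    where
    1[]≤1 : ∀ b → 1[ b ] ≤ 1
    1[]≤1 true = ≤-refl
    1[]≤1 false = z≤n

  ∑-classes : ∀ X w → sum (λ γ → ∣ class X w γ ∣) ≡ ∣ X ∣
  ∑-classes X w = begin
    sum (λ γ → ∣ class X w γ ∣)
      ≡⟨ sum-cong-≗ (∣class∣ X w) ⟩
    sum (λ γ → sum (λ z → 1[ X z ] * δ (colour w z) γ))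
      ≡⟨ ∑-comm (λ γ z → 1[ X z ] * δ (colour w z) γ) ⟩
    sum (λ z → sum (λ γ → 1[ X z ] * δ (colour w z) γ))
      ≡⟨ sum-cong-≗ (λ z → trans (sym (*-distribˡ-sum 1[ X z ] (δ (colour w z)))) (trans (cong (1[ X z ] *_) (sum-δ (colour w z))) (*-identityʳ _))) ⟩
    ∣ X ∣ ∎
    where open ≡-Reasoning

  -- Otherwise the classes at `w` would cover at most M |X|/b + 1 ≤ |X|/2 + 1 vertices of `X`, the 1
  -- being the class of `diag`. This is less than |X| from |X| = 3 on.
  all-heavy : ∀ b X → 2 * M ≤ b → 3 ≤ ∣ X ∣ → ∀ w → HeavyAt b X w
  all-heavy b X 2M≤b 3≤X w with heavyAt? b X w
  ... | yes h = h
  ... | no ¬h = ⊥-elim (<⇒≱ 3≤X (*-cancelˡ-≤ b {{>-nonZero 1≤b}} (+-cancelˡ-≤ (b * ∣ X ∣) _ _ (begin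
    b * ∣ X ∣ + b * ∣ X ∣         ≡⟨ arith₁ b ∣ X ∣ ⟩
    2 * (b * ∣ X ∣)               ≤⟨ *-monoʳ-≤ 2 bX≤ ⟩
    2 * (M * ∣ X ∣ + b * 1)       ≡⟨ arith₂ M ∣ X ∣ b ⟩
    2 * M * ∣ X ∣ + b * 2         ≤⟨ +-monoˡ-≤ (b * 2) (*-monoˡ-≤ ∣ X ∣ 2M≤b) ⟩
    b * ∣ X ∣ + b * 2 ∎))))
    where
    open ≤-Reasoning
    1≤b : 1 ≤ b
    1≤b = ≤-trans (≤-trans (1≤M diag) (m≤n*m M 2)) 2M≤b
      where
      1≤M : ∀ {M} → Fin M → 1 ≤ M
      1≤M {suc M} _ = s≤s z≤n
    arith₁ : ∀ b x → b * x + b * x ≡ 2 * (b * x)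
    arith₁ = solve-∀
    arith₂ : ∀ M x b → 2 * (M * x + b * 1) ≡ 2 * M * x + b * 2
    arith₂ = solve-∀
    pointwise : ∀ γ → b * ∣ class X w γ ∣ ≤ ∣ X ∣ + b * δ diag γ
    pointwise γ with diag ≟ᶠ γ | ∣ X ∣ ≤? b * ∣ class X w γ ∣
    ... | yes refl | _ = ≤-trans (*-monoʳ-≤ b (≤-trans (≤-reflexive (∣class∣ X w diag)) (deg-diag X w))) (m≤n+m (b * 1) ∣ X ∣)
    ... | no γ≢ | yes h = ⊥-elim (¬h (γ , γ≢ ∘ sym , h))
    ... | no _ | no ¬h′ = ≤-trans (<⇒≤ (≰⇒> ¬h′)) (m≤m+n ∣ X ∣ _)
    bX≤ : b * ∣ X ∣ ≤ M * ∣ X ∣ + b * 1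
    bX≤ = begin
      b * ∣ X ∣                               ≡⟨ cong (b *_) (sym (∑-classes X w)) ⟩
      b * sum (λ γ → ∣ class X w γ ∣)         ≡⟨ *-distribˡ-sum b (λ γ → ∣ class X w γ ∣) ⟩
      sum (λ γ → b * ∣ class X w γ ∣)         ≤⟨ sum-mono pointwise ⟩
      sum (λ γ → ∣ X ∣ + b * δ diag γ)        ≡⟨ ∑-distrib-+ (λ _ → ∣ X ∣) (λ γ → b * δ diag γ) ⟩
      sum {M} (λ _ → ∣ X ∣) + sum (λ γ → b * δ diag γ)
        ≡⟨ cong₂ _+_ (sum-const M ∣ X ∣) (trans (sym (*-distribˡ-sum b (δ diag))) (cong (b *_) (sum-δ diag))) ⟩
      M * ∣ X ∣ + b * 1 ∎

  -- The extremal subset of the full vertex set is smaller than n by a factor of at most 2^(2k(m+1))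
  -- ≤ 2^(4km), so the exponent 5km leaves km. All its vertices are heavy because 2^(A Q) exceeds
  -- twice the number of colours, which `no-heavy` forbids.
  too-large : ∀ m → M ≡ suc m → 1 ≤ m → ¬ (2 ^ (5 * k * m) ≤ n)
  too-large m M≡ 1≤m n≥ with level-of m 1≤m
  ... | i , lo , hi = extremal-exists Q (p-level k i) full λ { (X , X⊆ , ext , dom) →
    let big = X-big X dom
        3≤X = ≤-trans (s≤s (s≤s (s≤s z≤n))) (≤-trans (2^-mono {2} 2≤km) big)
    in no-heavy i X ext (≤-trans (2^-mono S≤km) big)
         (≤-trans (∣∣-mono (all-heavy′ X 3≤X)) (m≤n*m _ 2)) }
    where
    open ≤-Reasoning
    Q = 2 ^ i
    full : Subset n
    full _ = true
    ∣full∣ : ∣ full ∣ ≡ n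
    ∣full∣ = trans (sum-const n 1) (*-identityʳ n)
    14≤k : 14 ≤ k
    14≤k = ≤-trans 14≤A (≤-trans (m≤n*m A 20) (≤-trans (m≤m+n (20 * A) 7) k≥))
    2≤km : 2 ≤ k * m
    2≤km = *-mono-≤ {2} {k} {1} (≤-trans (s≤s (s≤s z≤n)) 14≤k) 1≤m
    S≤km : 5 * A * (Q * Q) ≤ k * m
    S≤km = *-mono-≤ (≤-trans (*-monoˡ-≤ A {5} {20} (s≤s (s≤s (s≤s (s≤s (s≤s z≤n)))))) (≤-trans (m≤m+n (20 * A) 7) k≥)) lo
    X-big : ∀ X → Dominates Q (p-level k i) X full → 2 ^ (k * m) ≤ ∣ X ∣
    X-big X dom = 2^-cancelʳ (4 * k * m) (begin
      2 ^ (k * m) * 2 ^ (4 * k * m) ≡⟨ sym (^-distribˡ-+-* 2 (k * m) (4 * k * m)) ⟩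
      2 ^ (k * m + 4 * k * m)       ≡⟨ cong (2 ^_) (arith k m) ⟩
      2 ^ (5 * k * m)               ≤⟨ n≥ ⟩
      n                             ≤⟨ ^-cancelˡ-≤ Q (2^>0 i) n^Q≤ ⟩
      ∣ X ∣ * 2 ^ (4 * k * m) ∎)
      where
      arith : ∀ k m → k * m + 4 * k * m ≡ 5 * k * m
      arith = solve-∀
      arith₁ : ∀ k q m → 2 * k * q * (m + m) ≡ 4 * k * m * q
      arith₁ = solve-∀
      n^Q≤ : n ^ Q ≤ (∣ X ∣ * 2 ^ (4 * k * m)) ^ Q
      n^Q≤ = begin
        n ^ Q                                             ≡⟨ cong (_^ Q) (sym ∣full∣) ⟩
        ∣ full ∣ ^ Q                                      ≡⟨ sym (*-identityʳ _) ⟩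
        ∣ full ∣ ^ Q * 1                                  ≤⟨ *-monoʳ-≤ (∣ full ∣ ^ Q) (2^>0 (p-level k i * #colours X)) ⟩
        ∣ full ∣ ^ Q * 2 ^ (p-level k i * #colours X)     ≤⟨ dom ⟩
        ∣ X ∣ ^ Q * 2 ^ (p-level k i * #colours full)
          ≤⟨ *-monoʳ-≤ (∣ X ∣ ^ Q) (2^-mono (*-mono-≤ (p≤2k*2^i k i) (≤-trans (#colours≤ full) (≤-trans (≤-reflexive M≡) (+-monoˡ-≤ m 1≤m))))) ⟩
        ∣ X ∣ ^ Q * 2 ^ (2 * k * Q * (m + m))             ≡⟨ cong (λ e → ∣ X ∣ ^ Q * 2 ^ e) (arith₁ k Q m) ⟩
        ∣ X ∣ ^ Q * 2 ^ (4 * k * m * Q)                   ≡⟨ cong (∣ X ∣ ^ Q *_) (sym (^-*-assoc 2 (4 * k * m) Q)) ⟩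
        ∣ X ∣ ^ Q * (2 ^ (4 * k * m)) ^ Q                 ≡⟨ sym (^-distribʳ-* Q ∣ X ∣ _) ⟩
        (∣ X ∣ * 2 ^ (4 * k * m)) ^ Q ∎
    2M≤b : 2 * M ≤ 2 ^ (A * Q)
    2M≤b = begin
      2 * M                          ≡⟨ cong (2 *_) M≡ ⟩
      2 * suc m                      ≤⟨ *-monoʳ-≤ 2 hi ⟩
      2 * (4 * (Q * Q))              ≡⟨ arith₁ Q ⟩
      8 * (Q * Q)                    ≡⟨ cong (8 *_) (sym (^-distribˡ-+-* 2 i i)) ⟩
      2 ^ 3 * 2 ^ (i + i)            ≡⟨ sym (^-distribˡ-+-* 2 3 (i + i)) ⟩
      2 ^ (3 + (i + i))              ≤⟨ 2^-mono {3 + (i + i)} {A * Q} (≤-trans (≤-trans (m≤m+n _ (11 + 12 * i)) (≤-reflexive (arith₂ i))) (*-mono-≤ 14≤A (n<2^n i))) ⟩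
      2 ^ (A * Q) ∎
      where
      arith₁ : ∀ q → 2 * (4 * (q * q)) ≡ 8 * (q * q)
      arith₁ = solve-∀
      arith₂ : ∀ i → 3 + (i + i) + (11 + 12 * i) ≡ 14 * suc i
      arith₂ = solve-∀
    all-heavy′ : ∀ X → 3 ≤ ∣ X ∣ → X ⊆ heavy (2 ^ (A * Q)) X
    all-heavy′ X 3≤X w Xw with heavyAt? (2 ^ (A * Q)) X w
    ... | yes _ = ∧-true⁺ Xw refl
    ... | no ¬h = ⊥-elim (¬h (all-heavy (2 ^ (A * Q)) X 2M≤b 3≤X w))

-- Squares in an edge colouring.

Square : ∀ {n m} → Coloring n m → Fin n → Fin n → Fin n → Fin n → Set
Square χ x y s t = (x ≢ y × s ≢ t × x ≢ s × x ≢ t × y ≢ s × y ≢ t) ×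
                   col χ x s ≡ col χ x t × col χ y s ≡ col χ y t × col χ x y ≡ col χ s t

square? : ∀ {n m} (χ : Coloring n m) x y s t → Dec (Square χ x y s t)
square? χ x y s t =
  (¬? (x ≟ᶠ y) ×-dec ¬? (s ≟ᶠ t) ×-dec ¬? (x ≟ᶠ s) ×-dec ¬? (x ≟ᶠ t) ×-dec ¬? (y ≟ᶠ s) ×-dec ¬? (y ≟ᶠ t))
  ×-dec (col χ x s ≟ᶠ col χ x t) ×-dec (col χ y s ≟ᶠ col χ y t) ×-dec (col χ x y ≟ᶠ col χ s t)

square-exists : ∀ A k → 14 ≤ A → 20 * A + 7 ≤ k → ∀ {n m} (χ : Coloring n m) → 1 ≤ m → 2 ^ (5 * k * m) ≤ n →
                ∃[ x ] ∃[ y ] ∃[ s ] ∃[ t ] Square χ x y s t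
square-exists A k 14≤A k≥ {n} {m} χ 1≤m n≥
  with any? (λ x → any? (λ y → any? (λ s → any? (λ t → square? χ x y s t))))
... | yes found = found
... | no none = ⊥-elim (NoSquare.too-large A k 14≤A k≥ colour colour-sym zero colour-refl colour-off no-square m refl 1≤m n≥)
  where
  -- A separate colour for loops turns a repeated vertex in a tuple into an ordinary colour
  -- collision; the given diagonal values of `χ` are arbitrary.
  colour : Fin n → Fin n → Fin (suc m)
  colour x y = if does (x ≟ᶠ y) then zero else suc (col χ x y)
  colour-sym : ∀ x y → colour x y ≡ colour y x
  colour-sym x y with x ≟ᶠ y | y ≟ᶠ x
  ... | yes _ | yes _ = refl
  ... | no _ | no _ = cong suc (colSym χ x y)
  ... | yes x≡y | no y≢x = ⊥-elim (y≢x (sym x≡y))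
  ... | no x≢y | yes y≡x = ⊥-elim (x≢y (sym y≡x))
  colour-refl : ∀ x → colour x x ≡ zero
  colour-refl x with x ≟ᶠ x
  ... | yes _ = refl
  ... | no x≢x = ⊥-elim (x≢x refl)
  colour-off : ∀ x y → colour x y ≡ zero → x ≡ y
  colour-off x y h with x ≟ᶠ y
  ... | yes x≡y = x≡y
  colour-≢ : ∀ {x y} → x ≢ y → colour x y ≡ suc (col χ x y)
  colour-≢ {x} {y} x≢y with x ≟ᶠ y
  ... | yes x≡y = ⊥-elim (x≢y x≡y)
  ... | no _ = refl
  col-≡ : ∀ {x y s t} → x ≢ y → s ≢ t → colour x y ≡ colour s t → col χ x y ≡ col χ s t
  col-≡ x≢y s≢t eq = suc-injective (trans (sym (colour-≢ x≢y)) (trans eq (colour-≢ s≢t)))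
  no-square : ∀ x y s t → x ≢ y → s ≢ t → x ≢ s → x ≢ t → y ≢ s → y ≢ t →
              colour x s ≡ colour x t → colour y s ≡ colour y t → colour x y ≢ colour s t
  no-square x y s t x≢y s≢t x≢s x≢t y≢s y≢t e₁ e₂ e₃ =
    none (x , y , s , t , (x≢y , s≢t , x≢s , x≢t , y≢s , y≢t) , col-≡ x≢s x≢t e₁ , col-≡ y≢s y≢t e₂ , col-≡ x≢y s≢t e₃)

-- Large subsets on which a key is constant.

enumerate : ∀ {n} (X : Subset n) N → N ≤ ∣ X ∣ →
            Σ (Fin N → Fin n) λ e → (∀ {i j} → e i ≡ e j → i ≡ j) × (∀ i → X (e i) ≡ true)
enumerate X zero _ = (λ ()) , (λ {i} → case i of λ ()) , λ ()
enumerate {suc n} X (suc N) h with X zero in X0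
... | false with enumerate (X ∘ suc) (suc N) h
...   | e , e-inj , e∈ = suc ∘ e , (λ eq → e-inj (suc-injective eq)) , e∈
enumerate {suc n} X (suc N) (s≤s h) | true with enumerate (X ∘ suc) N h
... | e , e-inj , e∈ = e′ , e′-inj , e′∈
  where
  e′ : Fin (suc N) → Fin (suc n)
  e′ zero = zero
  e′ (suc i) = suc (e i)
  e′-inj : ∀ {i j} → e′ i ≡ e′ j → i ≡ j
  e′-inj {zero} {zero} _ = refl
  e′-inj {suc i} {suc j} eq = cong suc (e-inj (suc-injective eq))
  e′∈ : ∀ i → X (e′ i) ≡ true
  e′∈ zero = X0
  e′∈ (suc i) = e∈ i

fibre : ∀ {n K} → Subset n → (Fin n → Fin K) → Fin K → Subset n
fibre X key c x = X x ∧ does (key x ≟ᶠ c)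

∑-fibres : ∀ {n K} (X : Subset n) (key : Fin n → Fin K) → sum (λ c → ∣ fibre X key c ∣) ≡ ∣ X ∣
∑-fibres X key = begin
  sum (λ c → ∣ fibre X key c ∣)
    ≡⟨ sum-cong-≗ (λ c → sum-cong-≗ (λ x → 1[∧] (X x) (does (key x ≟ᶠ c)))) ⟩
  sum (λ c → sum (λ x → 1[ X x ] * 1[ does (key x ≟ᶠ c) ]))
    ≡⟨ ∑-comm (λ c x → 1[ X x ] * 1[ does (key x ≟ᶠ c) ]) ⟩
  sum (λ x → sum (λ c → 1[ X x ] * 1[ does (key x ≟ᶠ c) ]))
    ≡⟨ sum-cong-≗ (λ x → trans (sym (*-distribˡ-sum 1[ X x ] (λ c → 1[ does (key x ≟ᶠ c) ]))) (trans (cong (1[ X x ] *_) (sum-δ (key x))) (*-identityʳ _))) ⟩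
  ∣ X ∣ ∎
  where open ≡-Reasoning

popular-fibre : ∀ {n K} (X : Subset n) (key : Fin n → Fin K) → 1 ≤ K → ∃[ c ] ∣ X ∣ ≤ K * ∣ fibre X key c ∣
popular-fibre {n} {K} X key 1≤K with any? (λ c → ∣ X ∣ ≤? K * ∣ fibre X key c ∣)
... | yes found = found
... | no none = ⊥-elim (<⇒≱ 1≤K (+-cancelˡ-≤ (K * ∣ X ∣) K 0 (begin
  K * ∣ X ∣ + K                                     ≡⟨ cong₂ _+_ (trans (cong (K *_) (sym (∑-fibres X key))) (*-distribˡ-sum K (λ c → ∣ fibre X key c ∣))) (trans (sym (*-identityʳ K)) (sym (sum-const K 1))) ⟩
  sum (λ c → K * ∣ fibre X key c ∣) + sum {K} (λ _ → 1) ≡⟨ sym (∑-distrib-+ (λ c → K * ∣ fibre X key c ∣) (λ _ → 1)) ⟩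
  sum (λ c → K * ∣ fibre X key c ∣ + 1)             ≤⟨ sum-mono (λ c → ≤-trans (≤-reflexive (+-comm _ 1)) (≰⇒> (λ h → none (c , h)))) ⟩
  sum {K} (λ _ → ∣ X ∣)                             ≡⟨ sum-const K ∣ X ∣ ⟩
  K * ∣ X ∣                                         ≡⟨ sym (+-identityʳ _) ⟩
  K * ∣ X ∣ + 0                                     ∎)))
  where open ≤-Reasoning

avoid : ∀ {n} → List (Fin n) → Subset n
avoid [] x = true
avoid (w ∷ ws) x = not (does (w ≟ᶠ x)) ∧ avoid ws x

avoid⁻ : ∀ {n} (ws : List (Fin n)) {x} → avoid ws x ≡ true → ∀ {w} → w ∈ ws → w ≢ x
avoid⁻ (w ∷ ws) {x} h w∈ refl with w∈
... | there w∈ws = avoid⁻ ws {x} (proj₂ (∧-true⁻ {not (does (w ≟ᶠ x))} h)) w∈ws refl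
... | here refl with x ≟ᶠ x | ∧-true⁻ {not (does (x ≟ᶠ x))} h
...   | no x≢x | _ = x≢x refl
...   | yes _ | () , _

∣avoid∣ : ∀ {n} (ws : List (Fin n)) → n ≤ length ws + ∣ avoid ws ∣
∣avoid∣ {n} [] = ≤-reflexive (sym (trans (sum-const n 1) (*-identityʳ n)))
∣avoid∣ {n} (w ∷ ws) = begin
  n                                   ≤⟨ ∣avoid∣ ws ⟩
  length ws + ∣ avoid ws ∣            ≤⟨ +-monoʳ-≤ (length ws) (sum-mono pointwise) ⟩
  length ws + sum (λ x → 1[ does (w ≟ᶠ x) ] + 1[ avoid (w ∷ ws) x ])
    ≡⟨ cong (length ws +_) (trans (∑-distrib-+ (λ x → 1[ does (w ≟ᶠ x) ]) (λ x → 1[ avoid (w ∷ ws) x ])) (cong (_+ ∣ avoid (w ∷ ws) ∣) (sum-δ w))) ⟩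
  length ws + (1 + ∣ avoid (w ∷ ws) ∣) ≡⟨ +-suc (length ws) _ ⟩
  suc (length ws) + ∣ avoid (w ∷ ws) ∣ ∎
  where
  open ≤-Reasoning
  pointwise : ∀ x → 1[ avoid ws x ] ≤ 1[ does (w ≟ᶠ x) ] + 1[ avoid (w ∷ ws) x ]
  pointwise x with does (w ≟ᶠ x) | avoid ws x
  ... | true | true = s≤s z≤n
  ... | true | false = z≤n
  ... | false | true = ≤-refl
  ... | false | false = z≤n

-- The form in which pigeonhole enters every embedding step: `ws` contains the vertices to stay away
-- from, `key` records the colours towards a block, and the rest of H is later embedded through `e`.
uniform-subset : ∀ {N K} (ws : List (Fin N)) (key : Fin N → Fin K) N′ → 1 ≤ K → length ws + K * N′ ≤ N →
                 Σ (Fin N′ → Fin N) λ e → (∀ {i j} → e i ≡ e j → i ≡ j) ×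
                   (∀ i {w} → w ∈ ws → w ≢ e i) × ∃[ c ] (∀ i → key (e i) ≡ c)
uniform-subset {N} {K} ws key N′ 1≤K enough with popular-fibre (avoid ws) key 1≤K
... | c , popular with enumerate (fibre (avoid ws) key c) N′ (*-cancelˡ-≤ K {{>-nonZero 1≤K}}
                       (≤-trans (+-cancelˡ-≤ (length ws) _ _ (≤-trans enough (∣avoid∣ ws))) popular))
...   | e , e-inj , e∈ = e , e-inj , (λ i → avoid⁻ ws (proj₁ (∧-true⁻ (e∈ i)))) , c , key≡
  where
  key≡ : ∀ i → key (e i) ≡ c
  key≡ i with key (e i) ≟ᶠ c | ∧-true⁻ {avoid ws (e i)} (e∈ i)
  ... | yes eq | _ = eq
  ... | no _ | _ , ()

-- Parities of sums over lists and over unordered pairs.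

xorSum : ∀ {A : Set} → (A → Bool) → List A → Bool
xorSum p [] = false
xorSum p (x ∷ xs) = p x xor xorSum p xs

-- Position in the list, not an order on the entries, selects each unordered pair once. For
-- symmetric `P` the sum is therefore invariant under permutation, which allows vertices to be split
-- off in any order.
pairSum : ∀ {A : Set} → (A → A → Bool) → List A → Bool
pairSum P [] = false
pairSum P (x ∷ xs) = xorSum (P x) xs xor pairSum P xs

crossSum : ∀ {A : Set} → (A → A → Bool) → List A → List A → Bool
crossSum P xs ys = xorSum (λ x → xorSum (P x) ys) xs

xor-swap : ∀ a b c → a xor (b xor c) ≡ b xor (a xor c)
xor-swap a b c = trans (sym (xor-assoc a b c)) (trans (cong (_xor c) (xor-comm a b)) (xor-assoc b a c))

xor-middle : ∀ a b c d → (a xor b) xor (c xor d) ≡ (a xor c) xor (b xor d)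
xor-middle a b c d = trans (xor-assoc a b (c xor d)) (trans (cong (a xor_) (xor-swap b c d)) (sym (xor-assoc a c (b xor d))))

xor-cancel : ∀ a b → a xor (a xor b) ≡ b
xor-cancel a b = trans (sym (xor-assoc a a b)) (cong (_xor b) (xor-same a))

xorSum-cong : ∀ {A : Set} {p q : A → Bool} xs → (∀ {x} → x ∈ xs → p x ≡ q x) → xorSum p xs ≡ xorSum q xs
xorSum-cong [] _ = refl
xorSum-cong (x ∷ xs) h = cong₂ _xor_ (h (here refl)) (xorSum-cong xs (h ∘ there))

xorSum-false : ∀ {A : Set} {p : A → Bool} xs → (∀ {x} → x ∈ xs → p x ≡ false) → xorSum p xs ≡ false
xorSum-false [] _ = refl
xorSum-false (x ∷ xs) h = cong₂ _xor_ (h (here refl)) (xorSum-false xs (h ∘ there))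

xorSum-++ : ∀ {A : Set} (p : A → Bool) xs ys → xorSum p (xs ++ ys) ≡ xorSum p xs xor xorSum p ys
xorSum-++ p [] ys = refl
xorSum-++ p (x ∷ xs) ys = trans (cong (p x xor_) (xorSum-++ p xs ys)) (sym (xor-assoc (p x) _ _))

xorSum-map : ∀ {A B : Set} (p : B → Bool) (f : A → B) xs → xorSum p (map f xs) ≡ xorSum (p ∘ f) xs
xorSum-map p f [] = refl
xorSum-map p f (x ∷ xs) = cong (p (f x) xor_) (xorSum-map p f xs)

xorSum-∧ : ∀ {A : Set} (p : A → Bool) b xs → xorSum (λ x → p x ∧ b) xs ≡ xorSum p xs ∧ b
xorSum-∧ p b [] = refl
xorSum-∧ p b (x ∷ xs) = trans (cong ((p x ∧ b) xor_) (xorSum-∧ p b xs)) (distr (p x) (xorSum p xs) b)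
  where
  distr : ∀ x y b → (x ∧ b) xor (y ∧ b) ≡ (x xor y) ∧ b
  distr true true true = refl
  distr true true false = refl
  distr true false true = refl
  distr true false false = refl
  distr false true true = refl
  distr false true false = refl
  distr false false _ = refl

xorSum-↭ : ∀ {A : Set} (p : A → Bool) {xs ys} → xs ↭ ys → xorSum p xs ≡ xorSum p ys
xorSum-↭ p _↭_.refl = refl
xorSum-↭ p (prep x π) = cong (p x xor_) (xorSum-↭ p π)
xorSum-↭ p (swap x y π) = trans (xor-swap (p x) (p y) _) (cong (λ s → p y xor (p x xor s)) (xorSum-↭ p π))
xorSum-↭ p (_↭_.trans π π′) = trans (xorSum-↭ p π) (xorSum-↭ p π′)

xorSum-xor : ∀ {A : Set} (p q : A → Bool) xs → xorSum (λ x → p x xor q x) xs ≡ xorSum p xs xor xorSum q xs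
xorSum-xor p q [] = refl
xorSum-xor p q (x ∷ xs) = trans (cong ((p x xor q x) xor_) (xorSum-xor p q xs)) (xor-middle (p x) (q x) _ _)

pairSum-cong : ∀ {A : Set} {P Q : A → A → Bool} xs → (∀ {x y} → x ∈ xs → y ∈ xs → P x y ≡ Q x y) →
               pairSum P xs ≡ pairSum Q xs
pairSum-cong [] _ = refl
pairSum-cong (x ∷ xs) h = cong₂ _xor_ (xorSum-cong xs (λ y∈ → h (here refl) (there y∈)))
                                      (pairSum-cong xs (λ x∈ y∈ → h (there x∈) (there y∈)))

pairSum-map : ∀ {A B : Set} (P : B → B → Bool) (f : A → B) xs → pairSum P (map f xs) ≡ pairSum (λ x y → P (f x) (f y)) xs
pairSum-map P f [] = refl
pairSum-map P f (x ∷ xs) = cong₂ _xor_ (xorSum-map (P (f x)) f xs) (pairSum-map P f xs)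

pairSum-++ : ∀ {A : Set} (P : A → A → Bool) xs ys →
             pairSum P (xs ++ ys) ≡ (pairSum P xs xor crossSum P xs ys) xor pairSum P ys
pairSum-++ P [] ys = refl
pairSum-++ P (x ∷ xs) ys = begin
  xorSum (P x) (xs ++ ys) xor pairSum P (xs ++ ys)
    ≡⟨ cong₂ _xor_ (xorSum-++ (P x) xs ys) (pairSum-++ P xs ys) ⟩
  (a xor b) xor ((c xor d) xor e)   ≡⟨ sym (xor-assoc (a xor b) (c xor d) e) ⟩
  ((a xor b) xor (c xor d)) xor e   ≡⟨ cong (_xor e) (xor-middle a b c d) ⟩
  ((a xor c) xor (b xor d)) xor e   ∎
  where
  open ≡-Reasoning
  a = xorSum (P x) xs
  b = xorSum (P x) ys
  c = pairSum P xs
  d = crossSum P xs ys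
  e = pairSum P ys

pairSum-↭ : ∀ {A : Set} (P : A → A → Bool) → (∀ x y → P x y ≡ P y x) → ∀ {xs ys} → xs ↭ ys → pairSum P xs ≡ pairSum P ys
pairSum-↭ P P-sym _↭_.refl = refl
pairSum-↭ P P-sym (prep x π) = cong₂ _xor_ (xorSum-↭ (P x) π) (pairSum-↭ P P-sym π)
pairSum-↭ P P-sym (swap {xs} {ys} x y π)
  rewrite P-sym x y | xorSum-↭ (P x) π | xorSum-↭ (P y) π | pairSum-↭ P P-sym π =
  xor-middle (P y x) (xorSum (P x) ys) (xorSum (P y) ys) (pairSum P ys)
pairSum-↭ P P-sym (_↭_.trans π π′) = trans (pairSum-↭ P P-sym π) (pairSum-↭ P P-sym π′)

unique-resp : ∀ {A : Set} {xs ys : List A} → xs ↭ ys → Unique xs → Unique ys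
unique-resp {A} π = Unique-resp-↭ (setoid A) (↭⇒↭ₛ π)

extract : ∀ {A : Set} {x : A} {xs} → x ∈ xs → ∃[ ys ] xs ↭ x ∷ ys
extract {x = x} x∈xs with ∈-∃++ x∈xs
... | ys , zs , refl = ys ++ zs , shift x ys zs

map-unique-injective : ∀ {A B : Set} (f : A → B) {xs} → Unique (map f xs) → ∀ {x y} → x ∈ xs → y ∈ xs → f x ≡ f y → x ≡ y
map-unique-injective f (_ ∷ _) (here refl) (here refl) _ = refl
map-unique-injective f (x∉ ∷ _) (here refl) (there y∈) eq = ⊥-elim (All-lookup x∉ (∈-map⁺ f y∈) eq)
map-unique-injective f (x∉ ∷ _) (there x∈) (here refl) eq = ⊥-elim (All-lookup x∉ (∈-map⁺ f x∈) (sym eq))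
map-unique-injective f (_ ∷ u) (there x∈) (there y∈) eq = map-unique-injective f u x∈ y∈ eq

odd : ℕ → Bool
odd zero = false
odd (suc n) = not (odd n)

odd-+ : ∀ a b → odd (a + b) ≡ odd a xor odd b
odd-+ zero b = refl
odd-+ (suc a) b rewrite odd-+ a b with odd a | odd b
... | true | true = refl
... | true | false = refl
... | false | true = refl
... | false | false = refl

even⇒odd≡false : ∀ {n} → 2 ∣ n → odd n ≡ false
even⇒odd≡false (divides zero refl) = refl
even⇒odd≡false (divides (suc q) refl) rewrite even⇒odd≡false (divides q refl) = refl

odd≡false⇒even : ∀ n → odd n ≡ false → 2 ∣ n
odd≡false⇒even zero _ = divides 0 refl
odd≡false⇒even (suc (suc n)) h with odd≡false⇒even n (double-not h)
  where
  double-not : ∀ {b} → not (not b) ≡ false → b ≡ false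
  double-not {false} _ = refl
... | divides q refl = divides (suc q) refl

-- The list `allFin n` is increasing, so the test on `toℕ` keeps from the double sum exactly the
-- pairs whose first entry comes earlier in the list.
odd-countPairs : ∀ {n} (P : Fin n → Fin n → Bool) → odd (countPairs P) ≡ pairSum P (allFin n)
odd-countPairs {n} P = trans (odd-sum (λ i → _) (allFin n)) (trans
  (xorSum-cong (allFin n) (λ {i} _ → trans (odd-sum (λ j → if (toℕ i <ᵇ toℕ j) ∧ P i j then 1 else 0) (allFin n))
                                           (xorSum-cong (allFin n) (λ {j} _ → odd-if ((toℕ i <ᵇ toℕ j) ∧ P i j)))))
  (ordered (allFin n) (AllPairsₚ.tabulate⁺-< id)))
  where
  odd-sum : ∀ {A : Set} (g : A → ℕ) xs → odd (sumᴸ (map g xs)) ≡ xorSum (odd ∘ g) xs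
  odd-sum g [] = refl
  odd-sum g (x ∷ xs) = trans (odd-+ (g x) _) (cong (odd (g x) xor_) (odd-sum g xs))
  odd-if : ∀ b → odd (if b then 1 else 0) ≡ b
  odd-if true = refl
  odd-if false = refl
  below : Fin n → Fin n → Bool
  below i j = (toℕ i <ᵇ toℕ j) ∧ P i j
  ≮⇒false : ∀ a b → ¬ a < b → (a <ᵇ b) ≡ false
  ≮⇒false a b a≮b with a <ᵇ b in eq
  ... | false = refl
  ... | true = ⊥-elim (a≮b (<ᵇ⇒< a b (subst T (sym eq) _)))
  <⇒true : ∀ a b → a < b → (a <ᵇ b) ≡ true
  <⇒true a b a<b with a <ᵇ b in eq
  ... | true = refl
  ... | false = ⊥-elim (subst T eq (<⇒<ᵇ a<b))
  ordered : ∀ xs → AllPairs _<ᶠ_ xs → xorSum (λ i → xorSum (below i) xs) xs ≡ pairSum P xs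
  ordered [] _ = refl
  ordered (x ∷ xs) (x< ∷ <s) = cong₂ _xor_
    (cong₂ _xor_ (cong (_∧ P x x) (≮⇒false (toℕ x) (toℕ x) (<-irrefl refl)))
                 (xorSum-cong xs (λ {y} y∈ → cong (_∧ P x y) (<⇒true (toℕ x) (toℕ y) (All-lookup x< y∈)))))
    (trans (xorSum-xor (λ y → below y x) (λ y → xorSum (below y) xs) xs)
           (cong₂ _xor_ (xorSum-false xs (λ {y} y∈ → cong (_∧ P y x) (≮⇒false (toℕ y) (toℕ x) (<-asym (All-lookup x< y∈)))))
                        (ordered xs <s)))

-- Even-chromatic embedding of a graph, block by block.

pull : ∀ {n n′ m} → Coloring n m → (Fin n′ → Fin n) → Coloring n′ m
col (pull χ e) i j = col χ (e i) (e j)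
colSym (pull χ e) i j = colSym χ (e i) (e j)

three-pairs : ∀ {a b c d e f} → a ≡ f → b ≡ c → d ≡ e →
              (a xor (b xor (c xor false))) xor ((d xor (e xor false)) xor ((f xor false) xor (false xor false))) ≡ false
three-pairs {a} {b} {_} {d} refl refl refl with a | b | d
... | true | true | true = refl
... | true | true | false = refl
... | true | false | true = refl
... | true | false | false = refl
... | false | true | true = refl
... | false | true | false = refl
... | false | false | true = refl
... | false | false | false = refl

four-false : ∀ {a b c d} → a ≡ false → b ≡ false → c ≡ false → d ≡ false → a xor (b xor (c xor (d xor false))) ≡ false
four-false refl refl refl refl = refl

CommonNeighbourhood : ∀ {N m} → Coloring N m → ℕ → Set
CommonNeighbourhood {N} χ N′ =
  ∃[ x ] ∃[ y ] (x ≢ y × Σ (Fin N′ → Fin N) λ e → (∀ {i j} → e i ≡ e j → i ≡ j) ×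
    (∀ i {w} → w ∈ x ∷ y ∷ [] → w ≢ e i) × ∃[ γ ] (∀ i → col χ x (e i) ≡ γ × col χ y (e i) ≡ γ))

-- Two of any m + 1 vertices have the same colour towards x; make the popular triple (i, j, colour) the key.
common-neighbourhood : ∀ {N m} (χ : Coloring N m) → 1 ≤ m → ∀ N′ → suc m ≤ N → 1 ≤ N′ →
  suc m + suc m * suc m * m * N′ ≤ N → CommonNeighbourhood χ N′
common-neighbourhood {N} {m} χ 1≤m N′ sm≤N 1≤N′ enough =
  build (λ x → pigeonhole (n<1+n m) (λ i → col χ (z i) x))
  where
  z : Fin (suc m) → Fin N
  z i = inject≤ i sm≤N
  ws : List (Fin N)
  ws = map z (allFin (suc m))
  ∣ws∣ : length ws ≡ suc m
  ∣ws∣ = trans (length-map z (allFin (suc m))) (length-tabulate {n = suc m} id)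
  build : (∀ x → ∃[ i ] ∃[ j ] (i <ᶠ j × col χ (z i) x ≡ col χ (z j) x)) → CommonNeighbourhood χ N′
  build clash = found (uniform-subset ws key N′ (*-mono-≤ {1} {suc m * suc m} (s≤s z≤n) 1≤m)
                        (subst (λ l → l + suc m * suc m * m * N′ ≤ N) (sym ∣ws∣) enough))
    where
    I J : Fin N → Fin (suc m)
    I x = proj₁ (clash x)
    J x = proj₁ (proj₂ (clash x))
    key : Fin N → Fin (suc m * suc m * m)
    key x = combine (combine (I x) (J x)) (col χ (z (I x)) x)
    found : (Σ (Fin N′ → Fin N) λ e → (∀ {i j} → e i ≡ e j → i ≡ j) × (∀ i {w} → w ∈ ws → w ≢ e i) × ∃[ c ] (∀ i → key (e i) ≡ c)) → CommonNeighbourhood χ N′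
    found (e , e-inj , avoids , c , uniform) =
      z i , z j , zi≢zj , e , (λ {x} {y} → e-inj {x} {y}) , avoids′ , γ , λ x → z-i x , z-j x
      where
      x₀ = e (inject≤ {1} zero 1≤N′)
      i = I x₀
      j = J x₀
      γ = col χ (z i) x₀
      parts : ∀ x → I (e x) ≡ i × J (e x) ≡ j × col χ (z (I (e x))) (e x) ≡ γ
      parts x with combine-injective (combine (I (e x)) (J (e x))) (col χ (z (I (e x))) (e x)) (combine i j) γ
                     (trans (uniform x) (sym (uniform (inject≤ {1} zero 1≤N′))))
      ... | eq , eqγ with combine-injective (I (e x)) (J (e x)) i j eq
      ...   | eqi , eqj = eqi , eqj , eqγ
      z-i : ∀ x → col χ (z i) (e x) ≡ γ
      z-i x = trans (cong (λ i → col χ (z i) (e x)) (sym (proj₁ (parts x)))) (proj₂ (proj₂ (parts x)))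
      z-j : ∀ x → col χ (z j) (e x) ≡ γ
      z-j x = trans (cong (λ i → col χ (z i) (e x)) (sym (proj₁ (proj₂ (parts x)))))
                    (trans (sym (proj₂ (proj₂ (proj₂ (clash (e x)))))) (proj₂ (proj₂ (parts x))))
      zi≢zj : z i ≢ z j
      zi≢zj eq = <ᶠ⇒≢ (proj₁ (proj₂ (proj₂ (clash x₀)))) (inject≤-injective sm≤N sm≤N i j eq)
      avoids′ : ∀ x {w} → w ∈ z i ∷ z j ∷ [] → w ≢ e x
      avoids′ x (here refl) = avoids x (∈-map⁺ z (∈-allFin i))
      avoids′ x (there (here refl)) = avoids x (∈-map⁺ z (∈-allFin j))

UniformFour : ∀ {N m} → Coloring N m → ℕ → (x y p q : Fin N) → Set
UniformFour {N} χ N′ x y p q =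
  Σ (Fin N′ → Fin N) λ e → (∀ {i j} → e i ≡ e j → i ≡ j) × (∀ i {w} → w ∈ x ∷ y ∷ p ∷ q ∷ [] → w ≢ e i) ×
    ∃[ cx ] ∃[ cy ] ∃[ cp ] ∃[ cq ] (∀ i → (col χ x (e i) ≡ cx × col χ y (e i) ≡ cy) × col χ p (e i) ≡ cp × col χ q (e i) ≡ cq)

uniform-four : ∀ {N m} (χ : Coloring N m) N′ → 1 ≤ m * m * m * m → 1 ≤ N′ → 4 + m * m * m * m * N′ ≤ N → ∀ x y p q →
  UniformFour χ N′ x y p q
uniform-four {N} {m} χ N′ 1≤m⁴ 1≤N′ enough x y p q = found (uniform-subset (x ∷ y ∷ p ∷ q ∷ []) key N′ 1≤m⁴ enough)
  where
  key : Fin N → Fin (m * m * m * m)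
  key w = combine (combine (combine (col χ x w) (col χ y w)) (col χ p w)) (col χ q w)
  key-injective : ∀ w w′ → key w ≡ key w′ →
    (col χ x w ≡ col χ x w′ × col χ y w ≡ col χ y w′) × col χ p w ≡ col χ p w′ × col χ q w ≡ col χ q w′
  key-injective w w′ eq with combine-injective (combine (combine (col χ x w) (col χ y w)) (col χ p w)) (col χ q w)
                               (combine (combine (col χ x w′) (col χ y w′)) (col χ p w′)) (col χ q w′) eq
  ... | eq₃ , eqq with combine-injective (combine (col χ x w) (col χ y w)) (col χ p w) (combine (col χ x w′) (col χ y w′)) (col χ p w′) eq₃
  ...   | eq₂ , eqp = combine-injective (col χ x w) (col χ y w) (col χ x w′) (col χ y w′) eq₂ , eqp , eqq
  found : (Σ (Fin N′ → Fin N) λ e → (∀ {i j} → e i ≡ e j → i ≡ j) × (∀ i {w} → w ∈ x ∷ y ∷ p ∷ q ∷ [] → w ≢ e i) × ∃[ c ] (∀ i → key (e i) ≡ c)) →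
          UniformFour χ N′ x y p q
  found (e , e-inj , avoids , c , uniform) =
    e , (λ {i} {j} → e-inj {i} {j}) , avoids , _ , _ , _ , _ ,
    λ i → key-injective (e i) (e (inject≤ {1} zero 1≤N′)) (trans (uniform i) (sym (uniform (inject≤ {1} zero 1≤N′))))

fits : ∀ {E t l k N} → l ≤ E → k ≤ E → 1 ≤ t → E * t + E * t ≤ N → l + k * t ≤ N
fits {E} {t} l≤E k≤E 1≤t h =
  ≤-trans (+-mono-≤ (≤-trans l≤E (≤-trans (≤-reflexive (sym (*-identityʳ E))) (*-monoʳ-≤ E 1≤t))) (*-monoˡ-≤ t k≤E)) h

double-eight : ∀ q p d → 8 * q * (p * d) + 8 * q * (p * d) ≡ p * (16 * q * d)
double-eight = solve-∀

module Embedding {h : ℕ} (H : SimpleGraph h) where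

  Coloured : ∀ {N m} → Coloring N m → Fin m → Fin h × Fin N → Fin h × Fin N → Bool
  Coloured χ γ (u , x) (v , y) = adj H u v ∧ does (col χ x y ≟ᶠ γ)

  -- Partial embeddings are kept as association lists.
  EvenPlacement : ∀ {N m} → Coloring N m → List (Fin h) → Set
  EvenPlacement {N} χ vs = Σ (List (Fin h × Fin N)) λ zs →
    map proj₁ zs ↭ vs × Unique (map proj₂ zs) × (∀ γ → pairSum (Coloured χ γ) zs ≡ false)

  transport : ∀ {N′ N : ℕ} → (Fin N′ → Fin N) → Fin h × Fin N′ → Fin h × Fin N
  transport e (u , i) = u , e i

  cross : ∀ {N m N′} → Coloring N m → Fin m → (Fin N′ → Fin N) → List (Fin h × Fin N) → List (Fin h × Fin N′) → Bool
  cross χ γ e B zs = xorSum (λ b → xorSum (λ z → Coloured χ γ b (transport e z)) zs) B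

  -- Pairs lie inside the block `B`, inside the rest, or across. The rest is even by recursion in
  -- the pulled-back colouring, so only the block and its cross edges remain to be checked.
  extend-placement : ∀ {N N′ m} (χ : Coloring N m) (e : Fin N′ → Fin N) → (∀ {i j} → e i ≡ e j → i ≡ j) →
    (B : List (Fin h × Fin N)) → Unique (map proj₂ B) → (∀ i {w} → w ∈ map proj₂ B → w ≢ e i) →
    ∀ {vs} (place : EvenPlacement (pull χ e) vs) →
    (∀ γ → pairSum (Coloured χ γ) B xor cross χ γ e B (proj₁ place) ≡ false) →
    EvenPlacement χ (map proj₁ B ++ vs)
  extend-placement χ e e-inj B uB avoids {vs} (zs , zs↭ , uzs , even) evenB =
    B ++ map (transport e) zs , vertices , unique , parity
    where
    vertices : map proj₁ (B ++ map (transport e) zs) ↭ map proj₁ B ++ vs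
    vertices = subst (_↭ map proj₁ B ++ vs)
      (sym (trans (map-++ proj₁ B _) (cong (map proj₁ B ++_) (sym (map-∘ zs))))) (++⁺ˡ (map proj₁ B) zs↭)
    images : map proj₂ (B ++ map (transport e) zs) ≡ map proj₂ B ++ map e (map proj₂ zs)
    images = trans (map-++ proj₂ B _) (cong (map proj₂ B ++_) (trans (sym (map-∘ zs)) (map-∘ zs)))
    unique : Unique (map proj₂ (B ++ map (transport e) zs))
    unique = subst Unique (sym images) (Uniqueₚ.++⁺ uB (Uniqueₚ.map⁺ e-inj uzs) λ { (w∈B , w∈e) →
      case ∈-map⁻ e w∈e of λ { (i , _ , refl) → avoids i w∈B refl } })
    parity : ∀ γ → pairSum (Coloured χ γ) (B ++ map (transport e) zs) ≡ false
    parity γ = begin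
      pairSum (Coloured χ γ) (B ++ map (transport e) zs)
        ≡⟨ pairSum-++ (Coloured χ γ) B (map (transport e) zs) ⟩
      (pairSum (Coloured χ γ) B xor crossSum (Coloured χ γ) B (map (transport e) zs)) xor pairSum (Coloured χ γ) (map (transport e) zs)
        ≡⟨ cong₂ (λ p q → (pairSum (Coloured χ γ) B xor p) xor q)
             (xorSum-cong B (λ {b} _ → xorSum-map (Coloured χ γ b) (transport e) zs))
             (pairSum-map (Coloured χ γ) (transport e) zs) ⟩
      (pairSum (Coloured χ γ) B xor cross χ γ e B zs) xor pairSum (Coloured (pull χ e) γ) zs
        ≡⟨ cong₂ _xor_ (evenB γ) (even γ) ⟩
      false ∎
      where open ≡-Reasoning

  -- All edges from `u` to the rest receive the one colour `c`; so their contribution to a colour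
  -- class is the parity of the degree of `u` into `vs`, wherever the rest is placed.
  star-uniform : ∀ {N N′ m} (χ : Coloring N m) (e : Fin N′ → Fin N) u x {vs} (place : EvenPlacement (pull χ e) vs) c →
    (∀ i → col χ x (e i) ≡ c) → ∀ γ →
    xorSum (λ z → Coloured χ γ (u , x) (transport e z)) (proj₁ place) ≡ xorSum (adj H u) vs ∧ does (c ≟ᶠ γ)
  star-uniform χ e u x {vs} (zs , zs↭ , _) c uniform γ = begin
    xorSum (λ z → adj H u (proj₁ z) ∧ does (col χ x (e (proj₂ z)) ≟ᶠ γ)) zs
      ≡⟨ xorSum-cong zs (λ {z} _ → cong (λ d → adj H u (proj₁ z) ∧ does (d ≟ᶠ γ)) (uniform (proj₂ z))) ⟩
    xorSum (λ z → adj H u (proj₁ z) ∧ does (c ≟ᶠ γ)) zs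
      ≡⟨ xorSum-∧ (adj H u ∘ proj₁) (does (c ≟ᶠ γ)) zs ⟩
    xorSum (adj H u ∘ proj₁) zs ∧ does (c ≟ᶠ γ)
      ≡⟨ cong (_∧ does (c ≟ᶠ γ)) (trans (sym (xorSum-map (adj H u) proj₁ zs)) (xorSum-↭ (adj H u) zs↭)) ⟩
    xorSum (adj H u) vs ∧ does (c ≟ᶠ γ) ∎
    where open ≡-Reasoning

  module _ {m : ℕ} (1≤m : 1 ≤ m) (K : ℕ)
           (square : ∀ {N} (χ : Coloring N m) → 2 ^ (K * m) ≤ N → ∃[ x ] ∃[ y ] ∃[ s ] ∃[ t ] Square χ x y s t) where

    m⁴ : ℕ
    m⁴ = m * m * m * m

    1≤m⁴ : 1 ≤ m⁴
    1≤m⁴ = *-mono-≤ (*-mono-≤ (*-mono-≤ 1≤m 1≤m) 1≤m) 1≤m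

    m≤m⁴ : m ≤ m⁴
    m≤m⁴ = ≤-trans (≤-reflexive (sym (*-identityˡ m))) (*-monoˡ-≤ m (*-mono-≤ (*-mono-≤ 1≤m 1≤m) 1≤m))

    abstract
      -- Each block costs a factor 16 m⁴, one half of it for the vertices set aside and the other
      -- for the pigeonhole. The factor 2^(K m) is never spent, so a square is available at every
      -- stage.
      threshold : ℕ → ℕ
      threshold s = 2 ^ (K * m) * (16 * m⁴) ^ s

      threshold-≡ : ∀ s → threshold s ≡ 2 ^ (K * m) * (16 * m⁴) ^ s
      threshold-≡ s = refl

      1≤D : 1 ≤ 16 * m⁴
      1≤D = *-mono-≤ {1} {16} (s≤s z≤n) 1≤m⁴

      2^≤threshold : ∀ s → 2 ^ (K * m) ≤ threshold s
      2^≤threshold s = ≤-trans (≤-reflexive (sym (*-identityʳ _))) (*-monoʳ-≤ (2 ^ (K * m)) (m^n>0 (16 * m⁴) {{>-nonZero 1≤D}} s))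

      1≤threshold : ∀ s → 1 ≤ threshold s
      1≤threshold s = ≤-trans (2^>0 (K * m)) (2^≤threshold s)

      room : ∀ s {N} l k → l ≤ 8 * m⁴ → k ≤ 8 * m⁴ → threshold (suc s) ≤ N → l + k * threshold s ≤ N
      room s l k l≤ k≤ N≥ = fits l≤ k≤ (1≤threshold s) (≤-trans (≤-reflexive (double-eight m⁴ (2 ^ (K * m)) ((16 * m⁴) ^ s))) N≥)

    Goal : ℕ → List (Fin h) → Set
    Goal s vs = pairSum (adj H) vs ≡ false → ∀ {N} (χ : Coloring N m) → threshold s ≤ N → EvenPlacement χ vs

    first : ∀ s {N} → threshold s ≤ N → Fin N
    first s N≥ = inject≤ {1} zero (≤-trans (1≤threshold s) N≥)

    peel-even : ∀ s v vs → xorSum (adj H v) vs ≡ false → Goal s vs → Goal (suc s) (v ∷ vs)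
    peel-even s v vs deg-even rec even {N} χ N≥ =
      let w = first (suc s) N≥
          (e , e-inj , avoids , c , uniform) = uniform-subset (w ∷ []) (col χ w) (threshold s) 1≤m
            (room s 1 m (≤-trans 1≤m⁴ (m≤n*m _ 8)) (≤-trans m≤m⁴ (m≤n*m _ 8)) N≥)
          place = rec (trans (cong (_xor pairSum (adj H) vs) (sym deg-even)) even) (pull χ e) ≤-refl
      in extend-placement χ e e-inj ((v , w) ∷ []) ([] ∷ []) avoids place
           (λ γ → trans (xor-identityʳ _) (trans (star-uniform χ e v w place c uniform γ) (cong (_∧ does (c ≟ᶠ γ)) deg-even)))

    -- Both stars into the rest have the same single colour and odd size, so together they are even,
    -- and no edge joins `u` to `v`. For the same reason the edge count of the rest stays even.
    peel-nonadjacent : ∀ s u v vs → adj H u v ≡ false → xorSum (adj H u) vs ≡ true → xorSum (adj H v) vs ≡ true →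
                       Goal s vs → Goal (suc s) (u ∷ v ∷ vs)
    peel-nonadjacent s u v vs u≁v u-odd v-odd rec even {N} χ N≥ =
      let (x , y , x≢y , e , e-inj , avoids , c , uniform) =
            common-neighbourhood χ 1≤m (threshold s) sm≤N (1≤threshold s) (room s (suc m) (suc m * suc m * m) sm≤ K≤ N≥)
          place = rec (rest-even u≁v u-odd v-odd even) (pull χ e) ≤-refl
      in extend-placement χ e e-inj ((u , x) ∷ (v , y) ∷ []) ((x≢y ∷ []) ∷ [] ∷ []) avoids place
           (λ γ → two-odd (cong (_∧ does (col χ x y ≟ᶠ γ)) u≁v)
                    (star-uniform χ e u x place c (proj₁ ∘ uniform) γ) (star-uniform χ e v y place c (proj₂ ∘ uniform) γ) u-odd v-odd)
      where
      open ≤-Reasoning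
      2m≤ : suc m ≤ 2 * m
      2m≤ = ≤-trans (+-monoˡ-≤ m 1≤m) (≤-reflexive (cong (m +_) (sym (+-identityʳ m))))
      sm≤ : suc m ≤ 8 * m⁴
      sm≤ = begin
        suc m                    ≤⟨ 2m≤ ⟩
        2 * m                    ≤⟨ *-mono-≤ {2} {8} (s≤s (s≤s z≤n)) m≤m⁴ ⟩
        8 * m⁴ ∎
      K≤ : suc m * suc m * m ≤ 8 * m⁴
      K≤ = begin
        suc m * suc m * m        ≤⟨ *-monoˡ-≤ m (*-mono-≤ 2m≤ 2m≤) ⟩
        2 * m * (2 * m) * m      ≡⟨ arith m ⟩
        4 * (m * m * m * 1)      ≤⟨ *-mono-≤ {4} {8} (s≤s (s≤s (s≤s (s≤s z≤n)))) (*-monoʳ-≤ (m * m * m) 1≤m) ⟩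
        8 * m⁴ ∎
        where
        arith : ∀ m → 2 * m * (2 * m) * m ≡ 4 * (m * m * m * 1)
        arith = solve-∀
      sm≤N : suc m ≤ N
      sm≤N = ≤-trans (m≤m+n (suc m) 0) (room s (suc m) 0 sm≤ z≤n N≥)
      rest-even : ∀ {uv du dv rest} → uv ≡ false → du ≡ true → dv ≡ true → (uv xor du) xor (dv xor rest) ≡ false → rest ≡ false
      rest-even {rest = false} refl refl refl _ = refl
      rest-even {rest = true} refl refl refl ()
      two-odd : ∀ {uv su sv du dv c} → uv ≡ false → su ≡ du ∧ c → sv ≡ dv ∧ c → du ≡ true → dv ≡ true →
                ((uv xor false) xor (false xor false)) xor (su xor (sv xor false)) ≡ false
      two-odd {c = true} refl refl refl refl refl = refl
      two-odd {c = false} refl refl refl refl refl = refl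

    -- Odd degree in a complete graph means even degree into `vs`, since three neighbours lie in the
    -- block. The square pairs up the six inner edges: `a b` with `c d`, `a c` with `a d`, `b c`
    -- with `b d`.
    peel-K₄ : ∀ s a b c d vs → adj H a b ≡ true → adj H a c ≡ true → adj H a d ≡ true →
              adj H b c ≡ true → adj H b d ≡ true → adj H c d ≡ true →
              xorSum (adj H a) vs ≡ false → xorSum (adj H b) vs ≡ false → xorSum (adj H c) vs ≡ false → xorSum (adj H d) vs ≡ false →
              Goal s vs → Goal (suc s) (a ∷ b ∷ c ∷ d ∷ vs)
    peel-K₄ s a b c d vs ab ac ad bc bd cd a-even b-even c-even d-even rec even {N} χ N≥ =
      let (x , y , p , q , (x≢y , p≢q , x≢p , x≢q , y≢p , y≢q) , xp≡xq , yp≡yq , xy≡pq) = square χ (≤-trans (2^≤threshold (suc s)) N≥)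
          (e , e-inj , avoids , cx , cy , cp , cq , uniform) = uniform-four χ (threshold s) 1≤m⁴ (1≤threshold s)
            (room s 4 m⁴ (*-mono-≤ {4} {8} (s≤s (s≤s (s≤s (s≤s z≤n)))) 1≤m⁴) (m≤n*m _ 8) N≥) x y p q
          place = rec (rest-even even) (pull χ e) ≤-refl
      in extend-placement χ e e-inj ((a , x) ∷ (b , y) ∷ (c , p) ∷ (d , q) ∷ [])
           ((x≢y ∷ x≢p ∷ x≢q ∷ []) ∷ (y≢p ∷ y≢q ∷ []) ∷ (p≢q ∷ []) ∷ [] ∷ []) avoids place
           (λ γ → cong₂ _xor_
             (three-pairs (trans (edge γ ab) (trans (cong (λ c → does (c ≟ᶠ γ)) xy≡pq) (sym (edge γ cd))))
                          (trans (edge γ ac) (trans (cong (λ c → does (c ≟ᶠ γ)) xp≡xq) (sym (edge γ ad))))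
                          (trans (edge γ bc) (trans (cong (λ c → does (c ≟ᶠ γ)) yp≡yq) (sym (edge γ bd)))))
             (four-false (trans (star-uniform χ e a x place cx (proj₁ ∘ proj₁ ∘ uniform) γ) (cong (_∧ does (cx ≟ᶠ γ)) a-even))
                         (trans (star-uniform χ e b y place cy (proj₂ ∘ proj₁ ∘ uniform) γ) (cong (_∧ does (cy ≟ᶠ γ)) b-even))
                         (trans (star-uniform χ e c p place cp (proj₁ ∘ proj₂ ∘ uniform) γ) (cong (_∧ does (cp ≟ᶠ γ)) c-even))
                         (trans (star-uniform χ e d q place cq (proj₂ ∘ proj₂ ∘ uniform) γ) (cong (_∧ does (cq ≟ᶠ γ)) d-even))))
      where
      rest-even : pairSum (adj H) (a ∷ b ∷ c ∷ d ∷ vs) ≡ false → pairSum (adj H) vs ≡ false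
      rest-even rewrite ab | ac | ad | bc | bd | cd | a-even | b-even | c-even | d-even = trans (sym (not-involutive (pairSum (adj H) vs)))
      edge : ∀ γ {u v w w′} → adj H u v ≡ true → Coloured χ γ (u , w) (v , w′) ≡ does (col χ w w′ ≟ᶠ γ)
      edge γ {w = w} {w′} uv = cong (_∧ does (col χ w w′ ≟ᶠ γ)) uv

    reorder : ∀ s {vs ws} → vs ↭ ws → Goal s ws → Goal s vs
    reorder s π goal even χ N≥ with goal (trans (sym (pairSum-↭ (adj H) (SimpleGraph.sym H) π)) even) χ N≥
    ... | zs , zs↭ , rest = zs , ↭-trans zs↭ (↭-sym π) , rest

    private
      true-unless : ∀ {b} → b ≢ false → b ≡ true
      true-unless {true} _ = refl
      true-unless {false} h = ⊥-elim (h refl)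

    -- The fuel `s` drops by one per block, of whatever size; the number of vertices bounds the
    -- number of blocks.
    place-all : ∀ s vs → length vs ≤ s → Unique vs → Goal s vs
    place-all s [] _ _ _ χ _ = [] , ↭-refl , [] , λ _ → refl
    place-all (suc s) vs ∣vs∣≤ u with Any.any? (λ v → xorSum (adj H v) vs ≟ᵇ false) vs
    ... | yes even-vertex with find even-vertex
    ...   | v , v∈ , v-even with extract v∈
    ...     | vs′ , π = reorder (suc s) π (peel-even s v vs′
                (trans (cong (_xor xorSum (adj H v) vs′) (sym (irrefl H v))) (trans (sym (xorSum-↭ (adj H v) π)) v-even))
                (place-all s vs′ (≤-pred (subst (_≤ suc s) (↭-length π) ∣vs∣≤)) (tail-unique (unique-resp π u))))
      where
      tail-unique : ∀ {x : Fin h} {xs} → Unique (x ∷ xs) → Unique xs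
      tail-unique (_ ∷ u) = u
    place-all (suc s) vs ∣vs∣≤ u | no ¬even
      with Any.any? (λ v → Any.any? (λ w → ¬? (v ≟ᶠ w) ×-dec (adj H v w ≟ᵇ false)) vs) vs
    ... | yes nonadjacent with find nonadjacent
    ...   | v , v∈ , rest with find rest
    ...     | w , w∈ , v≢w , v≁w with extract v∈
    ...       | vs₁ , π₁ with ∈-resp-↭ π₁ w∈
    ...         | here w≡v = ⊥-elim (v≢w (sym w≡v))
    ...         | there w∈₁ with extract w∈₁
    ...           | vs₂ , π₂ = reorder (suc s) π (peel-nonadjacent s v w vs₂ v≁w v-odd w-odd
                      (place-all s vs₂ (≤-trans (n≤1+n _) (≤-pred (subst (_≤ suc s) (↭-length π) ∣vs∣≤))) (tail₂ (unique-resp π u))))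
      where
      π : vs ↭ v ∷ w ∷ vs₂
      π = ↭-trans π₁ (prep v π₂)
      tail₂ : ∀ {x y : Fin h} {xs} → Unique (x ∷ y ∷ xs) → Unique xs
      tail₂ (_ ∷ _ ∷ u) = u
      odd-degree : ∀ {x} → x ∈ vs → xorSum (adj H x) vs ≡ true
      odd-degree x∈ = true-unless (λ h → ¬even (lose x∈ h))
      v-odd : xorSum (adj H v) vs₂ ≡ true
      v-odd = trans (sym (cong₂ (λ a b → a xor (b xor xorSum (adj H v) vs₂)) (irrefl H v) v≁w))
                    (trans (sym (xorSum-↭ (adj H v) π)) (odd-degree v∈))
      w-odd : xorSum (adj H w) vs₂ ≡ true
      w-odd = trans (sym (cong₂ (λ a b → a xor (b xor xorSum (adj H w) vs₂)) (trans (SimpleGraph.sym H w v) v≁w) (irrefl H w)))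
                    (trans (sym (xorSum-↭ (adj H w) π)) (odd-degree w∈))
    place-all (suc s) vs ∣vs∣≤ u | no ¬even | no ¬nonadjacent = complete vs ∣vs∣≤ u odd-degree adjacent
      where
      odd-degree : ∀ {x} → x ∈ vs → xorSum (adj H x) vs ≡ true
      odd-degree x∈ = true-unless (λ h → ¬even (lose x∈ h))
      adjacent : ∀ {x y} → x ∈ vs → y ∈ vs → x ≢ y → adj H x y ≡ true
      adjacent x∈ y∈ x≢y = true-unless (λ h → ¬nonadjacent (lose x∈ (lose y∈ (x≢y , h))))
      complete : ∀ vs → length vs ≤ suc s → Unique vs → (∀ {x} → x ∈ vs → xorSum (adj H x) vs ≡ true) →
                 (∀ {x y} → x ∈ vs → y ∈ vs → x ≢ y → adj H x y ≡ true) → Goal (suc s) vs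
      complete [] _ _ _ _ _ χ _ = [] , ↭-refl , [] , λ _ → refl
      -- Fewer than four vertices cannot occur: with one or three the degrees 0 and 2 are even, and
      -- with two the single edge contradicts the even edge count.
      complete (a ∷ []) _ _ odds _ = ⊥-elim (absurd (odds (here refl)))
        where
        absurd : ¬ (adj H a a xor false ≡ true)
        absurd rewrite irrefl H a = λ ()
      complete (a ∷ b ∷ []) _ ((a≢b ∷ []) ∷ _) _ adjs even = ⊥-elim (absurd even)
        where
        absurd : ¬ ((adj H a b xor false) xor (false xor false) ≡ false)
        absurd rewrite adjs (here refl) (there (here refl)) a≢b = λ ()
      complete (a ∷ b ∷ c ∷ []) _ ((a≢b ∷ a≢c ∷ []) ∷ _) odds adjs = ⊥-elim (absurd (odds (here refl)))
        where
        absurd : ¬ (adj H a a xor (adj H a b xor (adj H a c xor false)) ≡ true)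
        absurd rewrite irrefl H a | adjs (here refl) (there (here refl)) a≢b | adjs (here refl) (there (there (here refl))) a≢c = λ ()
      complete (a ∷ b ∷ c ∷ d ∷ vs) ∣vs∣≤ ((a≢b ∷ a≢c ∷ a≢d ∷ _) ∷ (b≢c ∷ b≢d ∷ _) ∷ (c≢d ∷ _) ∷ _ ∷ u) odds adjs =
        peel-K₄ s a b c d vs ab ac ad bc bd cd
          (rest (irrefl H a) ab ac ad (odds a∈))
          (rest′ (trans (SimpleGraph.sym H b a) ab) (irrefl H b) bc bd (odds b∈))
          (rest″ (trans (SimpleGraph.sym H c a) ac) (trans (SimpleGraph.sym H c b) bc) (irrefl H c) cd (odds c∈))
          (rest‴ (trans (SimpleGraph.sym H d a) ad) (trans (SimpleGraph.sym H d b) bd) (trans (SimpleGraph.sym H d c) cd) (irrefl H d) (odds d∈))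
          (place-all s vs (≤-trans (m≤n+m (length vs) 3) (≤-pred ∣vs∣≤)) u)
        where
        a∈ : a ∈ a ∷ b ∷ c ∷ d ∷ vs
        a∈ = here refl
        b∈ : b ∈ a ∷ b ∷ c ∷ d ∷ vs
        b∈ = there (here refl)
        c∈ : c ∈ a ∷ b ∷ c ∷ d ∷ vs
        c∈ = there (there (here refl))
        d∈ : d ∈ a ∷ b ∷ c ∷ d ∷ vs
        d∈ = there (there (there (here refl)))
        ab = adjs a∈ b∈ a≢b
        ac = adjs a∈ c∈ a≢c
        ad = adjs a∈ d∈ a≢d
        bc = adjs b∈ c∈ b≢c
        bd = adjs b∈ d∈ b≢d
        cd = adjs c∈ d∈ c≢d
        rest : ∀ {p q r t z} → p ≡ false → q ≡ true → r ≡ true → t ≡ true → p xor (q xor (r xor (t xor z))) ≡ true → z ≡ false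
        rest {z = false} refl refl refl refl _ = refl
        rest {z = true} refl refl refl refl ()
        rest′ : ∀ {p q r t z} → p ≡ true → q ≡ false → r ≡ true → t ≡ true → p xor (q xor (r xor (t xor z))) ≡ true → z ≡ false
        rest′ {z = false} refl refl refl refl _ = refl
        rest′ {z = true} refl refl refl refl ()
        rest″ : ∀ {p q r t z} → p ≡ true → q ≡ true → r ≡ false → t ≡ true → p xor (q xor (r xor (t xor z))) ≡ true → z ≡ false
        rest″ {z = false} refl refl refl refl _ = refl
        rest″ {z = true} refl refl refl refl ()
        rest‴ : ∀ {p q r t z} → p ≡ true → q ≡ true → r ≡ true → t ≡ false → p xor (q xor (r xor (t xor z))) ≡ true → z ≡ false
        rest‴ {z = false} refl refl refl refl _ = refl
        rest‴ {z = true} refl refl refl refl ()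

    even-copy : 2 ∣ edgeCount H → ∀ {N} (χ : Coloring N m) → threshold h ≤ N → EvenChromaticCopy H χ
    even-copy even-edges {N} χ N≥ with place-all h (allFin h) (≤-reflexive (length-tabulate {n = h} id)) (Uniqueₚ.allFin⁺ h)
      (trans (sym (odd-countPairs (adj H))) (even⇒odd≡false even-edges)) χ N≥
    ... | zs , zs↭ , unique , even = f , f-inj , λ γ → odd≡false⇒even _ (trans (odd-countPairs (P γ)) (trans (sym (final γ)) (even γ)))
      where
      locate : ∀ v → ∃[ z ] (z ∈ zs × v ≡ proj₁ z)
      locate v = ∈-map⁻ proj₁ (∈-resp-↭ (↭-sym zs↭) (∈-allFin v))
      f : Fin h → Fin N
      f v = proj₂ (proj₁ (locate v))
      f-inj : ∀ {u v} → f u ≡ f v → u ≡ v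
      f-inj {u} {v} eq with locate u | locate v
      ... | z , z∈ , refl | z′ , z′∈ , refl = cong proj₁ (map-unique-injective proj₂ unique z∈ z′∈ eq)
      f-zs : ∀ {z} → z ∈ zs → proj₂ z ≡ f (proj₁ z)
      f-zs {z} z∈ with locate (proj₁ z)
      ... | z′ , z′∈ , eq = cong proj₂ (map-unique-injective proj₁ (unique-resp (↭-sym zs↭) (Uniqueₚ.allFin⁺ h)) z∈ z′∈ eq)
      P : Fin m → Fin h → Fin h → Bool
      P γ u v = adj H u v ∧ does (col χ (f u) (f v) ≟ᶠ γ)
      P-sym : ∀ γ u v → P γ u v ≡ P γ v u
      P-sym γ u v = cong₂ _∧_ (SimpleGraph.sym H u v) (cong (λ c → does (c ≟ᶠ γ)) (colSym χ (f u) (f v)))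
      final : ∀ γ → pairSum (Coloured χ γ) zs ≡ pairSum (P γ) (allFin h)
      final γ = begin
        pairSum (Coloured χ γ) zs
          ≡⟨ pairSum-cong zs (λ {z} {z′} z∈ z′∈ → cong₂ (λ x y → adj H (proj₁ z) (proj₁ z′) ∧ does (col χ x y ≟ᶠ γ)) (f-zs z∈) (f-zs z′∈)) ⟩
        pairSum (λ z z′ → P γ (proj₁ z) (proj₁ z′)) zs
          ≡⟨ sym (pairSum-map (P γ) proj₁ zs) ⟩
        pairSum (P γ) (map proj₁ zs)
          ≡⟨ pairSum-↭ (P γ) (P-sym γ) zs↭ ⟩
        pairSum (P γ) (allFin h) ∎
        where open ≡-Reasoning

-- Removing the dependence of the constant on the graph.

m^j≤j^j*2^m : ∀ j → let i = suc j in ∀ m → m ^ i ≤ i ^ i * 2 ^ m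
m^j≤j^j*2^m j m = begin
  m ^ i                        ≤⟨ ^-monoˡ-≤ i m≤ ⟩
  (i * 2 ^ (m / i)) ^ i        ≡⟨ ^-distribʳ-* i i (2 ^ (m / i)) ⟩
  i ^ i * (2 ^ (m / i)) ^ i    ≡⟨ cong (i ^ i *_) (^-*-assoc 2 (m / i) i) ⟩
  i ^ i * 2 ^ (m / i * i)      ≤⟨ *-monoʳ-≤ (i ^ i) (2^-mono (m/n*n≤m m i)) ⟩
  i ^ i * 2 ^ m ∎
  where
  open ≤-Reasoning
  i = suc j
  -- Since m < (m/i + 1) i and m/i + 1 ≤ 2^(m/i); raising this to the power i restores 2^m.
  m≤ : m ≤ i * 2 ^ (m / i)
  m≤ = begin
    m                       ≡⟨ m≡m%n+[m/n]*n m i ⟩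
    m % i + m / i * i       ≤⟨ +-monoˡ-≤ (m / i * i) (<⇒≤ (m%n<n m i)) ⟩
    suc (m / i) * i         ≤⟨ *-monoˡ-≤ i (n<2^n (m / i)) ⟩
    2 ^ (m / i) * i         ≡⟨ *-comm (2 ^ (m / i)) i ⟩
    i * 2 ^ (m / i) ∎

constant : ℕ → ℕ
constant h = 16 ^ h * suc (4 * h) ^ suc (4 * h)

polynomial-bound : ∀ h m → 1 ≤ m → (16 * (m * m * m * m)) ^ h ≤ constant h * 2 ^ m
polynomial-bound h m 1≤m = begin
  (16 * (m * m * m * m)) ^ h       ≡⟨ ^-distribʳ-* h 16 (m * m * m * m) ⟩
  16 ^ h * (m * m * m * m) ^ h     ≡⟨ cong (λ z → 16 ^ h * z ^ h) (arith m) ⟩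
  16 ^ h * (m ^ 4) ^ h             ≡⟨ cong (16 ^ h *_) (^-*-assoc m 4 h) ⟩
  -- One more factor m makes the exponent 4h + 1 positive, as required for dividing by it.
  16 ^ h * m ^ (4 * h)             ≤⟨ *-monoʳ-≤ (16 ^ h) (≤-trans (m≤n*m _ m {{>-nonZero 1≤m}}) (m^j≤j^j*2^m (4 * h) m)) ⟩
  16 ^ h * (suc (4 * h) ^ suc (4 * h) * 2 ^ m) ≡⟨ sym (*-assoc (16 ^ h) _ _) ⟩
  constant h * 2 ^ m ∎
  where
  open ≤-Reasoning
  arith : ∀ m → m * m * m * m ≡ m * (m * (m * (m * 1)))
  arith = solve-∀

-- The embedding needs n ≥ 2^(K m) (16 m⁴)^h, and the polynomial factor is at most c₀ 2^m.
-- Multiplying n ≥ c₀² by n > 2^(2(K+1)m) and taking square roots gives n ≥ c₀ 2^((K+1)m). Thus H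
-- affects only the bound c₀² on n; this is the origin of the factor 2.
even-copy-exists : ∀ K → (∀ {n m} (χ : Coloring n m) → 1 ≤ m → 2 ^ (K * m) ≤ n → ∃[ x ] ∃[ y ] ∃[ s ] ∃[ t ] Square χ x y s t) →
  ∀ {h} (H : SimpleGraph h) → 2 ∣ edgeCount H → ∀ n → constant h * constant h ≤ n →
  ∀ m (χ : Coloring n m) → 2 ^ (2 * suc K * m) < n → EvenChromaticCopy H χ
even-copy-exists K square H even (suc n) n₀≤n zero χ _ = case col χ zero zero of λ ()
even-copy-exists K square {h} H even n n₀≤n m@(suc _) χ n> =
  Embedding.even-copy H (s≤s z≤n) K (λ χ → square χ (s≤s z≤n)) even χ
    (≤-trans (≤-reflexive (Embedding.threshold-≡ H {m} (s≤s z≤n) K (λ χ → square χ (s≤s z≤n)) h)) enough)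
  where
  open ≤-Reasoning
  c₀ = constant h
  arith₁ : ∀ K m → suc K * m * 2 ≡ 2 * suc K * m
  arith₁ = solve-∀
  arith₂ : ∀ c e → (c * e) * ((c * e) * 1) ≡ (c * c) * (e * (e * 1))
  arith₂ = solve-∀
  arith₃ : ∀ p c e → p * (c * e) ≡ c * (p * e)
  arith₃ = solve-∀
  CE≤n : c₀ * 2 ^ (suc K * m) ≤ n
  CE≤n = ^-cancelˡ-≤ 2 (s≤s z≤n) (begin
    (c₀ * 2 ^ (suc K * m)) ^ 2       ≡⟨ arith₂ c₀ (2 ^ (suc K * m)) ⟩
    c₀ * c₀ * (2 ^ (suc K * m)) ^ 2   ≡⟨ cong (c₀ * c₀ *_) (trans (^-*-assoc 2 (suc K * m) 2) (cong (2 ^_) (arith₁ K m))) ⟩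
    c₀ * c₀ * 2 ^ (2 * suc K * m)     ≤⟨ *-mono-≤ n₀≤n (<⇒≤ n>) ⟩
    n * n                           ≡⟨ cong (n *_) (sym (*-identityʳ n)) ⟩
    n ^ 2 ∎)
  enough : 2 ^ (K * m) * (16 * (m * m * m * m)) ^ h ≤ n
  enough = begin
    2 ^ (K * m) * (16 * (m * m * m * m)) ^ h ≤⟨ *-monoʳ-≤ (2 ^ (K * m)) (polynomial-bound h m (s≤s z≤n)) ⟩
    2 ^ (K * m) * (c₀ * 2 ^ m)                ≡⟨ arith₃ (2 ^ (K * m)) c₀ (2 ^ m) ⟩
    c₀ * (2 ^ (K * m) * 2 ^ m)                ≡⟨ cong (c₀ *_) (trans (sym (^-distribˡ-+-* 2 (K * m) m)) (cong (2 ^_) (+-comm (K * m) m))) ⟩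
    c₀ * 2 ^ (suc K * m)                      ≤⟨ CE≤n ⟩
    n ∎

-- Counting graphs, and the colouring by cosets of a subspace.

graphCount : ℕ → ℕ
graphCount zero = 1
graphCount (suc n) = 2 ^ n * graphCount n

graphCount-≡ : ∀ n → graphCount n ≡ 2 ^ (n C 2)
graphCount-≡ zero = refl
graphCount-≡ (suc n) = trans (cong (2 ^ n *_) (graphCount-≡ n)) (trans (sym (^-distribˡ-+-* 2 n (n C 2)))
  (cong (2 ^_) (trans (cong (_+ n C 2) (sym (nC1≡n n))) (nCk+nC[k+1]≡[n+1]C[k+1] n 1))))

private
  bit : Bool → Fin 2
  bit true = suc zero
  bit false = zero

  bit-injective : ∀ {a b} → bit a ≡ bit b → a ≡ b
  bit-injective {true} {true} _ = refl
  bit-injective {false} {false} _ = refl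

  deleteFirst : ∀ {n} → SimpleGraph (suc n) → SimpleGraph n
  adj (deleteFirst G) i j = adj G (suc i) (suc j)
  SimpleGraph.sym (deleteFirst G) i j = SimpleGraph.sym G (suc i) (suc j)
  irrefl (deleteFirst G) i = irrefl G (suc i)

code : ∀ {n} → SimpleGraph n → Fin (graphCount n)
code {zero} G = zero
code {suc n} G = combine (funToFin (λ j → bit (adj G zero (suc j)))) (code (deleteFirst G))

code-injective : ∀ {n} (G G′ : SimpleGraph n) → code G ≡ code G′ → G ≈G G′
code-injective {suc n} G G′ eq with combine-injective (funToFin (λ j → bit (adj G zero (suc j)))) (code (deleteFirst G))
                                      (funToFin (λ j → bit (adj G′ zero (suc j)))) (code (deleteFirst G′)) eq
... | row≡ , rest≡ = λ where
    zero zero → trans (irrefl G zero) (sym (irrefl G′ zero))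
    zero (suc j) → row j
    (suc i) zero → trans (SimpleGraph.sym G (suc i) zero) (trans (row i) (SimpleGraph.sym G′ zero (suc i)))
    (suc i) (suc j) → code-injective (deleteFirst G) (deleteFirst G′) rest≡ i j
  where
  row : ∀ j → adj G zero (suc j) ≡ adj G′ zero (suc j)
  row j = bit-injective (trans (sym (finToFun-funToFin (λ j → bit (adj G zero (suc j))) j))
    (trans (cong (λ c → finToFun c j) row≡) (finToFun-funToFin (λ j → bit (adj G′ zero (suc j))) j)))

does-sym : ∀ {n} (i j : Fin n) → does (i ≟ᶠ j) ≡ does (j ≟ᶠ i)
does-sym i j with i ≟ᶠ j | j ≟ᶠ i
... | yes _ | yes _ = refl
... | no _ | no _ = refl
... | yes i≡j | no j≢i = ⊥-elim (j≢i (sym i≡j))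
... | no i≢j | yes j≡i = ⊥-elim (i≢j (sym j≡i))

-- The first factor makes `edge a a` the empty graph, so every pair, loops included, determines a
-- coset.
edge : ∀ {n} → Fin n → Fin n → SimpleGraph n
adj (edge a b) i j = not (does (i ≟ᶠ j)) ∧ ((does (i ≟ᶠ a) ∧ does (j ≟ᶠ b)) ∨ (does (i ≟ᶠ b) ∧ does (j ≟ᶠ a)))
SimpleGraph.sym (edge a b) i j = cong₂ _∧_ (cong not (does-sym i j))
  (trans (∨-comm (does (i ≟ᶠ a) ∧ does (j ≟ᶠ b)) _) (cong₂ _∨_ (∧-comm (does (i ≟ᶠ b)) _) (∧-comm (does (i ≟ᶠ a)) _)))
irrefl (edge a b) i with i ≟ᶠ i
... | yes _ = refl
... | no i≢i = ⊥-elim (i≢i refl)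

edge-comm : ∀ {n} (a b : Fin n) → edge a b ≈G edge b a
edge-comm a b i j = cong (not (does (i ≟ᶠ j)) ∧_) (∨-comm (does (i ≟ᶠ a) ∧ does (j ≟ᶠ b)) _)

edge⁻ : ∀ {n} {a b i j : Fin n} → adj (edge a b) i j ≡ true → (i ≡ a × j ≡ b) ⊎ (i ≡ b × j ≡ a)
edge⁻ {a = a} {b} {i} {j} h with i ≟ᶠ j | i ≟ᶠ a | j ≟ᶠ b | i ≟ᶠ b | j ≟ᶠ a
... | no _ | yes p | yes q | _ | _ = inj₁ (p , q)
... | no _ | no _ | _ | yes p | yes q = inj₂ (p , q)
... | no _ | yes _ | no _ | yes p | yes q = inj₂ (p , q)
edge⁻ () | no _ | yes _ | no _ | yes _ | no _
edge⁻ () | no _ | yes _ | no _ | no _ | _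
edge⁻ () | no _ | no _ | _ | yes _ | no _
edge⁻ () | no _ | no _ | _ | no _ | _
edge⁻ () | yes _ | _ | _ | _ | _

edge⁺ : ∀ {n} {a b : Fin n} → a ≢ b → adj (edge a b) a b ≡ true
edge⁺ {a = a} {b} a≢b with a ≟ᶠ b | a ≟ᶠ a | b ≟ᶠ b
... | yes a≡b | _ | _ = ⊥-elim (a≢b a≡b)
... | no _ | yes _ | yes _ = refl
... | no _ | no a≢a | _ = ⊥-elim (a≢a refl)
... | no _ | yes _ | no b≢b = ⊥-elim (b≢b refl)

¬true⇒false : ∀ {b} → b ≢ true → b ≡ false
¬true⇒false {false} _ = refl
¬true⇒false {true} h = ⊥-elim (h refl)

pairSum-false : ∀ {A : Set} {P : A → A → Bool} xs → (∀ {x y} → x ∈ xs → y ∈ xs → P x y ≡ false) → pairSum P xs ≡ false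
pairSum-false [] _ = refl
pairSum-false (x ∷ xs) h = cong₂ _xor_ (xorSum-false xs (λ y∈ → h (here refl) (there y∈)))
                                       (pairSum-false xs (λ x∈ y∈ → h (there x∈) (there y∈)))

pairSum-xor : ∀ {A : Set} (P Q : A → A → Bool) xs → pairSum (λ x y → P x y xor Q x y) xs ≡ pairSum P xs xor pairSum Q xs
pairSum-xor P Q [] = refl
pairSum-xor P Q (x ∷ xs) = trans (cong₂ _xor_ (xorSum-xor (P x) (Q x) xs) (pairSum-xor P Q xs))
  (xor-middle (xorSum (P x) xs) (xorSum (Q x) xs) (pairSum P xs) (pairSum Q xs))

pairSum-∧ : ∀ {A : Set} (P : A → A → Bool) b xs → pairSum (λ x y → P x y ∧ b) xs ≡ pairSum P xs ∧ b
pairSum-∧ P true xs = trans (pairSum-cong xs (λ {x} {y} _ _ → ∧-identityʳ (P x y))) (sym (∧-identityʳ (pairSum P xs)))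
pairSum-∧ P false xs = trans (pairSum-false xs (λ {x} {y} _ _ → ∧-zeroʳ (P x y))) (sym (∧-zeroʳ (pairSum P xs)))

pairSum-xorSum : ∀ {A B : Set} (P : B → A → A → Bool) bs xs →
                 pairSum (λ x y → xorSum (λ b → P b x y) bs) xs ≡ xorSum (λ b → pairSum (P b) xs) bs
pairSum-xorSum P [] xs = pairSum-false xs (λ _ _ → refl)
pairSum-xorSum P (b ∷ bs) xs = trans (pairSum-xor (P b) (λ x y → xorSum (λ b → P b x y) bs) xs)
                                     (cong (pairSum (P b) xs xor_) (pairSum-xorSum P bs xs))

xorSum-δ : ∀ {m} (c : Fin m) (g : Fin m → Bool) → xorSum (λ γ → does (c ≟ᶠ γ) ∧ g γ) (allFin m) ≡ g c
xorSum-δ {m} c g with extract (∈-allFin c)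
... | rest , π = trans (xorSum-↭ _ π) (trans (cong₂ _xor_ head tail) (xor-identityʳ (g c)))
  where
  head : does (c ≟ᶠ c) ∧ g c ≡ g c
  head with c ≟ᶠ c
  ... | yes _ = refl
  ... | no c≢c = ⊥-elim (c≢c refl)
  c∉ : Unique (c ∷ rest) → ∀ {γ} → γ ∈ rest → c ≢ γ
  c∉ (h ∷ _) = All-lookup h
  tail : xorSum (λ γ → does (c ≟ᶠ γ) ∧ g γ) rest ≡ false
  tail = xorSum-false rest off
    where
    off : ∀ {γ} → γ ∈ rest → does (c ≟ᶠ γ) ∧ g γ ≡ false
    off {γ} γ∈ with c ≟ᶠ γ
    ... | yes c≡γ = ⊥-elim (c∉ (unique-resp π (Uniqueₚ.allFin⁺ m)) γ∈ c≡γ)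
    ... | no _ = refl

AllPairs-lookup : ∀ {A : Set} {_∼_ : A → A → Set} {xs} → AllPairs _∼_ xs → ∀ {i j} → i <ᶠ j → lookup xs i ∼ lookup xs j
AllPairs-lookup (x∼ ∷ _) {zero} {suc j} _ = All-lookup x∼ (∈-lookup j)
AllPairs-lookup (_ ∷ ∼s) {suc i} {suc j} (s≤s i<j) = AllPairs-lookup ∼s i<j

module Cosets {n : ℕ} (𝒞 : Subspace n) where

  -- Membership up to pointwise equality, the sense in which the listed elements are closed under
  -- addition.
  record InC (G : SimpleGraph n) : Set where
    constructor inC
    field member : Any.Any (λ G′ → G′ ≈G G) (elems 𝒞)
  open InC

  inC? : ∀ G → Dec (InC G)
  inC? G = map′ inC member (Any.any? (λ G′ → all? (λ i → all? (λ j → adj G′ i j ≟ᵇ adj G i j))) (elems 𝒞))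

  inC-resp : ∀ {G G′} → G ≈G G′ → InC G → InC G′
  inC-resp G≈G′ (inC G∈) = inC (Any.map (λ h i j → trans (h i j) (G≈G′ i j)) G∈)

  inC-empty : ∀ {G} → (∀ i j → adj G i j ≡ false) → InC G
  inC-empty G≈∅ with hasZero 𝒞
  ... | Z , Z∈ , Z≈∅ = inC (lose Z∈ (λ i j → trans (Z≈∅ i j) (sym (G≈∅ i j))))

  inC-+ : ∀ {G G′} → InC G → InC G′ → InC (G +G G′)
  inC-+ (inC G∈) (inC G′∈) with find G∈ | find G′∈
  ... | A , A∈ , A≈ | B , B∈ , B≈ with closed 𝒞 A∈ B∈
  ...   | S , S∈ , S≈ = inC (lose S∈ (λ i j → trans (S≈ i j) (cong₂ _xor_ (A≈ i j) (B≈ i j))))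

  -- Addition is its own inverse: `F x +G G` is the sum over the tail, and adding `F x` again
  -- returns `G`.
  inC-xorSum : ∀ {A : Set} (F : A → SimpleGraph n) xs → (∀ {x} → x ∈ xs → InC (F x)) →
               ∀ G → (∀ i j → adj G i j ≡ xorSum (λ x → adj (F x) i j) xs) → InC G
  inC-xorSum F [] _ G G≈ = inC-empty G≈
  inC-xorSum F (x ∷ xs) F∈ G G≈ = inC-resp difference (inC-+ (F∈ (here refl)) rest)
    where
    rest : InC (F x +G G)
    rest = inC-xorSum F xs (F∈ ∘ there) (F x +G G) (λ i j → trans (cong (adj (F x) i j xor_) (G≈ i j)) (xor-cancel (adj (F x) i j) _))
    difference : (F x +G (F x +G G)) ≈G G
    difference i j = xor-cancel (adj (F x) i j) (adj G i j)

  inC-pairSum : ∀ {A : Set} (F : A → A → SimpleGraph n) xs → (∀ x y → InC (F x y)) →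
                ∀ G → (∀ i j → adj G i j ≡ pairSum (λ x y → adj (F x y) i j) xs) → InC G
  inC-pairSum F [] _ G G≈ = inC-empty G≈
  inC-pairSum {A} F (x ∷ xs) F∈ G G≈ = inC-resp difference (inC-+ row rest)
    where
    rowGraph : List A → SimpleGraph n
    adj (rowGraph ys) i j = xorSum (λ y → adj (F x y) i j) ys
    SimpleGraph.sym (rowGraph ys) i j = xorSum-cong ys (λ {y} _ → SimpleGraph.sym (F x y) i j)
    irrefl (rowGraph ys) i = xorSum-false ys (λ {y} _ → irrefl (F x y) i)
    row : InC (rowGraph xs)
    row = inC-xorSum (F x) xs (λ {y} _ → F∈ x y) (rowGraph xs) (λ i j → refl)
    rest : InC (rowGraph xs +G G)
    rest = inC-pairSum F xs F∈ (rowGraph xs +G G) (λ i j → trans (cong (adj (rowGraph xs) i j xor_) (G≈ i j)) (xor-cancel (adj (rowGraph xs) i j) _))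
    difference : (rowGraph xs +G (rowGraph xs +G G)) ≈G G
    difference i j = xor-cancel (adj (rowGraph xs) i j) (adj G i j)

  -- A greedy choice of one graph per coset: a graph is kept only if its sum with each graph kept so
  -- far lies outside 𝒞.
  reps : List (SimpleGraph n) → List (SimpleGraph n)
  reps [] = []
  reps (G ∷ Gs) with Any.any? (λ R → inC? (G +G R)) (reps Gs)
  ... | yes _ = reps Gs
  ... | no _ = G ∷ reps Gs

  reps-cover : ∀ Gs {G} → G ∈ Gs → Any.Any (λ R → InC (G +G R)) (reps Gs)
  reps-cover (G ∷ Gs) G∈ with Any.any? (λ R → inC? (G +G R)) (reps Gs)
  reps-cover (G ∷ Gs) (here refl) | yes found = found
  reps-cover (G ∷ Gs) (here refl) | no _ = here (inC-empty (λ i j → xor-same (adj G i j)))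
  reps-cover (G ∷ Gs) (there G∈) | yes _ = reps-cover Gs G∈
  reps-cover (G ∷ Gs) (there G∈) | no _ = there (reps-cover Gs G∈)

  reps-separated : ∀ Gs → AllPairs (λ R R′ → ¬ InC (R +G R′)) (reps Gs)
  reps-separated [] = []
  reps-separated (G ∷ Gs) with Any.any? (λ R → inC? (G +G R)) (reps Gs)
  ... | yes _ = reps-separated Gs
  ... | no none = All-tabulate (λ R∈ h → none (lose R∈ h)) ∷ reps-separated Gs

  edges : List (SimpleGraph n)
  edges = cartesianProductWith edge (allFin n) (allFin n)

  R : List (SimpleGraph n)
  R = reps edges

  m : ℕ
  m = length R

  rep : Fin m → SimpleGraph n
  rep = lookup R

  cover : ∀ a b → Any.Any (λ S → InC (edge a b +G S)) R
  cover a b = reps-cover edges (∈-cartesianProductWith⁺ edge (∈-allFin a) (∈-allFin b))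

  cosetOf : Fin n → Fin n → Fin m
  cosetOf a b = Any.index (cover a b)

  -- The graphs `edge a b` and `edge b a` agree only pointwise and are looked up separately;
  -- ordering the endpoints makes the colour symmetric.
  χ : Coloring n m
  col χ a b with a ≤ᶠ? b
  ... | yes _ = cosetOf a b
  ... | no _ = cosetOf b a
  colSym χ a b with a ≤ᶠ? b | b ≤ᶠ? a
  ... | yes a≤b | yes b≤a = cong₂ cosetOf (≤ᶠ-antisym a≤b b≤a) (≤ᶠ-antisym b≤a a≤b)
  ... | yes _ | no _ = refl
  ... | no _ | yes _ = refl
  ... | no a≰b | no b≰a = ⊥-elim (a≰b (≰⇒≥ b≰a))

  edge-rep : ∀ a b → InC (edge a b +G rep (col χ a b))
  edge-rep a b with a ≤ᶠ? b
  ... | yes _ = lookup-index (cover a b)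
  ... | no _ = inC-resp (λ i j → cong (_xor adj (rep (cosetOf b a)) i j) (edge-comm b a i j)) (lookup-index (cover b a))

  separated : ∀ a a′ → a ≢ a′ → ¬ InC (rep a +G rep a′)
  separated a a′ a≢a′ h with <ᶠ-cmp a a′
  ... | tri< a<a′ _ _ = AllPairs-lookup (reps-separated edges) a<a′ h
  ... | tri≈ _ a≡a′ _ = a≢a′ a≡a′
  ... | tri> _ _ a>a′ = AllPairs-lookup (reps-separated edges) a>a′ (inC-resp (λ i j → xor-comm (adj (rep a) i j) (adj (rep a′) i j)) h)

  distinct-elements : ∀ b b′ → lookup (elems 𝒞) b ≈G lookup (elems 𝒞) b′ → b ≡ b′
  distinct-elements b b′ h with <ᶠ-cmp b b′
  ... | tri< b<b′ _ _ = ⊥-elim (AllPairs-lookup (distinct 𝒞) b<b′ h)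
  ... | tri≈ _ b≡b′ _ = b≡b′
  ... | tri> _ _ b>b′ = ⊥-elim (AllPairs-lookup (distinct 𝒞) b>b′ (λ i j → sym (h i j)))

  ∈-C : ∀ b → InC (lookup (elems 𝒞) b)
  ∈-C b = inC (lose (∈-lookup b) (λ i j → refl))

  translate : Fin m → Fin (size 𝒞) → SimpleGraph n
  translate a b = rep a +G lookup (elems 𝒞) b

  -- From r + g = r′ + g′ follows r + r′ = g + g′, an element of 𝒞, whereas distinct representatives
  -- are separated.
  translate-injective : ∀ a b a′ b′ → translate a b ≈G translate a′ b′ → a ≡ a′ × b ≡ b′
  translate-injective a b a′ b′ h with a ≟ᶠ a′
  ... | yes refl = refl , distinct-elements b b′ (λ i j →
          trans (sym (xor-cancel (adj (rep a) i j) _)) (trans (cong (adj (rep a) i j xor_) (h i j)) (xor-cancel (adj (rep a) i j) _)))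
  ... | no a≢a′ = ⊥-elim (separated a a′ a≢a′ (inC-resp (λ i j → sum-of-reps (adj (rep a) i j) (adj (rep a′) i j) _ _ (h i j)) (inC-+ (∈-C b) (∈-C b′))))
    where
    sum-of-reps : ∀ r r′ g g′ → r xor g ≡ r′ xor g′ → g xor g′ ≡ r xor r′
    sum-of-reps r r′ g g′ eq = begin
      g xor g′                       ≡⟨ sym (xor-cancel r (g xor g′)) ⟩
      r xor (r xor (g xor g′))       ≡⟨ cong (r xor_) (sym (xor-assoc r g g′)) ⟩
      r xor ((r xor g) xor g′)       ≡⟨ cong (λ s → r xor (s xor g′)) eq ⟩
      r xor ((r′ xor g′) xor g′)     ≡⟨ cong (r xor_) (trans (xor-assoc r′ g′ g′) (trans (cong (r′ xor_) (xor-same g′)) (xor-identityʳ r′))) ⟩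
      r xor r′ ∎
      where open ≡-Reasoning

  -- The represented cosets are disjoint translates of 𝒞; with more of their elements than graphs,
  -- two of them would share a code.
  m*size≤ : m * size 𝒞 ≤ 2 ^ (n C 2)
  m*size≤ with m * size 𝒞 ≤? graphCount n
  ... | yes h = ≤-trans h (≤-reflexive (graphCount-≡ n))
  ... | no ¬h with pigeonhole (≰⇒> ¬h) (λ i → code (translate (proj₁ (remQuot (size 𝒞) i)) (proj₂ (remQuot {m} (size 𝒞) i))))
  ...   | i , j , i<j , eq with translate-injective _ _ _ _ (code-injective _ _ eq)
  ...     | a≡ , b≡ = ⊥-elim (<ᶠ⇒≢ i<j (trans (sym (combine-remQuot {m} (size 𝒞) i)) (trans (cong₂ combine a≡ b≡) (combine-remQuot {m} (size 𝒞) j))))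

  module _ {h : ℕ} (H : SimpleGraph h) (f : Fin h → Fin n) (f-inj : ∀ {u v} → f u ≡ f v → u ≡ v)
           (even : ∀ γ → pairSum (λ u v → adj H u v ∧ does (col χ (f u) (f v) ≟ᶠ γ)) (allFin h) ≡ false) where

    image : SimpleGraph n
    adj image i j = pairSum (λ u v → adj H u v ∧ adj (edge (f u) (f v)) i j) (allFin h)
    SimpleGraph.sym image i j = pairSum-cong (allFin h) (λ {u} {v} _ _ → cong (adj H u v ∧_) (SimpleGraph.sym (edge (f u) (f v)) i j))
    irrefl image i = pairSum-false (allFin h) (λ {u} {v} _ _ → trans (cong (adj H u v ∧_) (irrefl (edge (f u) (f v)) i)) (∧-zeroʳ (adj H u v)))

    corrected : Fin h → Fin h → SimpleGraph n
    corrected u v = if adj H u v then edge (f u) (f v) +G rep (col χ (f u) (f v)) else emptyGraph n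

    -- Each edge plus the representative of its colour lies in 𝒞. In the sum over the edges of `H`
    -- every representative occurs an even number of times and cancels, and what is left is `image`.
    image∈C : InC image
    image∈C = inC-pairSum corrected (allFin h) corrected∈ image (λ i j → sym (collapse i j))
      where
      corrected∈ : ∀ u v → InC (corrected u v)
      corrected∈ u v with adj H u v
      ... | true = edge-rep (f u) (f v)
      ... | false = inC-empty (λ i j → refl)
      reps-cancel : ∀ i j → pairSum (λ u v → adj H u v ∧ adj (rep (col χ (f u) (f v))) i j) (allFin h) ≡ false
      reps-cancel i j = begin
        pairSum (λ u v → adj H u v ∧ adj (rep (col χ (f u) (f v))) i j) (allFin h)
          ≡⟨ pairSum-cong (allFin h) (λ {u} {v} _ _ → expand u v) ⟩
        pairSum (λ u v → xorSum (λ γ → (adj H u v ∧ does (col χ (f u) (f v) ≟ᶠ γ)) ∧ adj (rep γ) i j) (allFin m)) (allFin h)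
          ≡⟨ pairSum-xorSum (λ γ u v → (adj H u v ∧ does (col χ (f u) (f v) ≟ᶠ γ)) ∧ adj (rep γ) i j) (allFin m) (allFin h) ⟩
        xorSum (λ γ → pairSum (λ u v → (adj H u v ∧ does (col χ (f u) (f v) ≟ᶠ γ)) ∧ adj (rep γ) i j) (allFin h)) (allFin m)
          ≡⟨ xorSum-false (allFin m) (λ {γ} _ → trans (pairSum-∧ (λ u v → adj H u v ∧ does (col χ (f u) (f v) ≟ᶠ γ)) (adj (rep γ) i j) (allFin h))
                                                      (cong (_∧ adj (rep γ) i j) (even γ))) ⟩
        false ∎
        where
        open ≡-Reasoning
        expand : ∀ u v → adj H u v ∧ adj (rep (col χ (f u) (f v))) i j
                         ≡ xorSum (λ γ → (adj H u v ∧ does (col χ (f u) (f v) ≟ᶠ γ)) ∧ adj (rep γ) i j) (allFin m)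
        expand u v with adj H u v
        ... | true = sym (xorSum-δ (col χ (f u) (f v)) (λ γ → adj (rep γ) i j))
        ... | false = sym (xorSum-false (allFin m) (λ _ → refl))
      collapse : ∀ i j → pairSum (λ u v → adj (corrected u v) i j) (allFin h) ≡ adj image i j
      collapse i j = begin
        pairSum (λ u v → adj (corrected u v) i j) (allFin h)
          ≡⟨ pairSum-cong (allFin h) (λ {u} {v} _ _ → split u v) ⟩
        pairSum (λ u v → (adj H u v ∧ adj (edge (f u) (f v)) i j) xor (adj H u v ∧ adj (rep (col χ (f u) (f v))) i j)) (allFin h)
          ≡⟨ pairSum-xor (λ u v → adj H u v ∧ adj (edge (f u) (f v)) i j) (λ u v → adj H u v ∧ adj (rep (col χ (f u) (f v))) i j) (allFin h) ⟩
        adj image i j xor pairSum (λ u v → adj H u v ∧ adj (rep (col χ (f u) (f v))) i j) (allFin h)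
          ≡⟨ trans (cong (adj image i j xor_) (reps-cancel i j)) (xor-identityʳ (adj image i j)) ⟩
        adj image i j ∎
        where
        open ≡-Reasoning
        split : ∀ u v → adj (corrected u v) i j ≡ (adj H u v ∧ adj (edge (f u) (f v)) i j) xor (adj H u v ∧ adj (rep (col χ (f u) (f v))) i j)
        split u v with adj H u v
        ... | true = refl
        ... | false = refl

    -- As `f` is injective, only the pair u, v contributes at (f u, f v). Moving both to the front
    -- of the vertex list isolates its term.
    image-adj : ∀ u v → adj image (f u) (f v) ≡ adj H u v
    image-adj u v with u ≟ᶠ v
    ... | yes refl = trans (irrefl image (f u)) (sym (irrefl H u))
    ... | no u≢v with extract (∈-allFin u)
    ...   | vs₁ , π₁ with ∈-resp-↭ π₁ (∈-allFin v)
    ...     | here v≡u = ⊥-elim (u≢v (sym v≡u))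
    ...     | there v∈₁ with extract v∈₁
    ...       | vs₂ , π₂ = begin
      pairSum P (allFin h)      ≡⟨ pairSum-↭ P P-sym π ⟩
      (P u v xor xorSum (P u) vs₂) xor (xorSum (P v) vs₂ xor pairSum P vs₂)
        ≡⟨ cong₂ _xor_ (cong₂ _xor_ P-uv (xorSum-false vs₂ (λ {w} w∈ → P-off u w (λ { refl → notin w∈ (inj₁ refl) }) (λ { refl → notin w∈ (inj₂ refl) }))))
             (cong₂ _xor_ (xorSum-false vs₂ (λ {w} w∈ → P-off v w (λ { refl → notin w∈ (inj₁ refl) }) (λ { refl → notin w∈ (inj₂ refl) })))
                          (pairSum-false vs₂ (λ {w} {w′} w∈ w′∈ → P-off w w′ (λ { refl → notin w′∈ (inj₁ refl) }) (λ { refl → notin w′∈ (inj₂ refl) })))) ⟩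
      (adj H u v xor false) xor (false xor false) ≡⟨ trans (xor-identityʳ _) (xor-identityʳ _) ⟩
      adj H u v ∎
      where
      open ≡-Reasoning
      π : allFin h ↭ u ∷ v ∷ vs₂
      π = ↭-trans π₁ (prep u π₂)
      P : Fin h → Fin h → Bool
      P u′ v′ = adj H u′ v′ ∧ adj (edge (f u′) (f v′)) (f u) (f v)
      P-sym : ∀ x y → P x y ≡ P y x
      P-sym x y = cong₂ _∧_ (SimpleGraph.sym H x y) (edge-comm (f x) (f y) (f u) (f v))
      P-uv : P u v ≡ adj H u v
      P-uv = trans (cong (adj H u v ∧_) (edge⁺ (u≢v ∘ f-inj))) (∧-identityʳ (adj H u v))
      P-off : ∀ x y → y ≢ u → y ≢ v → P x y ≡ false
      P-off x y y≢u y≢v = trans (cong (adj H x y ∧_) (¬true⇒false (λ t → case edge⁻ {a = f x} {f y} {f u} {f v} t of λ where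
        (inj₁ (_ , fv≡fy)) → y≢v (sym (f-inj fv≡fy))
        (inj₂ (fu≡fy , _)) → y≢u (sym (f-inj fu≡fy))))) (∧-zeroʳ (adj H x y))
      notin : ∀ {w} → w ∈ vs₂ → ¬ (w ≡ u ⊎ w ≡ v)
      notin = outside (unique-resp π (Uniqueₚ.allFin⁺ h))
        where
        outside : Unique (u ∷ v ∷ vs₂) → ∀ {w} → w ∈ vs₂ → ¬ (w ≡ u ⊎ w ≡ v)
        outside ((_ ∷ u∉) ∷ v∉ ∷ _) w∈ (inj₁ refl) = All-lookup u∉ w∈ refl
        outside ((_ ∷ u∉) ∷ v∉ ∷ _) w∈ (inj₂ refl) = All-lookup v∉ w∈ refl

    image-support : ∀ a b → adj image a b ≡ true → (∃[ u ] f u ≡ a) × (∃[ v ] f v ≡ b)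
    image-support a b h = hit a (λ none → missing (λ u v → λ where
        (inj₁ (a≡ , _)) → none (u , sym a≡)
        (inj₂ (a≡ , _)) → none (v , sym a≡))) ,
      hit b (λ none → missing (λ u v → λ where
        (inj₁ (_ , b≡)) → none (v , sym b≡)
        (inj₂ (_ , b≡)) → none (u , sym b≡)))
      where
      hit : ∀ c → ¬ ¬ (∃[ u ] f u ≡ c) → ∃[ u ] f u ≡ c
      hit c = decidable-stable (any? (λ u → f u ≟ᶠ c))
      missing : ¬ (∀ u v → ¬ ((a ≡ f u × b ≡ f v) ⊎ (a ≡ f v × b ≡ f u)))
      missing none = case trans (sym h) (pairSum-false (allFin _) (λ {u} {v} _ _ →
        trans (cong (adj H u v ∧_) (¬true⇒false (none u v ∘ edge⁻))) (∧-zeroʳ (adj H u v)))) of λ ()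

  colour-parity : ∀ {h} (H : SimpleGraph h) (copy : EvenChromaticCopy H χ) γ →
    pairSum (λ u v → adj H u v ∧ does (col χ (proj₁ copy u) (proj₁ copy v) ≟ᶠ γ)) (allFin h) ≡ false
  colour-parity H (f , _ , even) γ =
    trans (sym (odd-countPairs (λ u v → adj H u v ∧ does (col χ (f u) (f v) ≟ᶠ γ)))) (even⇒odd≡false (even γ))

  even-copy⇒copy : ∀ {h} (H : SimpleGraph h) → EvenChromaticCopy H χ → ∃[ G ] (G ∈ elems 𝒞 × IsCopyOf G H)
  even-copy⇒copy H copy@(f , f-inj , _) with find (member (image∈C H f f-inj (colour-parity H copy)))
  ... | G , G∈ , G≈ = G , G∈ , f , f-inj ,
    (λ u v → trans (G≈ (f u) (f v)) (image-adj H f f-inj (colour-parity H copy) u v)) ,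
    (λ a b h → image-support H f f-inj (colour-parity H copy) a b (trans (sym (G≈ a b)) h))

-- Both bounds are freed of logarithms. The first says that a colouring without an even-chromatic
-- copy has at least log₂ n / k colours; the second, after taking log₂, that |𝒞| log₂ n ≤ k 2^(n
-- choose 2). So c = 1/(k log 2).
theorem1p3 : ∃[ k ] (1 ≤ k) ×
    (∀ (h : ℕ) (H : SimpleGraph h) → 2 ∣ edgeCount H →
    ∃[ n₀ ] (∀ (n : ℕ) → n₀ ≤ n →
    (∀ (m : ℕ) (χ : Coloring n m) → 2 ^ (k * m) < n → EvenChromaticCopy H χ) ×
    (∀ (𝒞 : Subspace n) → (∀ G → G ∈ elems 𝒞 → ¬ IsCopyOf G H) →
    n ^ size 𝒞 ≤ 2 ^ (k * 2 ^ (n C 2)))))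
theorem1p3 = k , s≤s z≤n , λ h H even → constant h * constant h , λ n n₀≤n →
  copies H even n n₀≤n , λ 𝒞 no-copy →
    let open Cosets 𝒞
        n≤ = ≮⇒≥ (λ n> → let (G , G∈ , copy) = even-copy⇒copy H (copies H even n n₀≤n m χ n>) in no-copy G G∈ copy)
    in begin
      n ^ size 𝒞                  ≤⟨ ^-monoˡ-≤ (size 𝒞) n≤ ⟩
      (2 ^ (k * m)) ^ size 𝒞      ≡⟨ ^-*-assoc 2 (k * m) (size 𝒞) ⟩
      2 ^ (k * m * size 𝒞)        ≡⟨ cong (2 ^_) (*-assoc k m (size 𝒞)) ⟩
      2 ^ (k * (m * size 𝒞))      ≤⟨ 2^-mono (*-monoʳ-≤ k m*size≤) ⟩
      2 ^ (k * 2 ^ (n C 2)) ∎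
  where
  open ≤-Reasoning
  -- Here A = 14 and 287 = 20 · 14 + 7, the least value that `pairs-too-many` accepts for this A;
  -- the 5 is that of `too-large`.
  K = 5 * 287
  k = 2 * suc K
  copies : ∀ {h} (H : SimpleGraph h) → 2 ∣ edgeCount H → ∀ n → constant h * constant h ≤ n →
           ∀ m (χ : Coloring n m) → 2 ^ (k * m) < n → EvenChromaticCopy H χ
  copies = even-copy-exists K (square-exists 14 287 ≤-refl ≤-refl)
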